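{- Let $p>3$ be a prime, $h\geq 1$, $q=p^h$, and let $a,b\in\mathbb{F}_{q^2}^*$. The polynomial $$f_{a,b}(X)=X\left(1+aX^{q(q-1)}+bX^{2(q-1)}\right)\in\mathbb{F}_{q^2}[X]$$ is a permutation polynomial of $\mathbb{F}_{q^2}$ if and only if either $$a^qb^q=a\left(b^{q+1}-a^{q+1}\right)\quad\text{and}\quad 1-4(b/a)^{q+1}\text{ is a nonzero square in }\mathbb{F}_q,$$ or $$a^{q-1}+3b=0\quad\text{and}\quad -3\left(1-4(b/a)^{q+1}\right)\text{ is a nonzero square in }\mathbb{F}_q.$$
   Context: A polynomial $f\in\mathbb{F}_{q^2}[X]$ is a permutation polynomial (PP) of $\mathbb{F}_{q^2}$ if the map $x\mapsto f(x)$ is a bijection of $\mathbb{F}_{q^2}$. -}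

module Defs where

open import Level using (0ℓ)
open import Data.Nat as ℕ using (ℕ; zero; suc)
open import Data.Fin using (Fin)
open import Data.Product using (∃; _×_)
open import Algebra.Core using (Op₁; Op₂)
open import Algebra.Structures using (IsCommutativeRing)
open import Relation.Binary.PropositionalEquality using (_≡_; _≢_)
open import Function.Bundles using (_↔_)
open import Function.Definitions using (Bijective)

record FiniteField : Set₁ where
  infixl 7 _*_
  infixl 6 _+_
  field
    Carrier : Set
    _+_ _*_ : Op₂ Carrier
    -_ : Op₁ Carrier
    0# 1# : Carrier
    isCommutativeRing : IsCommutativeRing _≡_ _+_ _*_ -_ 0# 1#
    0≢1 : 0# ≢ 1#
    _⁻¹ : Op₁ Carrier
    inverseʳ : ∀ x → x ≢ 0# → x * (x ⁻¹) ≡ 1#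
    size : ℕ
    enum : Carrier ↔ Fin size

module _ (F : FiniteField) where
  open FiniteField F

  pow : Carrier → ℕ → Carrier
  pow x zero = 1#
  pow x (suc n) = x * pow x n

  fromℕ : ℕ → Carrier
  fromℕ zero = 0#
  fromℕ (suc n) = 1# + fromℕ n

  sub : Carrier → Carrier → Carrier
  sub x y = x + (- y)

  IsPermutation : (Carrier → Carrier) → Set
  IsPermutation f = Bijective _≡_ _≡_ f

  -- c is a nonzero square in the subfield F_q = { y | y^q = y }
  IsNonzeroSquareIn𝔽 : ℕ → Carrier → Set
  IsNonzeroSquareIn𝔽 q c = ∃ λ y → pow y q ≡ y × y ≢ 0# × y * y ≡ c

module Submission where

-- Write q = p^h, x̄ = x^q, and let μ be the group of the y with y ȳ = 1.  For x ≠ 0 we have f(x) = x H(y) with y = x^(q-1) ∈ μ, and f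
-- is linear over the subfield, so f permutes the field iff the cubic rational function num / den permutes μ, i.e. iff
-- K(x, y) = (num x den y - num y den x) / (x - y) has no zero with x ≠ y in μ.  K(-, y) is quadratic, with discriminant a quartic E(y), and
-- its roots are off μ iff E(y) / y² is a nonzero square of the subfield.  In the two families of the theorem E is the discriminant
-- in the condition times a perfect square.  Conversely, if there is no collision, then E^((q-1)/2) X² = 1 on μ unless E has a double root
-- there (which is divided out first); applying the derivation θ = X d/dX to E^((q-1)/2) X² = 1 + (X^(q+1) - 1) R, where the power satisfies the differential equation
-- 2 E θG = - θE G, and comparing degrees shows that E is a constant times a square (an argument in the style of Stepanov).  Then the
-- conic K(x + y, x y) = 0 is doubly tangent to the discriminant conic or degenerate, which leads to the two families.

open import Defs
open import Algebra.Bundles using (CommutativeRing)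
import Algebra.Properties.CommutativeMonoid.Sum as BigOperator
import Algebra.Properties.Ring as RingProperties
import Algebra.Solver.Ring as RingSolver
open import Algebra.Solver.Ring.AlmostCommutativeRing using (fromCommutativeRing; _-Raw-AlmostCommutative⟶_)
open import Data.Fin as Fin using (Fin; zero; suc)
open import Data.Fin.Permutation using (Permutation′; permutation)
import Data.Fin.Properties as Fin
open import Data.Maybe using (Maybe; just; nothing)
open import Data.Nat as ℕ using (ℕ; zero; suc; s≤s; z≤n)
open import Data.Nat.Coprimality using (prime⇒coprime; coprime-Bézout)
open import Data.Nat.Divisibility using (divides)
open import Data.Nat.DivMod using (_%_; [m+n]%n≡m%n; m<n⇒m%n≡m)
open import Data.Nat.GCD using (module Bézout)
open import Data.Nat.Primality using (Prime; prime⇒irreducible)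
import Data.Nat.Properties as ℕ
import Data.Nat.Tactic.RingSolver as ℕSolver
open import Data.Product using (∃; _×_; _,_; proj₁; proj₂)
open import Data.Sum as Sum using (_⊎_; inj₁; inj₂; fromInj₁; fromInj₂)
open import Data.Vec.Functional using (Vector; replicate; removeAt)
open import Function.Base using (_∘_)
open import Function.Bundles using (_↔_; _⇔_; mk⇔; Equivalence; Inverse)
open import Function.Definitions using (Injective; Bijective)
open import Function.Properties.Inverse using (↔⇒↣)
open import Level using (0ℓ)
open import Relation.Binary.PropositionalEquality as ≡ using (_≡_)
open import Relation.Nullary using (Dec; yes; no; ¬?; contradiction)
open import Relation.Nullary.Decidable using (map′; _×-dec_; decidable-stable)
open import Relation.Unary using (Decidable)

-- That E is a constant times a square could be extracted from Hasse's bound for the curve z² = E.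
-- Here the hypothesis is extremal: every point of μ carries a nonzero square, so a polynomial
-- identity modulo X^(q+1) - 1 replaces an estimate. A nonzero square c of the subfield satisfies
-- c^((q-1)/2) = 1, and y^(1-q) = y² on μ; this is the origin of X². Since q - 1 = -1 in the field,
-- E^((q-1)/2) obeys the differential equation of E^(-1/2), so two rounds of θ remove first the
-- power and then R. What is left is (X^(q+1) - 1) V = L with deg L ≤ 6 ≤ q + 1, where V = T³ θ(E /
-- T²) for a quadratic T. Hence V is constant, and then 0. The bounds still hold for q = 5, so no
-- small field is treated apart; p > 3 allows the division by 2 and 3 when coefficients are
-- compared. K is symmetric, hence a conic in the sum and the product of x and y, and x = y is the
-- discriminant conic. In the first family K is a product β(x) β(y) of two tangents to it, up to a
-- constant; in the second it is a combination of (x - y)² and such a product s(x) s(y).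

module IntegerSolver {c ℓ} (R : CommutativeRing c ℓ) where
  open import Data.Integer as ℤ using (ℤ; +_; -[1+_]; _⊖_)
  import Data.Integer.Properties as ℤ
  open CommutativeRing R
  open RingProperties ring using (-‿distribˡ-*; -‿distribʳ-*; -‿involutive; -0#≈0#; -‿+-comm)
  open import Relation.Binary.Reasoning.Setoid setoid

  -- Unlike `fromℕ`, this has no trailing zero summand: `nat 1` is `1#` by definition, so the
  -- solver's `# 1` matches the `1#` of the goals.
  nat : ℕ → Carrier
  nat zero = 0#
  nat (suc zero) = 1#
  nat (suc (suc n)) = 1# + nat (suc n)

  int : ℤ → Carrier
  int (+ n) = nat n
  int -[1+ n ] = - nat (suc n)

  nat-suc : ∀ n → nat (suc n) ≈ 1# + nat n
  nat-suc zero = sym (+-identityʳ 1#)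
  nat-suc (suc n) = refl

  nat-+ : ∀ m n → nat (m ℕ.+ n) ≈ nat m + nat n
  nat-+ zero n = sym (+-identityˡ _)
  nat-+ (suc m) n = begin
    nat (suc (m ℕ.+ n))      ≈⟨ nat-suc (m ℕ.+ n) ⟩
    1# + nat (m ℕ.+ n)       ≈⟨ +-congˡ (nat-+ m n) ⟩
    1# + (nat m + nat n)     ≈⟨ +-assoc _ _ _ ⟨
    (1# + nat m) + nat n     ≈⟨ +-congʳ (nat-suc m) ⟨
    nat (suc m) + nat n      ∎

  nat-* : ∀ m n → nat (m ℕ.* n) ≈ nat m * nat n
  nat-* zero n = sym (zeroˡ _)
  nat-* (suc m) n = begin
    nat (n ℕ.+ m ℕ.* n)           ≈⟨ nat-+ n (m ℕ.* n) ⟩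
    nat n + nat (m ℕ.* n)         ≈⟨ +-cong (sym (*-identityˡ _)) (nat-* m n) ⟩
    1# * nat n + nat m * nat n    ≈⟨ distribʳ _ _ _ ⟨
    (1# + nat m) * nat n          ≈⟨ *-congʳ (nat-suc m) ⟨
    nat (suc m) * nat n           ∎

  int-⊖ : ∀ m n → int (m ⊖ n) ≈ nat m - nat n
  int-⊖ zero zero = sym (-‿inverseʳ 0#)
  int-⊖ zero (suc n) = sym (+-identityˡ _)
  int-⊖ (suc m) zero = sym (trans (+-congˡ -0#≈0#) (+-identityʳ _))
  int-⊖ (suc m) (suc n) = begin
    int (suc m ⊖ suc n)                ≡⟨ ≡.cong int (ℤ.[1+m]⊖[1+n]≡m⊖n m n) ⟩
    int (m ⊖ n)                        ≈⟨ int-⊖ m n ⟩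
    nat m - nat n                      ≈⟨ +-congˡ (+-identityˡ _) ⟨
    nat m + (0# - nat n)               ≈⟨ +-congˡ (+-congʳ (-‿inverseʳ 1#)) ⟨
    nat m + ((1# - 1#) - nat n)        ≈⟨ +-congˡ (+-assoc _ _ _) ⟩
    nat m + (1# + (- 1# - nat n))      ≈⟨ +-assoc _ _ _ ⟨
    (nat m + 1#) + (- 1# - nat n)      ≈⟨ +-cong (+-comm _ _) (-‿+-comm 1# (nat n)) ⟩
    (1# + nat m) - (1# + nat n)        ≈⟨ +-cong (nat-suc m) (-‿cong (nat-suc n)) ⟨
    nat (suc m) - nat (suc n)          ∎

  int-+ : ∀ i j → int (i ℤ.+ j) ≈ int i + int j
  int-+ (+ m) (+ n) = nat-+ m n
  int-+ (+ m) -[1+ n ] = int-⊖ m (suc n)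
  int-+ -[1+ m ] (+ n) = trans (int-⊖ n (suc m)) (+-comm _ _)
  int-+ -[1+ m ] -[1+ n ] = begin
    - nat (suc (suc (m ℕ.+ n)))     ≡⟨ ≡.cong (λ k → - nat (suc k)) (ℕ.+-suc m n) ⟨
    - nat (suc m ℕ.+ suc n)         ≈⟨ -‿cong (nat-+ (suc m) (suc n)) ⟩
    - (nat (suc m) + nat (suc n))   ≈⟨ -‿+-comm _ _ ⟨
    - nat (suc m) - nat (suc n)     ∎

  int-neg : ∀ i → int (ℤ.- i) ≈ - int i
  int-neg (+ zero) = sym -0#≈0#
  int-neg (+ suc n) = refl
  int-neg -[1+ n ] = sym (-‿involutive _)

  nat-int-* : ∀ m j → int (+ m ℤ.* j) ≈ nat m * int j
  nat-int-* m (+ n) = trans (reflexive (≡.cong int (≡.sym (ℤ.pos-* m n)))) (nat-* m n)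
  nat-int-* m -[1+ n ] = begin
    int (+ m ℤ.* -[1+ n ])          ≡⟨ ≡.cong int (ℤ.neg-distribʳ-* (+ m) (+ suc n)) ⟨
    int (ℤ.- (+ m ℤ.* + suc n))     ≈⟨ int-neg (+ m ℤ.* + suc n) ⟩
    - int (+ m ℤ.* + suc n)         ≈⟨ -‿cong (nat-int-* m (+ suc n)) ⟩
    - (nat m * nat (suc n))         ≈⟨ -‿distribʳ-* _ _ ⟩
    nat m * - nat (suc n)           ∎

  int-* : ∀ i j → int (i ℤ.* j) ≈ int i * int j
  int-* (+ m) j = nat-int-* m j
  int-* -[1+ m ] j = begin
    int (-[1+ m ] ℤ.* j)            ≡⟨ ≡.cong int (ℤ.neg-distribˡ-* (+ suc m) j) ⟨
    int (ℤ.- (+ suc m ℤ.* j))       ≈⟨ int-neg (+ suc m ℤ.* j) ⟩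
    - int (+ suc m ℤ.* j)           ≈⟨ -‿cong (nat-int-* (suc m) j) ⟩
    - (nat (suc m) * int j)         ≈⟨ -‿distribˡ-* _ _ ⟩
    - nat (suc m) * int j           ∎

  morphism : ℤ.+-*-rawRing -Raw-AlmostCommutative⟶ fromCommutativeRing R
  morphism = record
    { ⟦_⟧ = int ; +-homo = int-+ ; *-homo = int-* ; -‿homo = int-neg ; 0-homo = refl ; 1-homo = refl }

  int≟ : ∀ i j → Maybe (int i ≈ int j)
  int≟ i j with i ℤ.≟ j
  ... | yes i≡j = just (reflexive (≡.cong int i≡j))
  ... | no _ = nothing

  open RingSolver ℤ.+-*-rawRing (fromCommutativeRing R) morphism int≟ public
    using (Polynomial; con; _:+_; _:*_; :-_; _:-_; _:=_; solve)

  infix 9 #_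
  #_ : ∀ {n} → ℕ → Polynomial n
  # k = con (+ k)

  x-y≈0⇒x≈y : ∀ {x y} → x - y ≈ 0# → x ≈ y
  x-y≈0⇒x≈y {x} {y} eq = begin
    x             ≈⟨ solve 2 (λ x y → x := x :- y :+ y) refl x y ⟩
    (x - y) + y   ≈⟨ +-congʳ eq ⟩
    0# + y        ≈⟨ +-identityˡ y ⟩
    y             ∎

  x≈y⇒x-y≈0 : ∀ {x y} → x ≈ y → x - y ≈ 0#
  x≈y⇒x-y≈0 {x} {y} x≈y = trans (+-congʳ x≈y) (-‿inverseʳ y)

  private
    vanish : ∀ {a b} c → a ≈ b → c * (a - b) ≈ 0#
    vanish c a≈b = trans (*-congˡ (x≈y⇒x-y≈0 a≈b)) (zeroʳ c)

  -- An equation is certified by writing x - y as a linear combination of known equations. The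
  -- cofactors are supplied at each use, and the solver only has to check one polynomial identity.
  combine₁ : ∀ {x y a₁ b₁} c₁ → a₁ ≈ b₁ → x - y ≈ c₁ * (a₁ - b₁) → x ≈ y
  combine₁ c₁ e₁ eq = x-y≈0⇒x≈y (trans eq (vanish c₁ e₁))

  combine₂ : ∀ {x y a₁ b₁ a₂ b₂} c₁ → a₁ ≈ b₁ → ∀ c₂ → a₂ ≈ b₂ →
             x - y ≈ c₁ * (a₁ - b₁) + c₂ * (a₂ - b₂) → x ≈ y
  combine₂ c₁ e₁ c₂ e₂ eq = combine₁ c₁ e₁ (trans eq (trans (+-congˡ (vanish c₂ e₂)) (+-identityʳ _)))

  combine₃ : ∀ {x y a₁ b₁ a₂ b₂ a₃ b₃} c₁ → a₁ ≈ b₁ → ∀ c₂ → a₂ ≈ b₂ → ∀ c₃ → a₃ ≈ b₃ →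
             x - y ≈ c₁ * (a₁ - b₁) + c₂ * (a₂ - b₂) + c₃ * (a₃ - b₃) → x ≈ y
  combine₃ c₁ e₁ c₂ e₂ c₃ e₃ eq = combine₂ c₁ e₁ c₂ e₂ (trans eq (trans (+-congˡ (vanish c₃ e₃)) (+-identityʳ _)))

  combine₄ : ∀ {x y a₁ b₁ a₂ b₂ a₃ b₃ a₄ b₄} c₁ → a₁ ≈ b₁ → ∀ c₂ → a₂ ≈ b₂ → ∀ c₃ → a₃ ≈ b₃ → ∀ c₄ → a₄ ≈ b₄ →
             x - y ≈ c₁ * (a₁ - b₁) + c₂ * (a₂ - b₂) + c₃ * (a₃ - b₃) + c₄ * (a₄ - b₄) → x ≈ y
  combine₄ c₁ e₁ c₂ e₂ c₃ e₃ c₄ e₄ eq = combine₃ c₁ e₁ c₂ e₂ c₃ e₃ (trans eq (trans (+-congˡ (vanish c₄ e₄)) (+-identityʳ _)))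

open import Relation.Binary.PropositionalEquality

-- Finite fields: cancellation, powers, Fermat's theorem, characteristic.

module FieldProperties (F : FiniteField) where
  open FiniteField F hiding (_⁻¹)
  open FiniteField F using () renaming (_⁻¹ to infix 8 _⁻¹) public

  commutativeRing : CommutativeRing 0ℓ 0ℓ
  commutativeRing = record { isCommutativeRing = isCommutativeRing }

  open CommutativeRing commutativeRing public
    using (_-_; +-comm; +-assoc; +-identityˡ; +-identityʳ; *-comm; *-assoc; *-identityˡ; *-identityʳ;
           zeroˡ; zeroʳ; distribˡ; distribʳ; +-congˡ; +-congʳ; *-congˡ; *-congʳ; -‿inverseʳ; +-commutativeMonoid; *-commutativeMonoid)
  open IntegerSolver commutativeRing public

  private
    module Enum = Inverse enum

  elements : Fin size → Carrier
  elements = Enum.from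

  elements-injective : Injective _≡_ _≡_ elements
  elements-injective {i} {j} eq = trans (sym (Enum.strictlyInverseˡ i)) (trans (cong Enum.to eq) (Enum.strictlyInverseˡ j))

  infix 4 _≟_
  _≟_ : (x y : Carrier) → Dec (x ≡ y)
  _≟_ = Fin.inj⇒≟ (↔⇒↣ enum)

  any? : ∀ {P : Carrier → Set} → Decidable P → Dec (∃ P)
  any? {P} P? = map′ (λ (i , Pi) → elements i , Pi)
                     (λ (x , Px) → Enum.to x , subst P (sym (Enum.strictlyInverseʳ x)) Px)
                     (Fin.any? (P? ∘ elements))

  -- Pigeonhole: a missed value y, put in front of all the images, would give an injection of
  -- `Fin (suc size)` into `Fin size`.
  injective⇒bijective : ∀ {f : Carrier → Carrier} → Injective _≡_ _≡_ f → Bijective _≡_ _≡_ f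
  injective⇒bijective {f} inj = inj , surj
    where
    surj : ∀ y → ∃ λ x → ∀ {z} → z ≡ x → f z ≡ y
    surj y with any? (λ x → f x ≟ y)
    ... | yes (x , fx≡y) = x , λ z≡x → trans (cong f z≡x) fx≡y
    ... | no ∄x = contradiction (Fin.injective⇒≤ {f = g} g-inj) ℕ.1+n≰n
      where
      g : Fin (suc size) → Fin size
      g zero = Enum.to y
      g (suc i) = Enum.to (f (elements i))

      to-injective : ∀ {u v} → Enum.to u ≡ Enum.to v → u ≡ v
      to-injective {u} {v} eq = trans (sym (Enum.strictlyInverseʳ u)) (trans (cong Enum.from eq) (Enum.strictlyInverseʳ v))

      g-inj : Injective _≡_ _≡_ g
      g-inj {zero} {zero} _ = refl
      g-inj {zero} {suc j} eq = contradiction (elements j , sym (to-injective eq)) ∄x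
      g-inj {suc i} {zero} eq = contradiction (elements i , to-injective eq) ∄x
      g-inj {suc i} {suc j} eq = cong suc (elements-injective (inj (to-injective eq)))

  *-cancelˡ-0 : ∀ {x y} → x ≢ 0# → x * y ≡ 0# → y ≡ 0#
  *-cancelˡ-0 {x} {y} x≢0 xy≡0 = combine₂ (- y) (inverseʳ x x≢0) (x ⁻¹) xy≡0
    (solve 3 (λ x y i → y :- # 0 := :- y :* (x :* i :- # 1) :+ i :* (x :* y :- # 0)) refl x y (x ⁻¹))

  *-cancelˡ : ∀ {x y z} → x ≢ 0# → x * y ≡ x * z → y ≡ z
  *-cancelˡ {x} {y} {z} x≢0 eq = x-y≈0⇒x≈y (*-cancelˡ-0 x≢0 (combine₁ 1# eq
    (solve 3 (λ x y z → x :* (y :- z) :- # 0 := # 1 :* (x :* y :- x :* z)) refl x y z)))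

  x*y≡0 : ∀ {x y} → x * y ≡ 0# → x ≡ 0# ⊎ y ≡ 0#
  x*y≡0 {x} eq with x ≟ 0#
  ... | yes x≡0 = inj₁ x≡0
  ... | no x≢0 = inj₂ (*-cancelˡ-0 x≢0 eq)

  *-nonzero : ∀ {x y} → x ≢ 0# → y ≢ 0# → x * y ≢ 0#
  *-nonzero x≢0 y≢0 eq = y≢0 (*-cancelˡ-0 x≢0 eq)

  1≢0 : 1# ≢ 0#
  1≢0 = 0≢1 ∘ sym

  ⁻¹-nonzero : ∀ {x} → x ≢ 0# → x ⁻¹ ≢ 0#
  ⁻¹-nonzero {x} x≢0 eq = 0≢1 (trans (sym (zeroʳ x)) (trans (cong (x *_) (sym eq)) (inverseʳ x x≢0)))

  infixr 8 _^_
  _^_ : Carrier → ℕ → Carrier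
  _^_ = pow F

  ^-+ : ∀ x m n → x ^ (m ℕ.+ n) ≡ x ^ m * x ^ n
  ^-+ x zero n = sym (*-identityˡ _)
  ^-+ x (suc m) n = trans (cong (x *_) (^-+ x m n)) (sym (*-assoc _ _ _))

  ^-* : ∀ x m n → x ^ (m ℕ.* n) ≡ (x ^ n) ^ m
  ^-* x zero n = refl
  ^-* x (suc m) n = trans (^-+ x n (m ℕ.* n)) (cong (x ^ n *_) (^-* x m n))

  *-^ : ∀ x y n → (x * y) ^ n ≡ x ^ n * y ^ n
  *-^ x y zero = sym (*-identityˡ _)
  *-^ x y (suc n) = trans (cong (x * y *_) (*-^ x y n))
    (solve 4 (λ x y u v → x :* y :* (u :* v) := (x :* u) :* (y :* v)) refl x y (x ^ n) (y ^ n))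

  1-^ : ∀ n → 1# ^ n ≡ 1#
  1-^ zero = refl
  1-^ (suc n) = trans (*-identityˡ _) (1-^ n)

  0-^ : ∀ {n} → 1 ℕ.≤ n → 0# ^ n ≡ 0#
  0-^ (s≤s _) = zeroˡ _

  ^-nonzero : ∀ {x} n → x ≢ 0# → x ^ n ≢ 0#
  ^-nonzero zero x≢0 = 1≢0
  ^-nonzero (suc n) x≢0 = *-nonzero x≢0 (^-nonzero n x≢0)

  ^≡0⇒≡0 : ∀ {x} n → x ^ n ≡ 0# → x ≡ 0#
  ^≡0⇒≡0 {x} n eq with x ≟ 0#
  ... | yes x≡0 = x≡0
  ... | no x≢0 = contradiction eq (^-nonzero n x≢0)

  -- Fermat's theorem and the characteristic

  private
    module ∑ = BigOperator +-commutativeMonoid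
    module ∏ = BigOperator *-commutativeMonoid

    reindex : (f g : Carrier → Carrier) → (∀ x → f (g x) ≡ x) → (∀ x → g (f x) ≡ x) →
              ∀ {n} → Carrier ↔ Fin n → Permutation′ n
    reindex f g fg gf e = permutation (E.to ∘ f ∘ E.from) (E.to ∘ g ∘ E.from)
      (λ i → trans (cong (E.to ∘ f) (E.strictlyInverseʳ _)) (trans (cong E.to (fg _)) (E.strictlyInverseˡ i)))
      (λ i → trans (cong (E.to ∘ g) (E.strictlyInverseʳ _)) (trans (cong E.to (gf _)) (E.strictlyInverseˡ i)))
      where module E = Inverse e

  fromℕ-+ : ∀ m n → fromℕ F (m ℕ.+ n) ≡ fromℕ F m + fromℕ F n
  fromℕ-+ zero n = sym (+-identityˡ _)
  fromℕ-+ (suc m) n = trans (cong (1# +_) (fromℕ-+ m n)) (sym (+-assoc _ _ _))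

  fromℕ-* : ∀ m n → fromℕ F (m ℕ.* n) ≡ fromℕ F m * fromℕ F n
  fromℕ-* zero n = sym (zeroˡ _)
  fromℕ-* (suc m) n = trans (fromℕ-+ n (m ℕ.* n)) (trans (cong (fromℕ F n +_) (fromℕ-* m n))
    (solve 2 (λ m n → n :+ m :* n := (# 1 :+ m) :* n) refl (fromℕ F m) (fromℕ F n)))

  fromℕ-^ : ∀ m n → fromℕ F (m ℕ.^ n) ≡ fromℕ F m ^ n
  fromℕ-^ m zero = +-identityʳ 1#
  fromℕ-^ m (suc n) = trans (fromℕ-* m (m ℕ.^ n)) (cong (fromℕ F m *_) (fromℕ-^ m n))

  -- Translation by 1 permutes the field, so the sum of all elements does not change when 1 is added to each.
  fromℕ-size : fromℕ F size ≡ 0#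
  fromℕ-size = combine₁ (- 1#) total (solve 2 (λ s c → c :- # 0 := :- # 1 :* (s :- (s :+ c))) refl S (fromℕ F size))
    where
    S = ∑.sum elements
    ones : ∀ n → ∑.sum (replicate n 1#) ≡ fromℕ F n
    ones zero = refl
    ones (suc n) = cong (1# +_) (ones n)
    shift = reindex (_+ 1#) (_- 1#) (solve 1 (λ x → x :- # 1 :+ # 1 := x) refl)
                    (solve 1 (λ x → x :+ # 1 :- # 1 := x) refl) enum
    open ≡-Reasoning
    total : S ≡ S + fromℕ F size
    total = begin
      S                                             ≡⟨ ∑.sum-permute elements shift ⟩
      ∑.sum (λ i → elements (Enum.to (elements i + 1#))) ≡⟨ ∑.sum-cong-≗ {size} (λ i → Enum.strictlyInverseʳ _) ⟩
      ∑.sum (λ i → elements i + 1#)                 ≡⟨ ∑.∑-distrib-+ elements (replicate size 1#) ⟩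
      S + ∑.sum (replicate size 1#)                 ≡⟨ cong (S +_) (ones size) ⟩
      S + fromℕ F size                              ∎

  -- Multiplication by c permutes the field and multiplies each nonzero element by c.
  fermat : ∀ {n} → Carrier ↔ Fin (suc n) → ∀ {c} → c ≢ 0# → c ^ n ≡ 1#
  fermat {n} e {c} c≢0 = sym (*-cancelˡ P≢0 (trans (*-identityʳ P) total))
    where
    module E = Inverse e

    -- `unit` replaces 0 by 1, so that the product can run over the whole enumeration and still be
    -- nonzero. `scale` is the factor that `unit` acquires under multiplication by c: 1 at 0, and c
    -- elsewhere.
    unit : Carrier → Carrier
    unit x with x ≟ 0#
    ... | yes _ = 1#
    ... | no _ = x

    scale : Carrier → Carrier
    scale x with x ≟ 0#
    ... | yes _ = 1#
    ... | no _ = c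

    unit-nonzero : ∀ x → unit x ≢ 0#
    unit-nonzero x with x ≟ 0#
    ... | yes _ = 1≢0
    ... | no x≢0 = x≢0

    unit-scale : ∀ x → unit (c * x) ≡ unit x * scale x
    unit-scale x with x ≟ 0# | c * x ≟ 0#
    ... | yes _ | yes _ = sym (*-identityˡ 1#)
    ... | yes refl | no cx≢0 = contradiction (zeroʳ c) cx≢0
    ... | no x≢0 | yes cx≡0 = contradiction cx≡0 (*-nonzero c≢0 x≢0)
    ... | no _ | no _ = *-comm c x

    P = ∏.sum (unit ∘ E.from)

    product-nonzero : ∀ {m} (t : Vector Carrier m) → (∀ i → t i ≢ 0#) → ∏.sum t ≢ 0#
    product-nonzero {zero} t t≢0 = 1≢0
    product-nonzero {suc m} t t≢0 = *-nonzero (t≢0 zero) (product-nonzero (t ∘ suc) (t≢0 ∘ suc))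

    P≢0 : P ≢ 0#
    P≢0 = product-nonzero (unit ∘ E.from) (unit-nonzero ∘ E.from)

    constant : ∀ {m} (t : Vector Carrier m) → (∀ i → t i ≡ c) → ∏.sum t ≡ c ^ m
    constant {zero} t t≡c = refl
    constant {suc m} t t≡c = cong₂ _*_ (t≡c zero) (constant (t ∘ suc) (t≡c ∘ suc))

    scale-0 : scale (E.from (E.to 0#)) ≡ 1#
    scale-0 with E.from (E.to 0#) ≟ 0#
    ... | yes _ = refl
    ... | no ≢0 = contradiction (E.strictlyInverseʳ 0#) ≢0

    scale-≢0 : ∀ i → scale (E.from (Fin.punchIn (E.to 0#) i)) ≡ c
    scale-≢0 i with E.from (Fin.punchIn (E.to 0#) i) ≟ 0#
    ... | yes eq = contradiction (trans (sym (E.strictlyInverseˡ _)) (cong E.to eq)) (Fin.punchInᵢ≢i (E.to 0#) i)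
    ... | no _ = refl

    dilate = reindex (c *_) (c ⁻¹ *_)
      (λ x → combine₁ x (inverseʳ c c≢0) (solve 3 (λ c i x → c :* (i :* x) :- x := x :* (c :* i :- # 1)) refl c (c ⁻¹) x))
      (λ x → combine₁ x (inverseʳ c c≢0) (solve 3 (λ c i x → i :* (c :* x) :- x := x :* (c :* i :- # 1)) refl c (c ⁻¹) x)) e

    open ≡-Reasoning
    total : P ≡ P * c ^ n
    total = begin
      P                                                 ≡⟨ ∏.sum-permute (unit ∘ E.from) dilate ⟩
      ∏.sum (λ i → unit (E.from (E.to (c * E.from i)))) ≡⟨ ∏.sum-cong-≗ {suc n} (λ i → trans (cong unit (E.strictlyInverseʳ _)) (unit-scale (E.from i))) ⟩
      ∏.sum (λ i → unit (E.from i) * scale (E.from i))  ≡⟨ ∏.∑-distrib-+ (unit ∘ E.from) (scale ∘ E.from) ⟩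
      P * ∏.sum (scale ∘ E.from)                        ≡⟨ cong (P *_) (∏.sum-remove {i = E.to 0#} (scale ∘ E.from)) ⟩
      P * (scale (E.from (E.to 0#)) * ∏.sum (removeAt (scale ∘ E.from) (E.to 0#)))
        ≡⟨ cong (P *_) (cong₂ _*_ scale-0 (constant (removeAt (scale ∘ E.from) (E.to 0#)) scale-≢0)) ⟩
      P * (1# * c ^ n)                                  ≡⟨ cong (P *_) (*-identityˡ _) ⟩
      P * c ^ n                                         ∎

  module _ {p : ℕ} (k : ℕ) (p-prime : Prime p) (size≡ : size ≡ p ℕ.^ k) where
    fromℕ-char : fromℕ F p ≡ 0#
    fromℕ-char = ^≡0⇒≡0 k (trans (sym (fromℕ-^ p k)) (trans (cong (fromℕ F) (sym size≡)) fromℕ-size))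

    fromℕ-multiple : ∀ x {m} → fromℕ F m ≡ 0# → fromℕ F (x ℕ.* m) ≡ 0#
    fromℕ-multiple x {m} m≡0 = trans (fromℕ-* x m) (trans (cong (fromℕ F x *_) m≡0) (zeroʳ _))

    -- Bézout for the coprime numbers j and p: if both vanished in the field, so would 1.
    fromℕ-nonzero : ∀ {j} → 0 ℕ.< j → j ℕ.< p → fromℕ F j ≢ 0#
    fromℕ-nonzero {suc j} _ j<p eq with coprime-Bézout (prime⇒coprime p-prime j<p)
    ... | Bézout.+- x y id = 0≢1 (trans (sym (fromℕ-multiple x fromℕ-char)) (trans (cong (fromℕ F) (sym id))
                               (trans (cong (1# +_) (fromℕ-multiple y eq)) (+-identityʳ 1#))))
    ... | Bézout.-+ x y id = 0≢1 (trans (sym (fromℕ-multiple y eq)) (trans (cong (fromℕ F) (sym id))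
                               (trans (cong (1# +_) (fromℕ-multiple x fromℕ-char)) (+-identityʳ 1#))))

-- The operations are parametrised by those of the coefficients so that they also act on the expressions of the
-- ring solver, which then can treat single coefficients of series.
module RawSeries {A : Set} (_+_ _*_ : A → A → A) (-_ : A → A) (0# 1# : A) (nat : ℕ → A) where
  infixl 6 _⊕_ _⊖_
  infixl 7 _⊛_

  -- Polynomials are series with a separate bound `Degree≤`. The ring laws then hold
  -- coefficientwise, and no normal form or leading coefficient has to be maintained.
  Series : Set
  Series = ℕ → A

  _⊕_ _⊛_ _⊖_ : Series → Series → Series
  ⊝_ θ double : Series → Series
  (f ⊕ g) n = f n + g n
  (⊝ f) n = - f n
  f ⊖ g = f ⊕ (⊝ g)
  (f ⊛ g) zero = f 0 * g 0
  (f ⊛ g) (suc n) = (f 0 * g (suc n)) + ((f ∘ suc) ⊛ g) n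
  -- The derivation X d/dX.
  θ f n = nat n * f n
  double f = f ⊕ f

  0ₛ 1ₛ X : Series
  0ₛ _ = 0#
  1ₛ zero = 1#
  1ₛ (suc _) = 0#
  X zero = 0#
  X (suc n) = 1ₛ n

  X^ : ℕ → Series
  X^ zero = 1ₛ
  X^ (suc n) zero = 0#
  X^ (suc n) (suc k) = X^ n k

  linear : A → A → Series
  linear a₀ a₁ 0 = a₀
  linear a₀ a₁ 1 = a₁
  linear a₀ a₁ (suc (suc _)) = 0#

  quadratic : A → A → A → Series
  quadratic a₀ a₁ a₂ zero = a₀
  quadratic a₀ a₁ a₂ (suc n) = linear a₁ a₂ n

  quartic : A → A → A → A → A → Series
  quartic a₀ a₁ a₂ a₃ a₄ 0 = a₀
  quartic a₀ a₁ a₂ a₃ a₄ 1 = a₁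
  quartic a₀ a₁ a₂ a₃ a₄ (suc (suc n)) = quadratic a₂ a₃ a₄ n

  -- `wronskian E T` is T³ θ(E / T²), and `stepanov E T` is what X^(q+1) - 1 times it will be equal
  -- to after both eliminations.
  stepanov wronskian : Series → Series → Series
  stepanov E T = double (double (E ⊛ T)) ⊖ (double E ⊕ θ E) ⊛ (double (double E) ⊖ θ E)
                 ⊕ double E ⊛ (double (double (θ E)) ⊖ θ (θ E))
  wronskian E T = θ E ⊛ T ⊖ double (E ⊛ θ T)

  -- With `l′` = θ l this is -X (X - y)³ θ(E / (X - y)²), so for a quadratic E its vanishing forces
  -- a double root at y.
  pointed-stepanov : Series → A → Series
  pointed-stepanov E y = double E ⊛ l′ ⊖ θ E ⊛ l ⊖ double E ⊛ l
    where
    l = X ⊛ (X ⊖ linear y 0#)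
    l′ = l ⊕ X ⊛ X

-- Series: ring structure, the derivation θ, degrees, evaluation, roots, Frobenius.

module SeriesProperties (F : FiniteField) where
  open FiniteField F using (Carrier; _+_; _*_; -_; 0#; 1#; inverseʳ; size)
  open FieldProperties F
  open RawSeries _+_ _*_ -_ 0# 1# nat public

  private variable
    f f′ g g′ h : Series

  ⊛-cong : f ≗ f′ → g ≗ g′ → f ⊛ g ≗ f′ ⊛ g′
  ⊛-cong p q zero = cong₂ _*_ (p 0) (q 0)
  ⊛-cong p q (suc n) = cong₂ _+_ (cong₂ _*_ (p 0) (q (suc n))) (⊛-cong (p ∘ suc) q n)

  ⊛-zeroˡ : ∀ g → 0ₛ ⊛ g ≗ 0ₛ
  ⊛-zeroˡ g zero = zeroˡ _
  ⊛-zeroˡ g (suc n) = trans (cong₂ _+_ (zeroˡ _) (⊛-zeroˡ g n)) (+-identityˡ 0#)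

  ⊛-identityˡ : ∀ g → 1ₛ ⊛ g ≗ g
  ⊛-identityˡ g zero = *-identityˡ _
  ⊛-identityˡ g (suc n) = trans (cong₂ _+_ (*-identityˡ _) (⊛-zeroˡ g n)) (+-identityʳ _)

  ⊛-distribʳ : ∀ h f g → (f ⊕ g) ⊛ h ≗ f ⊛ h ⊕ g ⊛ h
  ⊛-distribʳ h f g zero = distribʳ _ _ _
  ⊛-distribʳ h f g (suc n) = trans (cong ((f 0 + g 0) * h (suc n) +_) (⊛-distribʳ h (f ∘ suc) (g ∘ suc) n))
    (solve 5 (λ a b c x y → (a :+ b) :* c :+ (x :+ y) := (a :* c :+ x) :+ (b :* c :+ y)) refl
      (f 0) (g 0) (h (suc n)) (((f ∘ suc) ⊛ h) n) (((g ∘ suc) ⊛ h) n))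

  scale : Carrier → Series → Series
  scale c f n = c * f n

  scale-⊛ : ∀ c f g → scale c f ⊛ g ≗ scale c (f ⊛ g)
  scale-⊛ c f g zero = *-assoc _ _ _
  scale-⊛ c f g (suc n) = trans (cong (c * f 0 * g (suc n) +_) (scale-⊛ c (f ∘ suc) g n))
    (solve 4 (λ c a b x → c :* a :* b :+ c :* x := c :* (a :* b :+ x)) refl c (f 0) (g (suc n)) (((f ∘ suc) ⊛ g) n))

  ⊛-suc : ∀ f g n → (f ⊛ g) (suc n) ≡ f (suc n) * g 0 + (f ⊛ (g ∘ suc)) n
  ⊛-suc f g zero = +-comm _ _
  ⊛-suc f g (suc n) = trans (cong (f 0 * g (suc (suc n)) +_) (⊛-suc (f ∘ suc) g n))
    (solve 3 (λ x y z → x :+ (y :+ z) := y :+ (x :+ z)) refl _ _ _)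

  ⊛-comm : ∀ f g → f ⊛ g ≗ g ⊛ f
  ⊛-comm f g zero = *-comm _ _
  ⊛-comm f g (suc n) = trans (cong₂ _+_ (*-comm (f 0) (g (suc n))) (⊛-comm (f ∘ suc) g n)) (sym (⊛-suc g f n))

  ⊛-assoc : ∀ f g h → (f ⊛ g) ⊛ h ≗ f ⊛ (g ⊛ h)
  ⊛-assoc f g h zero = *-assoc _ _ _
  ⊛-assoc f g h (suc n) = begin
    f 0 * g 0 * h (suc n) + ((scale (f 0) (g ∘ suc) ⊕ (f ∘ suc) ⊛ g) ⊛ h) n
      ≡⟨ cong (f 0 * g 0 * h (suc n) +_) (⊛-distribʳ h (scale (f 0) (g ∘ suc)) ((f ∘ suc) ⊛ g) n) ⟩
    f 0 * g 0 * h (suc n) + ((scale (f 0) (g ∘ suc) ⊛ h) n + (((f ∘ suc) ⊛ g) ⊛ h) n)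
      ≡⟨ cong (f 0 * g 0 * h (suc n) +_) (cong₂ _+_ (scale-⊛ (f 0) (g ∘ suc) h n) (⊛-assoc (f ∘ suc) g h n)) ⟩
    f 0 * g 0 * h (suc n) + (f 0 * ((g ∘ suc) ⊛ h) n + ((f ∘ suc) ⊛ (g ⊛ h)) n)
      ≡⟨ solve 5 (λ a b c x y → a :* b :* c :+ (a :* x :+ y) := a :* (b :* c :+ x) :+ y) refl
           (f 0) (g 0) (h (suc n)) (((g ∘ suc) ⊛ h) n) (((f ∘ suc) ⊛ (g ⊛ h)) n) ⟩
    f 0 * (g 0 * h (suc n) + ((g ∘ suc) ⊛ h) n) + ((f ∘ suc) ⊛ (g ⊛ h)) n ∎
    where open ≡-Reasoning

  seriesRing : CommutativeRing 0ℓ 0ℓ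
  seriesRing = record
    { Carrier = Series ; _≈_ = _≗_ ; _+_ = _⊕_ ; _*_ = _⊛_ ; -_ = ⊝_ ; 0# = 0ₛ ; 1# = 1ₛ
    ; isCommutativeRing = record
      { isRing = record
        { +-isAbelianGroup = record
          { isGroup = record
            { isMonoid = record
              { isSemigroup = record
                { isMagma = record
                  { isEquivalence = record
                    { refl = λ _ → refl ; sym = λ p n → sym (p n) ; trans = λ p q n → trans (p n) (q n) }
                  ; ∙-cong = λ p q n → cong₂ _+_ (p n) (q n) }
                ; assoc = λ f g h n → +-assoc _ _ _ }
              ; identity = (λ f n → +-identityˡ _) , (λ f n → +-identityʳ _) }
            ; inverse = (λ f n → trans (+-comm _ _) (-‿inverseʳ _)) , (λ f n → -‿inverseʳ _)
            ; ⁻¹-cong = λ p n → cong -_ (p n) }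
          ; comm = λ f g n → +-comm _ _ }
        ; *-cong = ⊛-cong
        ; *-assoc = ⊛-assoc
        ; *-identity = ⊛-identityˡ , (λ f n → trans (⊛-comm f 1ₛ n) (⊛-identityˡ f n))
        ; distrib = (λ f g h n → trans (⊛-comm f (g ⊕ h) n) (trans (⊛-distribʳ f g h n)
                                   (cong₂ _+_ (⊛-comm g f n) (⊛-comm h f n))))
                  , ⊛-distribʳ }
      ; *-comm = ⊛-comm } }

  module S = IntegerSolver seriesRing

  nat≡fromℕ : ∀ n → nat n ≡ fromℕ F n
  nat≡fromℕ zero = refl
  nat≡fromℕ (suc n) = trans (nat-suc n) (cong (1# +_) (nat≡fromℕ n))

  θ-cong : f ≗ g → θ f ≗ θ g
  θ-cong p n = cong (nat n *_) (p n)

  θ-⊕ : ∀ f g → θ (f ⊕ g) ≗ θ f ⊕ θ g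
  θ-⊕ f g n = distribˡ _ _ _

  θ-⊝ : ∀ f → θ (⊝ f) ≗ ⊝ θ f
  θ-⊝ f n = solve 2 (λ m x → m :* (:- x) := :- (m :* x)) refl (nat n) (f n)

  θ-tail : ∀ f → θ f ∘ suc ≗ θ (f ∘ suc) ⊕ (f ∘ suc)
  θ-tail f n = trans (cong (_* f (suc n)) (nat-suc n))
    (solve 2 (λ m x → (# 1 :+ m) :* x := m :* x :+ x) refl (nat n) (f (suc n)))

  θ-⊛ : ∀ f g → θ (f ⊛ g) ≗ θ f ⊛ g ⊕ f ⊛ θ g
  θ-⊛ f g zero = solve 2 (λ a b → # 0 :* (a :* b) := (# 0 :* a) :* b :+ a :* (# 0 :* b)) refl (f 0) (g 0)
  θ-⊛ f g (suc n) = begin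
    nat (suc n) * (f 0 * g (suc n) + P)
      ≡⟨ distribˡ _ _ _ ⟩
    nat (suc n) * (f 0 * g (suc n)) + nat (suc n) * P
      ≡⟨ cong (nat (suc n) * (f 0 * g (suc n)) +_) (trans (cong (_* P) (nat-suc n)) (trans (distribʳ _ _ _) (cong₂ _+_ (*-identityˡ P) (θ-⊛ (f ∘ suc) g n)))) ⟩
    nat (suc n) * (f 0 * g (suc n)) + (P + ((θ (f ∘ suc) ⊛ g) n + ((f ∘ suc) ⊛ θ g) n))
      ≡⟨ solve 6 (λ m a b x y z → m :* (a :* b) :+ (x :+ (y :+ z)) := (# 0 :* a) :* b :+ (y :+ x) :+ (a :* (m :* b) :+ z)) refl
           (nat (suc n)) (f 0) (g (suc n)) P ((θ (f ∘ suc) ⊛ g) n) (((f ∘ suc) ⊛ θ g) n) ⟩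
    (0# * f 0) * g (suc n) + ((θ (f ∘ suc) ⊛ g) n + P) + (f 0 * (nat (suc n) * g (suc n)) + ((f ∘ suc) ⊛ θ g) n)
      ≡⟨ cong (λ z → (0# * f 0) * g (suc n) + z + (f 0 * (nat (suc n) * g (suc n)) + ((f ∘ suc) ⊛ θ g) n))
           (trans (⊛-cong {g = g} (θ-tail f) (λ _ → refl) n) (⊛-distribʳ g (θ (f ∘ suc)) (f ∘ suc) n)) ⟨
    (0# * f 0) * g (suc n) + ((θ f ∘ suc) ⊛ g) n + (f 0 * (nat (suc n) * g (suc n)) + ((f ∘ suc) ⊛ θ g) n) ∎
    where
    open ≡-Reasoning
    P = ((f ∘ suc) ⊛ g) n

  infixr 8 _**_
  _**_ : Series → ℕ → Series
  f ** zero = 1ₛ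
  f ** suc n = f ⊛ f ** n

  θ-1 : θ 1ₛ ≗ 0ₛ
  θ-1 zero = zeroˡ _
  θ-1 (suc n) = zeroʳ _

  -- The power rule for θ, multiplied by f in order to avoid the exponent m - 1.
  θ-** : ∀ f m → f ⊛ θ (f ** m) ≗ scale (nat m) (θ f ⊛ f ** m)
  θ-** f zero n = trans (⊛-cong {f = f} (λ _ → refl) θ-1 n)
    (trans (trans (⊛-comm f 0ₛ n) (⊛-zeroˡ f n)) (sym (zeroˡ _)))
  θ-** f (suc m) n = begin
    (f ⊛ θ (f ⊛ f ** m)) n                                     ≡⟨ ⊛-cong {f = f} (λ _ → refl) (θ-⊛ f (f ** m)) n ⟩
    (f ⊛ (θ f ⊛ f ** m ⊕ f ⊛ θ (f ** m))) n
      ≡⟨ S.solve 4 (λ f d p e → f S.:* (d S.:* p S.:+ f S.:* e) S.:= d S.:* (f S.:* p) S.:+ (f S.:* e) S.:* f) (λ _ → refl) f (θ f) (f ** m) (θ (f ** m)) n ⟩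
    (θ f ⊛ (f ⊛ f ** m)) n + ((f ⊛ θ (f ** m)) ⊛ f) n          ≡⟨ +-congˡ (⊛-cong {g = f} (θ-** f m) (λ _ → refl) n) ⟩
    (θ f ⊛ (f ⊛ f ** m)) n + (scale (nat m) (θ f ⊛ f ** m) ⊛ f) n  ≡⟨ +-congˡ (scale-⊛ (nat m) (θ f ⊛ f ** m) f n) ⟩
    (θ f ⊛ (f ⊛ f ** m)) n + nat m * ((θ f ⊛ f ** m) ⊛ f) n
      ≡⟨ cong (λ z → (θ f ⊛ (f ⊛ f ** m)) n + nat m * z) (S.solve 3 (λ f d p → (d S.:* p) S.:* f S.:= d S.:* (f S.:* p)) (λ _ → refl) f (θ f) (f ** m) n) ⟩
    (θ f ⊛ (f ⊛ f ** m)) n + nat m * (θ f ⊛ (f ⊛ f ** m)) n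
      ≡⟨ solve 2 (λ x m → x :+ m :* x := (# 1 :+ m) :* x) refl ((θ f ⊛ (f ⊛ f ** m)) n) (nat m) ⟩
    (1# + nat m) * (θ f ⊛ (f ⊛ f ** m)) n                      ≡⟨ *-congʳ (nat-suc m) ⟨
    nat (suc m) * (θ f ⊛ (f ⊛ f ** m)) n ∎
    where open ≡-Reasoning

  Degree≤ : ℕ → Series → Set
  Degree≤ d f = ∀ {k} → d ℕ.< k → f k ≡ 0#

  degree-⊕ : ∀ {d} → Degree≤ d f → Degree≤ d g → Degree≤ d (f ⊕ g)
  degree-⊕ p q d<k = trans (cong₂ _+_ (p d<k) (q d<k)) (+-identityˡ 0#)

  degree-⊝ : ∀ {d} → Degree≤ d f → Degree≤ d (⊝ f)
  degree-⊝ p d<k = trans (cong -_ (p d<k)) (solve 0 (:- # 0 := # 0) refl)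

  degree-⊖ : ∀ {d} → Degree≤ d f → Degree≤ d g → Degree≤ d (f ⊖ g)
  degree-⊖ {f = f} {g = g} p q = degree-⊕ {f = f} {g = ⊝ g} p (degree-⊝ {f = g} q)

  degree-double : ∀ {d} → Degree≤ d f → Degree≤ d (double f)
  degree-double {f = f} p = degree-⊕ {f = f} {g = f} p p

  degree-θ : ∀ {d} → Degree≤ d f → Degree≤ d (θ f)
  degree-θ p d<k = trans (*-congˡ (p d<k)) (zeroʳ _)

  degree-weaken : ∀ {d e} → d ℕ.≤ e → Degree≤ d f → Degree≤ e f
  degree-weaken d≤e p e<k = p (ℕ.≤-<-trans d≤e e<k)

  degree-⊛ : ∀ {d e} → Degree≤ d f → Degree≤ e g → Degree≤ (d ℕ.+ e) (f ⊛ g)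
  degree-⊛ {f} {g} {zero} {e} p q {suc k} e<k = trans (cong₂ _+_
    (trans (cong (f 0 *_) (q e<k)) (zeroʳ _))
    (trans (⊛-cong {g = g} (λ n → p (s≤s z≤n)) (λ _ → refl) k) (⊛-zeroˡ g k))) (+-identityˡ 0#)
  degree-⊛ {f} {g} {suc d} {e} p q {suc k} (s≤s d+e<k) = trans (cong₂ _+_
    (trans (cong (f 0 *_) (q (ℕ.≤-trans (ℕ.≤-<-trans (ℕ.m≤n+m e d) d+e<k) (ℕ.n≤1+n k)))) (zeroʳ _))
    (degree-⊛ {f ∘ suc} {g} {d} {e} (λ d<k → p (s≤s d<k)) q d+e<k)) (+-identityˡ 0#)

  ⊛-constant : Degree≤ 0 f → ∀ g → f ⊛ g ≗ scale (f 0) g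
  ⊛-constant p g zero = refl
  ⊛-constant {f} p g (suc k) = trans (cong (f 0 * g (suc k) +_)
    (trans (⊛-cong {g = g} (λ n → p (s≤s z≤n)) (λ _ → refl) k) (⊛-zeroˡ g k))) (+-identityʳ _)

  degree-1 : Degree≤ 0 1ₛ
  degree-1 (s≤s _) = refl

  degree-** : ∀ {d} → Degree≤ d f → ∀ m → Degree≤ (m ℕ.* d) (f ** m)
  degree-** p zero = degree-1
  degree-** {f} {d} p (suc m) = degree-⊛ {f} {f ** m} {d} p (degree-** {f} p m)

  degree-X^ : ∀ n → Degree≤ n (X^ n)
  degree-X^ zero = degree-1
  degree-X^ (suc n) (s≤s n<k) = degree-X^ n n<k

  degree-linear : ∀ {a b} → Degree≤ 1 (linear a b)
  degree-linear (s≤s (s≤s _)) = refl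

  degree-quadratic : ∀ {a b c} → Degree≤ 2 (quadratic a b c)
  degree-quadratic (s≤s (s≤s (s≤s _))) = refl

  degree-quartic : ∀ {a b c d e} → Degree≤ 4 (quartic a b c d e)
  degree-quartic (s≤s (s≤s (s≤s (s≤s (s≤s _))))) = refl

  X^-shift : ∀ n f k → (X^ n ⊛ f) (n ℕ.+ k) ≡ f k
  X^-shift zero f k = ⊛-identityˡ f k
  X^-shift (suc n) f k = trans (cong₂ _+_ (zeroˡ _) (X^-shift n f k)) (+-identityˡ _)

  X^-low : ∀ n f {k} → k ℕ.< n → (X^ n ⊛ f) k ≡ 0#
  X^-low (suc n) f {zero} _ = zeroˡ _
  X^-low (suc n) f {suc k} (s≤s k<n) = trans (cong₂ _+_ (zeroˡ _) (X^-low n f k<n)) (+-identityˡ _)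

  θ-X^ : ∀ n → θ (X^ n) ≗ scale (nat n) (X^ n)
  θ-X^ zero k = trans (θ-1 k) (sym (zeroˡ _))
  θ-X^ (suc n) zero = trans (zeroˡ _) (sym (zeroʳ _))
  θ-X^ (suc n) (suc k) = begin
    nat (suc k) * X^ n k          ≡⟨ cong (_* X^ n k) (nat-suc k) ⟩
    (1# + nat k) * X^ n k         ≡⟨ distribʳ _ _ _ ⟩
    1# * X^ n k + nat k * X^ n k  ≡⟨ +-congˡ (θ-X^ n k) ⟩
    1# * X^ n k + nat n * X^ n k  ≡⟨ distribʳ _ _ _ ⟨
    (1# + nat n) * X^ n k         ≡⟨ cong (_* X^ n k) (nat-suc n) ⟨
    nat (suc n) * X^ n k          ∎
    where open ≡-Reasoning

  -- A series has no value at a point, so only its first n coefficients are read. Evaluation is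
  -- therefore multiplicative only under degree bounds that n respects.
  eval : ℕ → Series → Carrier → Carrier
  eval zero f x = 0#
  eval (suc n) f x = f 0 + x * eval n (f ∘ suc) x

  eval-cong : ∀ n {x} → (∀ {k} → k ℕ.< n → f k ≡ g k) → eval n f x ≡ eval n g x
  eval-cong zero p = refl
  eval-cong {f} {g} (suc n) {x} p = cong₂ _+_ (p (s≤s z≤n)) (cong (x *_) (eval-cong {f ∘ suc} {g ∘ suc} n (λ k<n → p (s≤s k<n))))

  eval-0 : ∀ n {x} → eval n 0ₛ x ≡ 0#
  eval-0 zero = refl
  eval-0 (suc n) {x} = trans (cong (λ z → 0# + x * z) (eval-0 n)) (solve 1 (λ x → # 0 :+ x :* # 0 := # 0) refl x)

  eval-⊕ : ∀ n f g x → eval n (f ⊕ g) x ≡ eval n f x + eval n g x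
  eval-⊕ zero f g x = sym (+-identityˡ 0#)
  eval-⊕ (suc n) f g x = trans (cong (λ z → f 0 + g 0 + x * z) (eval-⊕ n (f ∘ suc) (g ∘ suc) x))
    (solve 5 (λ a b x u v → a :+ b :+ x :* (u :+ v) := (a :+ x :* u) :+ (b :+ x :* v)) refl
      (f 0) (g 0) x (eval n (f ∘ suc) x) (eval n (g ∘ suc) x))

  eval-scale : ∀ n c f x → eval n (scale c f) x ≡ c * eval n f x
  eval-scale zero c f x = sym (zeroʳ c)
  eval-scale (suc n) c f x = trans (cong (λ z → c * f 0 + x * z) (eval-scale n c (f ∘ suc) x))
    (solve 4 (λ c a x u → c :* a :+ x :* (c :* u) := c :* (a :+ x :* u)) refl c (f 0) x (eval n (f ∘ suc) x))

  eval-⊝ : ∀ n f x → eval n (⊝ f) x ≡ - eval n f x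
  eval-⊝ zero f x = solve 0 (# 0 := :- # 0) refl
  eval-⊝ (suc n) f x = trans (cong (λ z → - f 0 + x * z) (eval-⊝ n (f ∘ suc) x))
    (solve 3 (λ a x u → :- a :+ x :* (:- u) := :- (a :+ x :* u)) refl (f 0) x (eval n (f ∘ suc) x))

  eval-++ : ∀ m n f x → eval (m ℕ.+ n) f x ≡ eval m f x + x ^ m * eval n (f ∘ (m ℕ.+_)) x
  eval-++ zero n f x = solve 1 (λ e → e := # 0 :+ # 1 :* e) refl (eval n f x)
  eval-++ (suc m) n f x = trans (cong (λ z → f 0 + x * z) (eval-++ m n (f ∘ suc) x))
    (solve 5 (λ a x e p r → a :+ x :* (e :+ p :* r) := a :+ x :* e :+ x :* p :* r) refl
      (f 0) x (eval m (f ∘ suc) x) (x ^ m) (eval n (λ k → f (suc (m ℕ.+ k))) x))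

  eval-degree : ∀ {d n} → Degree≤ d f → d ℕ.< n → ∀ x → eval n f x ≡ eval (suc d) f x
  eval-degree {f} {d} {n} p d<n x = begin
    eval n f x                         ≡⟨ cong (λ k → eval k f x) (ℕ.m+[n∸m]≡n d<n) ⟨
    eval (suc d ℕ.+ (n ℕ.∸ suc d)) f x ≡⟨ eval-++ (suc d) (n ℕ.∸ suc d) f x ⟩
    eval (suc d) f x + x ^ suc d * eval (n ℕ.∸ suc d) (f ∘ (suc d ℕ.+_)) x
      ≡⟨ cong (λ z → eval (suc d) f x + x ^ suc d * z) (trans (eval-cong {g = 0ₛ} (n ℕ.∸ suc d) (λ {k} _ → p (s≤s (ℕ.m≤m+n d k)))) (eval-0 (n ℕ.∸ suc d))) ⟩
    eval (suc d) f x + x ^ suc d * 0#  ≡⟨ solve 2 (λ e p → e :+ p :* # 0 := e) refl _ _ ⟩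
    eval (suc d) f x                   ∎
    where open ≡-Reasoning

  eval-⊛ : ∀ {d e} → Degree≤ d f → Degree≤ e g → ∀ x →
           eval (suc (d ℕ.+ e)) (f ⊛ g) x ≡ eval (suc d) f x * eval (suc e) g x
  eval-⊛ {f} {g} {zero} {e} p q x = begin
    eval (suc e) (f ⊛ g) x       ≡⟨ eval-cong {f ⊛ g} {scale (f 0) g} (suc e) (λ {k} _ → ⊛-constant p g k) ⟩
    eval (suc e) (scale (f 0) g) x  ≡⟨ eval-scale (suc e) (f 0) g x ⟩
    f 0 * eval (suc e) g x       ≡⟨ solve 3 (λ a x e → a :* e := (a :+ x :* # 0) :* e) refl (f 0) x _ ⟩
    eval 1 f x * eval (suc e) g x ∎
    where open ≡-Reasoning
  eval-⊛ {f} {g} {suc d} {e} p q x = begin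
    f 0 * g 0 + x * eval (suc (d ℕ.+ e)) (scale (f 0) (g ∘ suc) ⊕ (f ∘ suc) ⊛ g) x
      ≡⟨ cong (λ z → f 0 * g 0 + x * z) (trans (eval-⊕ (suc (d ℕ.+ e)) (scale (f 0) (g ∘ suc)) ((f ∘ suc) ⊛ g) x)
           (cong₂ _+_ (eval-scale (suc (d ℕ.+ e)) (f 0) (g ∘ suc) x) (eval-⊛ {f ∘ suc} {g} (λ d<k → p (s≤s d<k)) q x))) ⟩
    f 0 * g 0 + x * (f 0 * eval (suc (d ℕ.+ e)) (g ∘ suc) x + eval (suc d) (f ∘ suc) x * eval (suc e) g x)
      ≡⟨ solve 6 (λ a b x u v w → a :* b :+ x :* (a :* u :+ v :* w) := a :* (b :+ x :* u) :+ x :* v :* w) refl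
           (f 0) (g 0) x (eval (suc (d ℕ.+ e)) (g ∘ suc) x) (eval (suc d) (f ∘ suc) x) (eval (suc e) g x) ⟩
    f 0 * eval (suc (suc (d ℕ.+ e))) g x + x * eval (suc d) (f ∘ suc) x * eval (suc e) g x
      ≡⟨ cong (λ z → f 0 * z + x * eval (suc d) (f ∘ suc) x * eval (suc e) g x) (eval-degree q (s≤s (ℕ.m≤n+m e (suc d))) x) ⟩
    f 0 * eval (suc e) g x + x * eval (suc d) (f ∘ suc) x * eval (suc e) g x
      ≡⟨ distribʳ _ _ _ ⟨
    (f 0 + x * eval (suc d) (f ∘ suc) x) * eval (suc e) g x ∎
    where open ≡-Reasoning

  eval-** : ∀ {d} → Degree≤ d f → ∀ m x → eval (suc (m ℕ.* d)) (f ** m) x ≡ eval (suc d) f x ^ m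
  eval-** p zero x = solve 1 (λ x → # 1 :+ x :* # 0 := # 1) refl x
  eval-** {f} {d} p (suc m) x = trans (eval-⊛ {f} {f ** m} {d} p (degree-** {f} p m) x) (cong (eval (suc d) f x *_) (eval-** {f} p m x))

  eval-monomial : ∀ n f x → (∀ {k} → k ℕ.< n → f k ≡ 0#) → eval (suc n) f x ≡ x ^ n * f n
  eval-monomial n f x p = trans (cong (λ k → eval k f x) (ℕ.+-comm 1 n)) (trans (eval-++ n 1 f x)
    (trans (cong₂ _+_ (trans (eval-cong {g = 0ₛ} n p) (eval-0 n)) (cong (λ k → x ^ n * (f k + x * 0#)) (ℕ.+-identityʳ n)))
      (solve 3 (λ p a x → # 0 :+ p :* (a :+ x :* # 0) := p :* a) refl (x ^ n) (f n) x)))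

  X^-leading : ∀ n → X^ n n ≡ 1#
  X^-leading zero = refl
  X^-leading (suc n) = X^-leading n

  X^-below : ∀ n {k} → k ℕ.< n → X^ n k ≡ 0#
  X^-below (suc n) {zero} _ = refl
  X^-below (suc n) {suc k} (s≤s k<n) = X^-below n k<n

  eval-X^ : ∀ n x → eval (suc n) (X^ n) x ≡ x ^ n
  eval-X^ n x = trans (eval-monomial n (X^ n) x (X^-below n)) (trans (cong (x ^ n *_) (X^-leading n)) (*-identityʳ _))

  -- Roots

  -- Synthetic division: the coefficients of (f(X) - f(r)) / (X - r) are the Horner tails of f at r.
  quotient : ℕ → Series → Carrier → Series
  quotient zero f r k = 0#
  quotient (suc n) f r zero = eval n (f ∘ suc) r
  quotient (suc n) f r (suc k) = quotient n (f ∘ suc) r k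

  division : ∀ n f r x → eval (suc n) f x - eval (suc n) f r ≡ (x - r) * eval n (quotient (suc n) f r) x
  division zero f r x = solve 3 (λ a r x → (a :+ x :* # 0) :- (a :+ r :* # 0) := (x :- r) :* # 0) refl (f 0) r x
  division (suc n) f r x = combine₁ x (division n (f ∘ suc) r x)
    (solve 6 (λ a x r ax ar q → ((a :+ x :* ax) :- (a :+ r :* ar)) :- (x :- r) :* (ar :+ x :* q) :=
                                x :* ((ax :- ar) :- (x :- r) :* q)) refl
      (f 0) x r (eval (suc n) (f ∘ suc) x) (eval (suc n) (f ∘ suc) r) (eval n (quotient (suc n) (f ∘ suc) r) x))

  quotient≡0 : ∀ n f r → (∀ {k} → k ℕ.< n → quotient (suc n) f r k ≡ 0#) → eval (suc n) f r ≡ 0# →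
               ∀ {k} → k ℕ.< suc n → f k ≡ 0#
  quotient≡0 zero f r _ root {zero} _ = trans (solve 2 (λ a r → a := a :+ r :* # 0) refl (f 0) r) root
  quotient≡0 zero f r _ root {suc k} (s≤s ())
  quotient≡0 (suc n) f r q≡0 root {zero} _ = combine₂ 1# root (- r) (q≡0 (s≤s z≤n))
    (solve 3 (λ a r e → a :- # 0 := # 1 :* ((a :+ r :* e) :- # 0) :+ (:- r) :* (e :- # 0)) refl (f 0) r (eval (suc n) (f ∘ suc) r))
  quotient≡0 (suc n) f r q≡0 root {suc k} (s≤s k<) =
    quotient≡0 n (f ∘ suc) r (λ k<n → q≡0 (s≤s k<n)) (q≡0 (s≤s z≤n)) k<

  roots : ∀ n f (points : Fin n → Carrier) → Injective _≡_ _≡_ points → (∀ i → eval n f (points i) ≡ 0#) →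
          ∀ {k} → k ℕ.< n → f k ≡ 0#
  roots (suc n) f points inj root = quotient≡0 n f r
    (roots n (quotient (suc n) f r) (points ∘ suc) (Fin.suc-injective ∘ inj) quotient-root) (root zero)
    where
    r = points zero
    quotient-root : ∀ i → eval n (quotient (suc n) f r) (points (suc i)) ≡ 0#
    quotient-root i = *-cancelˡ-0 (λ x-r≡0 → contradiction (inj (x-y≈0⇒x≈y x-r≡0)) λ ())
      (trans (sym (division n f r (points (suc i)))) (x≈y⇒x-y≈0 (trans (root (suc i)) (sym (root zero)))))

  roots-everywhere : ∀ {n} f → n ℕ.≤ size → (∀ x → eval n f x ≡ 0#) → ∀ {k} → k ℕ.< n → f k ≡ 0#
  roots-everywhere {n} f n≤size root = roots n f (elements ∘ λ i → Fin.inject≤ i n≤size)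
    (Fin.inject≤-injective n≤size n≤size _ _ ∘ elements-injective) (λ i → root _)

  -- θ((c + X)^m) (c + X) = m X (c + X)^m, which vanishes in characteristic m.
  module _ {m : ℕ} (m≡0 : nat (suc m) ≡ 0#) (invertible : ∀ {k} → k ℕ.< m → nat (suc k) ≢ 0#) where
    private
      module _ (c : Carrier) (c≢0 : c ≢ 0#) where
        c+X = linear c 1#

        -- The constant term c is invertible, so (c + X) θ((c + X)^m) = 0 forces the coefficients of
        -- the second factor to vanish one after the other.
        θ-zero : ∀ n → θ (c+X ** suc m) n ≡ 0#
        θ-zero zero = zeroˡ _
        θ-zero (suc n) = *-cancelˡ-0 c≢0 (trans (sym (trans (cong (c * θ (c+X ** suc m) (suc n) +_) below) (+-identityʳ _)))
          (trans (θ-** c+X (suc m) (suc n)) (trans (cong (_* (θ c+X ⊛ c+X ** suc m) (suc n)) m≡0) (zeroˡ _))))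
          where
          below : ((c+X ∘ suc) ⊛ θ (c+X ** suc m)) n ≡ 0#
          below = trans (⊛-cong {g = θ (c+X ** suc m)} (λ { zero → refl ; (suc _) → refl }) (λ _ → refl) n)
                        (trans (⊛-identityˡ (θ (c+X ** suc m)) n) (θ-zero n))

        -- This takes the place of the divisibility of binomial coefficients by p: θ multiplies the
        -- coefficient by an invertible number, and the product is 0.
        middle : ∀ {k} → k ℕ.< m → (c+X ** suc m) (suc k) ≡ 0#
        middle k<m = *-cancelˡ-0 (invertible k<m) (θ-zero (suc _))

        top : ∀ n → (c+X ** n) n ≡ 1#
        top zero = refl
        top (suc n) = trans (cong₂ _+_ (trans (cong (c *_) (degree-** {c+X} {1} degree-linear n n*1<)) (zeroʳ c))
          (trans (⊛-cong {g = c+X ** n} (λ { zero → refl ; (suc _) → refl }) (λ _ → refl) n)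
            (trans (⊛-identityˡ (c+X ** n) n) (top n)))) (+-identityˡ 1#)
          where
          n*1< : n ℕ.* 1 ℕ.< suc n
          n*1< = s≤s (ℕ.≤-reflexive (ℕ.*-identityʳ n))

        bottom : ∀ n → (c+X ** n) 0 ≡ c ^ n
        bottom zero = refl
        bottom (suc n) = cong (c *_) (bottom n)

        expand : ∀ y → (c + y) ^ suc m ≡ c ^ suc m + y ^ suc m
        expand y = begin
          (c + y) ^ suc m                            ≡⟨ cong (_^ suc m) (solve 2 (λ c y → c :+ y := c :+ y :* (# 1 :+ y :* # 0)) refl c y) ⟩
          eval 2 c+X y ^ suc m                         ≡⟨ eval-** {c+X} degree-linear (suc m) y ⟨
          eval (suc (suc m ℕ.* 1)) (c+X ** suc m) y    ≡⟨ cong (λ k → eval (suc k) (c+X ** suc m) y) (ℕ.*-identityʳ (suc m)) ⟩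
          (c+X ** suc m) 0 + y * eval (suc m) ((c+X ** suc m) ∘ suc) y
            ≡⟨ cong₂ (λ u v → u + y * v) (bottom (suc m)) (eval-monomial m ((c+X ** suc m) ∘ suc) y middle) ⟩
          c ^ suc m + y * (y ^ m * (c+X ** suc m) (suc m))
            ≡⟨ cong (λ z → c ^ suc m + y * (y ^ m * z)) (top (suc m)) ⟩
          c ^ suc m + y * (y ^ m * 1#)               ≡⟨ solve 3 (λ a y p → a :+ y :* (p :* # 1) := a :+ y :* p) refl (c ^ suc m) y (y ^ m) ⟩
          c ^ suc m + y ^ suc m                      ∎
          where open ≡-Reasoning

    frobenius : ∀ x y → (x + y) ^ suc m ≡ x ^ suc m + y ^ suc m
    frobenius x y with x ≟ 0#
    ... | yes refl = trans (cong (_^ suc m) (+-identityˡ y)) (sym (trans (cong (_+ y ^ suc m) (zeroˡ _)) (+-identityˡ _)))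
    ... | no x≢0 = expand x x≢0 y

-- Odd prime powers.

parity : ∀ n → ∃ λ k → n ≡ k ℕ.* 2 ⊎ n ≡ suc (k ℕ.* 2)
parity zero = 0 , inj₁ refl
parity (suc n) with parity n
... | k , inj₁ refl = k , inj₂ refl
... | k , inj₂ refl = suc k , inj₁ refl

odd-^ : ∀ {a} → ∃ (λ k → a ≡ suc (k ℕ.* 2)) → ∀ n → ∃ λ k → a ℕ.^ n ≡ suc (k ℕ.* 2)
odd-^ _ zero = 0 , refl
odd-^ {a} (k , refl) (suc n) with odd-^ {a} (k , refl) n
... | l , eq = k ℕ.+ l ℕ.+ k ℕ.* l ℕ.* 2 , trans (cong (a ℕ.*_) eq) (product k l)
  where
  product : ∀ k l → suc (k ℕ.* 2) ℕ.* suc (l ℕ.* 2) ≡ suc ((k ℕ.+ l ℕ.+ k ℕ.* l ℕ.* 2) ℕ.* 2)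
  product = ℕSolver.solve-∀

odd-prime : ∀ {p} → Prime p → 3 ℕ.< p → ∃ λ k → p ≡ suc (k ℕ.* 2)
odd-prime {p} p-prime 3<p with parity p
... | k , inj₂ eq = k , eq
... | k , inj₁ eq with prime⇒irreducible p-prime {2} (divides k eq)
...   | inj₂ refl = contradiction 3<p λ { (s≤s (s≤s ())) }

-- The field of order p^(2h): characteristic and additivity of Frobenius.

module PrimePower (F : FiniteField) {p h : ℕ} (p-prime : Prime p) (3<p : 3 ℕ.< p) (1≤h : 1 ℕ.≤ h)
         (size≡ : FiniteField.size F ≡ (p ℕ.^ h) ℕ.^ 2) where
  open FiniteField F using (Carrier; _+_; 0#; size)
  open FieldProperties F
  open SeriesProperties F

  private
    size≡p^ : size ≡ p ℕ.^ (h ℕ.* 2)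
    size≡p^ = trans size≡ (ℕ.^-*-assoc p h 2)

  odd-power : ∃ λ m → p ℕ.^ h ≡ suc (m ℕ.* 2)
  odd-power = odd-^ (odd-prime p-prime 3<p) h

  2≤half : 2 ℕ.≤ proj₁ odd-power
  2≤half = large (proj₁ odd-power) (subst (3 ℕ.<_) (proj₂ odd-power) (ℕ.<-≤-trans 3<p p≤p^h))
    where
    p≤p^h : p ℕ.≤ p ℕ.^ h
    p≤p^h = ℕ.≤-trans (ℕ.≤-reflexive (sym (ℕ.^-identityʳ p))) (ℕ.^-monoʳ-≤ p ⦃ ℕ.>-nonZero (ℕ.≤-trans (s≤s z≤n) 3<p) ⦄ 1≤h)
    large : ∀ m → 3 ℕ.< suc (m ℕ.* 2) → 2 ℕ.≤ m
    large zero (s≤s ())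
    large (suc zero) (s≤s (s≤s (s≤s ())))
    large (suc (suc m)) _ = s≤s (s≤s z≤n)

  nat-nonzero : ∀ {j} → j ℕ.< 3 → nat (suc j) ≢ 0#
  nat-nonzero {j} j<3 eq = fromℕ-nonzero (h ℕ.* 2) p-prime size≡p^ (s≤s z≤n) (ℕ.≤-trans (s≤s j<3) 3<p)
    (trans (sym (nat≡fromℕ (suc j))) eq)

  ^-p-+ : ∀ x y → (x + y) ^ p ≡ x ^ p + y ^ p
  ^-p-+ = additive p refl
    where
    additive : ∀ p′ → p ≡ p′ → ∀ x y → (x + y) ^ p′ ≡ x ^ p′ + y ^ p′
    additive zero refl = contradiction 3<p λ ()
    additive (suc n) refl = frobenius (trans (nat≡fromℕ p) (fromℕ-char (h ℕ.* 2) p-prime size≡p^))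
      (λ {k} k<n eq → fromℕ-nonzero (h ℕ.* 2) p-prime size≡p^ (s≤s z≤n) (s≤s k<n) (trans (sym (nat≡fromℕ (suc k))) eq))

  ^-p^-+ : ∀ k x y → (x + y) ^ (p ℕ.^ k) ≡ x ^ (p ℕ.^ k) + y ^ (p ℕ.^ k)
  ^-p^-+ zero x y = distribʳ _ x y
  ^-p^-+ (suc k) x y = trans (^-* (x + y) p (p ℕ.^ k)) (trans (cong (_^ p) (^-p^-+ k x y)) (trans (^-p-+ _ _)
    (cong₂ _+_ (sym (^-* x p (p ℕ.^ k))) (sym (^-* y p (p ℕ.^ k))))))

-- Conjugation x ↦ x^q and the unit circle.

module QuadraticExtension (F : FiniteField) (q m : ℕ) (q≡ : q ≡ suc (m ℕ.* 2)) (2≤m : 2 ℕ.≤ m)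
         (size≡ : FiniteField.size F ≡ q ℕ.^ 2) (3≢0 : fromℕ F 3 ≢ FiniteField.0# F)
         (conj-+ : ∀ x y → pow F (FiniteField._+_ F x y) q ≡ FiniteField._+_ F (pow F x q) (pow F y q)) where
  open FiniteField F using (Carrier; _+_; _*_; -_; 0#; 1#; inverseʳ; size; enum)
  open FieldProperties F public
  open SeriesProperties F public

  5≤q : 5 ℕ.≤ q
  5≤q = subst (5 ℕ.≤_) (sym q≡) (s≤s (ℕ.*-monoˡ-≤ 2 2≤m))

  group-order : ℕ
  group-order = (m ℕ.* 2) ℕ.* suc q

  size≡suc : size ≡ suc group-order
  size≡suc = trans size≡ (trans (cong (λ q → q ℕ.^ 2) q≡) (trans (square m) (cong (λ q → suc (m ℕ.* 2 ℕ.* suc q)) (sym q≡))))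
    where
    square : ∀ m → suc (m ℕ.* 2) ℕ.* (suc (m ℕ.* 2) ℕ.* 1) ≡ suc (m ℕ.* 2 ℕ.* suc (suc (m ℕ.* 2)))
    square = ℕSolver.solve-∀

  ^-group-order : ∀ {x} → x ≢ 0# → x ^ group-order ≡ 1#
  ^-group-order = fermat (subst (λ k → Carrier ↔ Fin k) size≡suc enum)

  nat-q : nat q ≡ 0#
  nat-q = trans (nat≡fromℕ q) (^≡0⇒≡0 2 (trans (sym (fromℕ-^ q 2)) (trans (cong (fromℕ F) (sym size≡)) fromℕ-size)))

  -- q = 2m + 1 vanishes in the field, so 2 = 0 would give 1 = 0.
  2≢0 : nat 2 ≢ 0#
  2≢0 2≡0 = 1≢0 (combine₂ 1# (trans (sym (nat-suc (m ℕ.* 2))) (trans (cong nat (sym q≡)) nat-q)) (- 1#)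
    (trans (nat-* m 2) (trans (cong (nat m *_) 2≡0) (zeroʳ _)))
    (solve 1 (λ x → # 1 :- # 0 := # 1 :* (# 1 :+ x :- # 0) :+ (:- # 1) :* (x :- # 0)) refl (nat (m ℕ.* 2))))

  nat3≢0 : nat 3 ≢ 0#
  nat3≢0 eq = 3≢0 (trans (sym (nat≡fromℕ 3)) eq)

  conj : Carrier → Carrier
  conj x = x ^ q

  conj-* : ∀ x y → conj (x * y) ≡ conj x * conj y
  conj-* x y = *-^ x y q

  conj-0 : conj 0# ≡ 0#
  conj-0 = 0-^ (ℕ.≤-trans (s≤s z≤n) 5≤q)

  conj-1 : conj 1# ≡ 1#
  conj-1 = 1-^ q

  conj-neg : ∀ x → conj (- x) ≡ - conj x
  conj-neg x = combine₁ 1# (trans (sym (conj-+ (- x) x)) (trans (cong conj (trans (+-comm (- x) x) (-‿inverseʳ x))) conj-0))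
    (solve 2 (λ u v → u :- (:- v) := # 1 :* (u :+ v :- # 0)) refl (conj (- x)) (conj x))

  conj-sub : ∀ x y → conj (x - y) ≡ conj x - conj y
  conj-sub x y = trans (conj-+ x (- y)) (cong (conj x +_) (conj-neg y))

  conj-nat : ∀ n → conj (nat n) ≡ nat n
  conj-nat zero = conj-0
  conj-nat (suc zero) = conj-1
  conj-nat (suc (suc n)) = trans (conj-+ 1# (nat (suc n))) (cong₂ _+_ conj-1 (conj-nat (suc n)))

  conj-involutive : ∀ x → conj (conj x) ≡ x
  conj-involutive x with x ≟ 0#
  ... | yes refl = trans (cong conj conj-0) conj-0
  ... | no x≢0 = begin
    conj (conj x)          ≡⟨ ^-* x q q ⟨
    x ^ (q ℕ.* q)          ≡⟨ cong (x ^_) (trans (cong (q ℕ.*_) (sym (ℕ.*-identityʳ q))) (trans (sym size≡) size≡suc)) ⟩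
    x * x ^ group-order    ≡⟨ cong (x *_) (^-group-order x≢0) ⟩
    x * 1#                 ≡⟨ *-identityʳ x ⟩
    x                      ∎
    where open ≡-Reasoning

  conj-nonzero : ∀ {x} → x ≢ 0# → conj x ≢ 0#
  conj-nonzero = ^-nonzero q

  conj≡* : ∀ x → conj x ≡ x * x ^ (m ℕ.* 2)
  conj≡* x = cong (x ^_) q≡

  conj-⁻¹ : ∀ {x} → x ≢ 0# → conj (x ⁻¹) ≡ conj x ⁻¹
  conj-⁻¹ {x} x≢0 = *-cancelˡ (conj-nonzero x≢0) (trans (sym (conj-* x (x ⁻¹)))
    (trans (cong conj (inverseʳ x x≢0)) (trans conj-1 (sym (inverseʳ (conj x) (conj-nonzero x≢0))))))

  Unit : Carrier → Set
  Unit y = y * conj y ≡ 1#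

  unit-nonzero : ∀ {y} → Unit y → y ≢ 0#
  unit-nonzero u refl = 0≢1′ (trans (sym (zeroˡ _)) u)
    where 0≢1′ = FiniteField.0≢1 F

  private
    -- Multiplication by X adds the missing root 0.
    prepend : Series → Series
    prepend f zero = 0#
    prepend f (suc k) = f k

    roots-nonzero : ∀ f → (∀ {x} → x ≢ 0# → eval group-order f x ≡ 0#) → ∀ {k} → k ℕ.< group-order → f k ≡ 0#
    roots-nonzero f root k< = roots-everywhere {suc group-order} (prepend f) (ℕ.≤-reflexive (sym size≡suc)) everywhere (s≤s k<)
      where
      everywhere : ∀ x → 0# + x * eval group-order f x ≡ 0#
      everywhere x with x ≟ 0#
      ... | yes refl = solve 1 (λ e → # 0 :+ # 0 :* e := # 0) refl _
      ... | no x≢0 = trans (cong (λ z → 0# + x * z) (root x≢0)) (solve 1 (λ x → # 0 :+ x :* # 0 := # 0) refl x)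

    module _ (f : Series) where
      periodic : Series
      periodic k = f (k % suc q)

      eval-periodic : ∀ j x → eval (j ℕ.* suc q) periodic x * (x ^ suc q - 1#) ≡ (x ^ (j ℕ.* suc q) - 1#) * eval (suc q) f x
      eval-periodic zero x = solve 2 (λ y e → # 0 :* y := (# 1 :- # 1) :* e) refl (x ^ suc q - 1#) (eval (suc q) f x)
      eval-periodic (suc j) x = trans (cong (_* (x ^ suc q - 1#)) (trans (eval-++ (suc q) (j ℕ.* suc q) periodic x)
          (cong₂ (λ u v → u + x ^ suc q * v)
            (eval-cong (suc q) (λ k< → cong f (m<n⇒m%n≡m k<)))
            (eval-cong (j ℕ.* suc q) (λ {k} _ → cong f (trans (cong (_% suc q) (ℕ.+-comm (suc q) k)) ([m+n]%n≡m%n k (suc q))))))))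
        (combine₂ (x ^ suc q) (eval-periodic j x) (eval (suc q) f x) (sym (^-+ x (suc q) (j ℕ.* suc q)))
          (solve 5 (λ e y r z w → (e :+ y :* r) :* (y :- # 1) :- (w :- # 1) :* e :=
             y :* (r :* (y :- # 1) :- (z :- # 1) :* e) :+ e :* (y :* z :- w)) refl
             (eval (suc q) f x) (x ^ suc q) (eval (j ℕ.* suc q) periodic x) (x ^ (j ℕ.* suc q)) (x ^ (suc q ℕ.+ j ℕ.* suc q))))

      -- On the circle x^(q+1) - 1 vanishes and cannot be cancelled from `eval-periodic`; here every
      -- period contributes the value of f, which is 0.
      eval-periodic-0 : ∀ j {x} → eval (suc q) f x ≡ 0# → eval (j ℕ.* suc q) periodic x ≡ 0#
      eval-periodic-0 zero _ = refl
      eval-periodic-0 (suc j) {x} root = trans (eval-++ (suc q) (j ℕ.* suc q) periodic x)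
          (trans (cong₂ (λ u v → u + x ^ suc q * v)
            (trans (eval-cong (suc q) (λ k< → cong f (m<n⇒m%n≡m k<))) root)
            (trans (eval-cong (j ℕ.* suc q) (λ {k} _ → cong f (trans (cong (_% suc q) (ℕ.+-comm (suc q) k)) ([m+n]%n≡m%n k (suc q)))))
                   (eval-periodic-0 j root)))
            (solve 1 (λ y → # 0 :+ y :* # 0 := # 0) refl _))

  -- (X^(q²-1) - 1) / (X^(q+1) - 1) f has degree < q²-1, and all nonzero elements are roots.
  roots-unit : ∀ f → (∀ {y} → Unit y → eval (suc q) f y ≡ 0#) → ∀ {k} → k ℕ.< suc q → f k ≡ 0#
  roots-unit f root k< = trans (cong f (sym (m<n⇒m%n≡m k<)))
    (roots-nonzero (periodic f) everywhere (ℕ.≤-trans k< (ℕ.m≤n*m (suc q) (m ℕ.* 2) ⦃ ℕ.>-nonZero (ℕ.≤-trans (s≤s z≤n) (ℕ.*-monoˡ-≤ 2 2≤m)) ⦄)))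
    where
    everywhere : ∀ {x} → x ≢ 0# → eval group-order (periodic f) x ≡ 0#
    everywhere {x} x≢0 with x * conj x ≟ 1#
    ... | yes u = eval-periodic-0 f (m ℕ.* 2) (root u)
    ... | no ¬u = *-cancelˡ-0 (¬u ∘ x-y≈0⇒x≈y) (trans (*-comm _ _) (trans (eval-periodic f (m ℕ.* 2) x)
      (trans (cong (λ z → (z - 1#) * eval (suc q) f x) (^-group-order x≢0))
        (solve 1 (λ e → (# 1 :- # 1) :* e := # 0) refl _))))

  -- Square roots

  private
    module _ (d : Carrier) where
      -- The expansion of 1 / (1 - d X²).
      geometric : Series
      geometric 0 = 1#
      geometric 1 = 0#
      geometric (suc (suc k)) = d * geometric k

      eval-geometric : ∀ j x → (1# - d * x ^ 2) * eval (j ℕ.* 2) geometric x ≡ 1# - (d * x ^ 2) ^ j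
      eval-geometric zero x = solve 1 (λ y → y :* # 0 := # 1 :- # 1) refl _
      eval-geometric (suc j) x = trans (cong (λ z → (1# - d * x ^ 2) * (1# + x * (0# + x * z))) (eval-scale (j ℕ.* 2) d geometric x))
        (combine₁ (d * x ^ 2) (eval-geometric j x)
          (solve 4 (λ d x e z → let y = d :* (x :* (x :* # 1)) in
              (# 1 :- y) :* (# 1 :+ x :* (# 0 :+ x :* (d :* e))) :- (# 1 :- y :* z) := y :* ((# 1 :- y) :* e :- (# 1 :- z))) refl
            d x (eval (j ℕ.* 2) geometric x) ((d * x ^ 2) ^ j)))

  ^-m*2 : ∀ {c} → c ≢ 0# → conj c ≡ c → c ^ (m ℕ.* 2) ≡ 1#
  ^-m*2 {c} c≢0 c-real = *-cancelˡ c≢0 (trans (sym (conj≡* c)) (trans c-real (sym (*-identityʳ c))))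

  abstract
    -- Were c not a square, 1 - x²/c would have no zero, and 1 / (1 - X²/c) truncated below X^(q²-1)
    -- would vanish at every x ≠ 0, because c^(-(q²-1)/2) = c^(-(q-1)) = 1. Its constant
    -- coefficient, however, is 1. As z² is fixed by conjugation, z is fixed or negated.
    real-square-root : ∀ {c} → c ≢ 0# → conj c ≡ c → ∃ λ z → z * z ≡ c × (conj z ≡ z ⊎ conj z ≡ - z)
    real-square-root {c} c≢0 c-real with any? (λ z → z * z ≟ c)
    ... | yes (z , zz≡c) = z , zz≡c , signs
      where
      signs : conj z ≡ z ⊎ conj z ≡ - z
      signs with x*y≡0 {conj z - z} {conj z + z} (combine₁ 1# (trans (sym (conj-* z z)) (trans (cong conj zz≡c) (trans c-real (sym zz≡c))))
                   (solve 2 (λ u z → (u :- z) :* (u :+ z) :- # 0 := # 1 :* (u :* u :- z :* z)) refl (conj z) z))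
      ... | inj₁ eq = inj₁ (x-y≈0⇒x≈y eq)
      ... | inj₂ eq = inj₂ (combine₁ 1# eq (solve 2 (λ u z → u :- (:- z) := # 1 :* (u :+ z :- # 0)) refl (conj z) z))
    ... | no ∄z = contradiction (roots-nonzero (geometric d) root 0<) 1≢0
      where
      d : Carrier
      d = c ⁻¹
      M : ℕ
      M = m ℕ.* suc q
      order≡ : group-order ≡ M ℕ.* 2
      order≡ = swap m (suc q)
        where
        swap : ∀ a b → a ℕ.* 2 ℕ.* b ≡ a ℕ.* b ℕ.* 2
        swap = ℕSolver.solve-∀
      0< : 0 ℕ.< group-order
      0< = ℕ.*-mono-≤ {1} {m ℕ.* 2} {1} {suc q} (ℕ.≤-trans (s≤s z≤n) (ℕ.*-monoˡ-≤ 2 2≤m)) (s≤s z≤n)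
      d≢0 : d ≢ 0#
      d≢0 = ⁻¹-nonzero c≢0
      d-real : conj d ≡ d
      d-real = trans (conj-⁻¹ c≢0) (cong _⁻¹ c-real)
      open ≡-Reasoning
      d^M : d ^ M ≡ 1#
      d^M = begin
        d ^ (m ℕ.* suc q)     ≡⟨ ^-* d m (suc q) ⟩
        (d * conj d) ^ m      ≡⟨ cong (λ z → (d * z) ^ m) d-real ⟩
        (d * d) ^ m           ≡⟨ cong (_^ m) (cong (d *_) (*-identityʳ d)) ⟨
        (d ^ 2) ^ m           ≡⟨ ^-* d m 2 ⟨
        d ^ (m ℕ.* 2)         ≡⟨ ^-m*2 d≢0 d-real ⟩
        1#                    ∎
      root : ∀ {x} → x ≢ 0# → eval group-order (geometric d) x ≡ 0#
      root {x} x≢0 = *-cancelˡ-0 {1# - d * x ^ 2}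
        (λ eq → ∄z (x , combine₂ (- c) eq (- (x * x)) (inverseʳ c c≢0)
          (solve 3 (λ x c d → x :* x :- c := (:- c) :* ((# 1 :- d :* (x :* (x :* # 1))) :- # 0) :+ (:- (x :* x)) :* (c :* d :- # 1)) refl x c d)))
        (begin
          (1# - d * x ^ 2) * eval group-order (geometric d) x   ≡⟨ cong (λ n → (1# - d * x ^ 2) * eval n (geometric d) x) order≡ ⟩
          (1# - d * x ^ 2) * eval (M ℕ.* 2) (geometric d) x     ≡⟨ eval-geometric d M x ⟩
          1# - (d * x ^ 2) ^ M                                  ≡⟨ cong (λ z → 1# - z) (*-^ d (x ^ 2) M) ⟩
          1# - d ^ M * (x ^ 2) ^ M                              ≡⟨ cong₂ (λ u v → 1# - u * v) d^M
                (trans (sym (^-* x M 2)) (trans (cong (x ^_) (sym order≡)) (^-group-order x≢0))) ⟩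
          1# - 1# * 1#                                          ≡⟨ solve 0 (# 1 :- # 1 :* # 1 := # 0) refl ⟩
          0#                                                    ∎)

  -- Otherwise X^q - X, of degree q < q², would vanish everywhere.
  imaginary : ∃ λ i → i ≢ 0# × conj i ≡ - i
  imaginary with any? (λ z → ¬? (conj z ≟ z))
  ... | yes (z , z̄≢z) = z - conj z , (λ eq → z̄≢z (sym (x-y≈0⇒x≈y eq))) ,
    trans (conj-sub z (conj z)) (trans (cong (λ w → conj z - w) (conj-involutive z))
      (solve 2 (λ z w → w :- z := :- (z :- w)) refl z (conj z)))
  ... | no all-real = contradiction (trans (sym leading) (roots-everywhere f q<size root (s≤s ℕ.≤-refl))) 1≢0
    where
    f = X^ q ⊖ X
    q<size : suc q ℕ.≤ size
    q<size = ℕ.≤-trans (ℕ.m≤n*m (suc q) (m ℕ.* 2) ⦃ ℕ.>-nonZero (ℕ.≤-trans (s≤s z≤n) (ℕ.*-monoˡ-≤ 2 2≤m)) ⦄)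
                       (ℕ.≤-trans (ℕ.n≤1+n _) (ℕ.≤-reflexive (sym size≡suc)))
    X-1 : ∀ {k} → 2 ℕ.≤ k → X k ≡ 0#
    X-1 (s≤s (s≤s _)) = refl
    leading : f q ≡ 1#
    leading = trans (cong₂ _-_ (X^-leading q) (X-1 (ℕ.≤-trans (s≤s (s≤s z≤n)) 5≤q))) (solve 0 (# 1 :- # 0 := # 1) refl)
    root : ∀ x → eval (suc q) f x ≡ 0#
    root x = begin
      eval (suc q) f x                         ≡⟨ eval-⊕ (suc q) (X^ q) (⊝ X) x ⟩
      eval (suc q) (X^ q) x + eval (suc q) (⊝ X) x  ≡⟨ cong₂ _+_ (eval-X^ q x) (eval-⊝ (suc q) X x) ⟩
      conj x - eval (suc q) X x                ≡⟨ cong₂ _-_ (decidable-stable (conj x ≟ x) (λ ≢ → all-real (x , ≢)))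
                                                    (eval-degree X-1 (s≤s (ℕ.≤-trans (s≤s z≤n) 5≤q)) x) ⟩
      x - eval 2 X x                           ≡⟨ solve 1 (λ x → x :- (# 0 :+ x :* (# 1 :+ x :* # 0)) := # 0) refl x ⟩
      0#                                       ∎
      where open ≡-Reasoning

  real-imaginary : ∀ {x} → conj x ≡ x → conj x ≡ - x → x ≡ 0#
  real-imaginary {x} real imag = *-cancelˡ-0 2≢0 (combine₁ 1# (trans (sym real) imag)
    (solve 1 (λ x → # 2 :* x :- # 0 := # 1 :* (x :- (:- x))) refl x))

  -- w = r or w = -r, so r is both fixed and negated by conjugation. This is what tells nonzero
  -- squares of the subfield from squares of imaginary elements.
  square-imaginary-real : ∀ {w r} → conj w ≡ - w → conj r ≡ r → w * w ≡ r * r → r ≡ 0#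
  square-imaginary-real {w} {r} w-imaginary r-real ww≡rr with x*y≡0 {w - r} {w + r} (combine₁ 1# ww≡rr
      (solve 2 (λ w r → (w :- r) :* (w :+ r) :- # 0 := # 1 :* (w :* w :- r :* r)) refl w r))
  ... | inj₁ eq with refl ← x-y≈0⇒x≈y eq = real-imaginary r-real w-imaginary
  ... | inj₂ eq = real-imaginary r-real (begin
    conj r       ≡⟨ cong conj r≡-w ⟩
    conj (- w)   ≡⟨ conj-neg w ⟩
    - conj w     ≡⟨ cong -_ w-imaginary ⟩
    - - w        ≡⟨ cong -_ r≡-w ⟨
    - r          ∎)
    where
    open ≡-Reasoning
    r≡-w : r ≡ - w
    r≡-w = combine₁ 1# eq (solve 2 (λ w r → r :- (:- w) := # 1 :* (w :+ r :- # 0)) refl w r)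

  -- Hilbert 90
  abstract
    unit-ratio : ∀ {y} → Unit y → ∃ λ x → x ≢ 0# × conj x ≡ y * x
    unit-ratio {y} u with 1# + conj y ≟ 0#
    -- 1 + ȳ has the required ratio unless y = -1, where an imaginary element takes its place.
    ... | no ≢0 = 1# + conj y , ≢0 , trans (conj-+ 1# (conj y)) (trans (cong₂ _+_ conj-1 (conj-involutive y))
      (combine₁ (- 1#) u (solve 2 (λ y z → # 1 :+ y :- y :* (# 1 :+ z) := (:- # 1) :* (y :* z :- # 1)) refl y (conj y))))
    ... | yes eq = let i , i≢0 , i-imaginary = imaginary in i , i≢0 , trans i-imaginary
      (combine₂ (- i * y) eq i u (solve 3 (λ y z i → :- i :- y :* i := (:- i :* y) :* (# 1 :+ z :- # 0) :+ i :* (y :* z :- # 1)) refl y (conj y) i))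

-- In the application θ is a derivation, e′ = θ e, etc., and w = a - 1 satisfies θ w = a.
module Elimination {c ℓ} (R : CommutativeRing c ℓ) where
  open CommutativeRing R using (Carrier; _≈_; _+_; _*_; -_; _-_; 1#) renaming (refl to ≈-refl)
  open IntegerSolver R

  private
    2* 4* : Carrier → Carrier
    2* x = x + x
    4* x = 2* (2* x)

    :2 :4 : ∀ {n} → Polynomial n → Polynomial n
    :2 x = x :+ x
    :4 x = :2 (:2 x)

  -- Multiplying the differentiated equation by 2e turns 2eg′ into -e′g; then g occurs only in xg,
  -- which is 1 + (a - 1)r.
  eliminate-power : ∀ {e e′ g g′ x a r r′} → x * g ≈ 1# + (a - 1#) * r → 2* e * g′ ≈ - (e′ * g) →
    2* x * g + x * g′ ≈ a * r + (a - 1#) * r′ →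
    (a - 1#) * ((2* e - e′) * r - 2* e * r′) ≈ 2* e * r - 4* e + e′
  eliminate-power {e} {e′} {g} {g′} {x} {a} {r} {r′} h₁ h₂ h₃ = combine₃ (- (4* e - e′)) h₁ (- x) h₂ (2* e) h₃
    (solve 8 (λ e e′ g g′ x a r r′ → let w = a :- # 1 in
      w :* ((:2 e :- e′) :* r :- :2 e :* r′) :- (:2 e :* r :- :4 e :+ e′) :=
      (:- (:4 e :- e′)) :* (x :* g :- (# 1 :+ w :* r))
      :+ (:- x) :* (:2 e :* g′ :- (:- (e′ :* g)))
      :+ :2 e :* (:2 x :* g :+ x :* g′ :- (a :* r :+ w :* r′)))
      ≈-refl e e′ g g′ x a r r′)

  -- The second round removes r and r′, the last quantities whose degree grows with q: only e, of
  -- degree 4, and t remain.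
  eliminate-quotient : ∀ {e e′ e″ a r r′ t t′} → (2* e - e′) * r - 2* e * r′ ≈ t →
    2* e * r ≈ (a - 1#) * t + 4* e - e′ → 2* (e′ * r + e * r′) ≈ a * t + (a - 1#) * t′ + 4* e′ - e″ →
    (a - 1#) * (e′ * t - 2* (e * t′)) ≈ 2* (2* (e * t)) - (2* e + e′) * (4* e - e′) + 2* e * (4* e′ - e″)
  eliminate-quotient {e} {e′} {e″} {a} {r} {r′} {t} {t′} h₁ h₂ h₃ = combine₃ (2* e) h₁ (- (2* e + e′)) h₂ (2* e) h₃
    (solve 8 (λ e e′ e″ a r r′ t t′ → let w = a :- # 1 in
      w :* (e′ :* t :- :2 (e :* t′)) :- (:2 (:2 (e :* t)) :- (:2 e :+ e′) :* (:4 e :- e′) :+ :2 e :* (:4 e′ :- e″)) :=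
      :2 e :* ((:2 e :- e′) :* r :- :2 e :* r′ :- t)
      :+ (:- (:2 e :+ e′)) :* (:2 e :* r :- (w :* t :+ :4 e :- e′))
      :+ :2 e :* (:2 (e′ :* r :+ e :* r′) :- (a :* t :+ w :* t′ :+ :4 e′ :- e″)))
      ≈-refl e e′ e″ a r r′ t t′)

  -- Here l = x (x - y), and θ x = x, θ r = 0.
  eliminate-pointed : ∀ {e e′ g g′ a r x y} → let z = x - y; l = x * z; l′ = l + x * x in
    (x * g + y) * z ≈ (a - 1#) * r → 2* e * g′ ≈ - (e′ * g) →
    (x * g + x * g′) * z + (x * g + y) * x ≈ a * r →
    (a - 1#) * (r * (2* e * l′ - e′ * l - 2* e * l)) ≈ (2* e * l′ - e′ * l) * (y * z) + 2* e * l * (r - y * x)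
  eliminate-pointed {e} {e′} {g} {g′} {a} {r} {x} {y} h₁ h₂ h₃ = combine₃ (- (2* e * l′ - e′ * l)) h₁ (- (l * l)) h₂ (l * 2* e) h₃
    (solve 8 (λ e e′ g g′ a r x y → let w = a :- # 1 ; z = x :- y ; l = x :* z ; l′ = l :+ x :* x in
      w :* (r :* (:2 e :* l′ :- e′ :* l :- :2 e :* l)) :- ((:2 e :* l′ :- e′ :* l) :* (y :* z) :+ :2 e :* l :* (r :- y :* x)) :=
      (:- (:2 e :* l′ :- e′ :* l)) :* ((x :* g :+ y) :* z :- w :* r)
      :+ (:- (l :* l)) :* (:2 e :* g′ :- (:- (e′ :* g)))
      :+ (l :* :2 e) :* ((x :* g :+ x :* g′) :* z :+ (x :* g :+ y) :* x :- a :* r))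
      ≈-refl e e′ g g′ a r x y)
    where
    z = x - y
    l = x * z
    l′ = l + x * x

-- Quartics with nonzero square values on the circle.

module Stepanov (F : FiniteField) (q m : ℕ) (q≡ : q ≡ suc (m ℕ.* 2)) (2≤m : 2 ℕ.≤ m)
         (size≡ : FiniteField.size F ≡ q ℕ.^ 2) (3≢0 : fromℕ F 3 ≢ FiniteField.0# F)
         (conj-+ : ∀ x y → pow F (FiniteField._+_ F x y) q ≡ FiniteField._+_ F (pow F x q) (pow F y q)) where
  open FiniteField F using (Carrier; _+_; _*_; -_; 0#; 1#; inverseʳ)
  open QuadraticExtension F q m q≡ 2≤m size≡ 3≢0 conj-+ public

  private
    open Elimination seriesRing

    module P {n : ℕ} = RawSeries {Polynomial n} _:+_ _:*_ :-_ (# 0) (# 1) #_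

    N = suc q
    A = X^ N
    W = A ⊖ 1ₛ

    W-high : ∀ f k → (W ⊛ f) (N ℕ.+ k) ≡ f k - f (N ℕ.+ k)
    W-high f k = trans (S.solve 2 (λ a f → (a S.:- S.# 1) S.:* f S.:= a S.:* f S.:- f) (λ _ → refl) A f (N ℕ.+ k))
      (cong (_- f (N ℕ.+ k)) (X^-shift N f k))

    W-low : ∀ f {k} → k ℕ.< N → (W ⊛ f) k ≡ - f k
    W-low f {k} k<N = trans (S.solve 2 (λ a f → (a S.:- S.# 1) S.:* f S.:= a S.:* f S.:- f) (λ _ → refl) A f k)
      (trans (cong (_- f k) (X^-low N f k<N)) (+-identityˡ _))

    θ-A : θ A ≗ A
    θ-A k = trans (θ-X^ N k) (trans (cong (_* A k) (trans (nat-suc q) (trans (cong (1# +_) nat-q) (+-identityʳ 1#)))) (*-identityˡ _))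

    θ-W : θ W ≗ A
    θ-W k = trans (θ-⊕ A (⊝ 1ₛ) k) (trans (cong₂ _+_ (θ-A k) (trans (θ-⊝ 1ₛ k) (cong -_ (θ-1 k)))) (solve 1 (λ a → a :+ (:- # 0) := a) refl (A k)))

    θ-W⊛ : ∀ f → θ (W ⊛ f) ≗ A ⊛ f ⊕ W ⊛ θ f
    θ-W⊛ f k = trans (θ-⊛ W f k) (cong (_+ (W ⊛ θ f) k) (⊛-cong {g = f} θ-W (λ _ → refl) k))

    -- Coefficient N + k of W V = L reads V k - V (N + k) = L (N + k). A crude common bound e
    -- therefore improves to e - N.
    quotient-degree : ∀ {V L d e} → W ⊛ V ≗ L → Degree≤ e L → Degree≤ e V → e ℕ.≤ N ℕ.+ d → Degree≤ d V
    quotient-degree {V} {L} {d} {e} eq L-degree V-degree e≤ {k} d<k = combine₃ 1# (trans (sym (W-high V k)) (eq (N ℕ.+ k)))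
        1# (L-degree e<) 1# (V-degree e<)
        (solve 3 (λ v w l → v :- # 0 := # 1 :* (v :- w :- l) :+ # 1 :* (l :- # 0) :+ # 1 :* (w :- # 0)) refl (V k) (V (N ℕ.+ k)) (L (N ℕ.+ k)))
      where
      e< : e ℕ.< N ℕ.+ k
      e< = ℕ.≤-<-trans e≤ (ℕ.+-monoʳ-< N d<k)

    -- Reduction modulo W adds the coefficients of X^k and X^(N+k).
    divisible : ∀ P → Degree≤ (q ℕ.+ q) P → (∀ {y} → Unit y → eval (suc (q ℕ.+ q)) P y ≡ 0#) →
                P ≗ W ⊛ (λ k → P (N ℕ.+ k))
    divisible P P-degree root k = split (k ℕ.<? N)
      where
      R = λ k → P (N ℕ.+ k)
      folded : ∀ {y} → Unit y → eval N (P ⊕ R) y ≡ 0#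
      folded {y} u = begin
        eval N (P ⊕ R) y               ≡⟨ eval-⊕ N P R y ⟩
        eval N P y + eval N R y        ≡⟨ cong (eval N P y +_) (trans (cong (_* eval N R y) u) (*-identityˡ _)) ⟨
        eval N P y + y ^ N * eval N R y  ≡⟨ eval-++ N N P y ⟨
        eval (N ℕ.+ N) P y             ≡⟨ eval-degree P-degree (s≤s (ℕ.+-monoʳ-≤ q (ℕ.n≤1+n q))) y ⟩
        eval (suc (q ℕ.+ q)) P y       ≡⟨ root u ⟩
        0#                             ∎
        where open ≡-Reasoning
      split : Dec (k ℕ.< N) → P k ≡ (W ⊛ R) k
      split (yes k<N) = trans (combine₁ 1# (roots-unit (P ⊕ R) folded k<N)
        (solve 2 (λ p r → p :- (:- r) := # 1 :* (p :+ r :- # 0)) refl (P k) (R k))) (sym (W-low R k<N))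
      split (no k≮N) = begin
        P k                         ≡⟨ cong P k≡ ⟨
        R (k ℕ.∸ N)                 ≡⟨ solve 1 (λ x → x := x :- # 0) refl _ ⟩
        R (k ℕ.∸ N) - 0#            ≡⟨ cong (λ z → R (k ℕ.∸ N) - z) (P-degree high) ⟨
        R (k ℕ.∸ N) - R (N ℕ.+ (k ℕ.∸ N)) ≡⟨ W-high R (k ℕ.∸ N) ⟨
        (W ⊛ R) (N ℕ.+ (k ℕ.∸ N))   ≡⟨ cong (W ⊛ R) k≡ ⟩
        (W ⊛ R) k                   ∎
        where
        open ≡-Reasoning
        k≡ = ℕ.m+[n∸m]≡n (ℕ.≮⇒≥ k≮N)
        high : q ℕ.+ q ℕ.< N ℕ.+ (N ℕ.+ (k ℕ.∸ N))
        high = s≤s (ℕ.+-monoʳ-≤ q (ℕ.≤-trans (ℕ.n≤1+n q) (ℕ.m≤m+n N _)))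

    nat-m*2 : nat (m ℕ.* 2) ≡ - 1#
    nat-m*2 = combine₁ 1# (trans (sym (nat-suc (m ℕ.* 2))) (trans (cong nat (sym q≡)) nat-q))
      (solve 1 (λ x → x :- (:- # 1) := # 1 :* (# 1 :+ x :- # 0)) refl (nat (m ℕ.* 2)))

    θ-half-power : ∀ E → double E ⊛ θ (E ** m) ≗ ⊝ (θ E ⊛ E ** m)
    θ-half-power E k = begin
      (double E ⊛ θ (E ** m)) k          ≡⟨ ⊛-distribʳ (θ (E ** m)) E E k ⟩
      (E ⊛ θ (E ** m)) k + (E ⊛ θ (E ** m)) k  ≡⟨ cong (λ z → z + z) (θ-** E m k) ⟩
      nat m * z + nat m * z              ≡⟨ solve 2 (λ m z → m :* z :+ m :* z := (m :* # 2) :* z) refl (nat m) z ⟩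
      (nat m * nat 2) * z                ≡⟨ cong (_* z) (trans (sym (nat-* m 2)) nat-m*2) ⟩
      - 1# * z                           ≡⟨ solve 1 (λ z → (:- # 1) :* z := :- z) refl z ⟩
      - z                                ∎
      where
      open ≡-Reasoning
      z = (θ E ⊛ E ** m) k

    θ-double : ∀ f → θ (double f) ≗ double (θ f)
    θ-double f = θ-⊕ f f

  record SquareQuartic (e₀ e₁ e₂ e₃ e₄ : Carrier) : Set where
    field
      κ s₀ s₁ s₂ : Carrier
      e₀≡ : e₀ ≡ κ * (s₀ * s₀)
      e₁≡ : e₁ ≡ κ * (nat 2 * s₀ * s₁)
      e₂≡ : e₂ ≡ κ * (s₁ * s₁ + nat 2 * s₀ * s₂)
      e₃≡ : e₃ ≡ κ * (nat 2 * s₁ * s₂)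
      e₄≡ : e₄ ≡ κ * (s₂ * s₂)

  -- The two hypotheses are what remains of the symmetry of E under conjugation, which exchanges e₀
  -- with e₄ and e₁ with e₃. They settle the case in which T has no constant term.
  module _ {e₀ e₁ e₂ e₃ e₄ : Carrier} (e₀⇒e₄ : e₀ ≡ 0# → e₄ ≡ 0#) (e₁⇒e₃ : e₁ ≡ 0# → e₃ ≡ 0#) where
    private
      E = quartic e₀ e₁ e₂ e₃ e₄

    -- The left side is (E(y) / y²)^m, because y^(-2m) = y^(1-q) = y² on the circle.
    module _ (square : ∀ {y} → Unit y → eval 5 E y ^ m * y ^ 2 ≡ 1#) where
      private
        G = E ** m
        P′ = X^ 2 ⊛ G ⊖ 1ₛ
        R = λ k → P′ (N ℕ.+ k)

        2+m*4≡ : 2 ℕ.+ m ℕ.* 4 ≡ q ℕ.+ q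
        2+m*4≡ = trans (identity m) (cong (λ q → q ℕ.+ q) (sym q≡))
          where
          identity : ∀ m → 2 ℕ.+ m ℕ.* 4 ≡ suc (m ℕ.* 2) ℕ.+ suc (m ℕ.* 2)
          identity = ℕSolver.solve-∀

        G-degree : Degree≤ (m ℕ.* 4) G
        G-degree = degree-** {E} {4} degree-quartic m

        P′-degree : Degree≤ (q ℕ.+ q) P′
        P′-degree = subst (λ d → Degree≤ d P′) 2+m*4≡ (degree-⊖ {X^ 2 ⊛ G} {1ₛ} (degree-⊛ {X^ 2} {G} {2} (degree-X^ 2) G-degree)
          (degree-weaken {1ₛ} {0} z≤n degree-1))

        P′-root : ∀ {y} → Unit y → eval (suc (q ℕ.+ q)) P′ y ≡ 0#
        P′-root {y} u = begin
          eval (suc (q ℕ.+ q)) P′ y    ≡⟨ cong (λ d → eval (suc d) P′ y) 2+m*4≡ ⟨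
          eval D P′ y                  ≡⟨ eval-⊕ D (X^ 2 ⊛ G) (⊝ 1ₛ) y ⟩
          eval D (X^ 2 ⊛ G) y + eval D (⊝ 1ₛ) y
            ≡⟨ cong₂ _+_ (trans (eval-⊛ {X^ 2} {G} {2} (degree-X^ 2) G-degree y) (cong₂ _*_ (eval-X^ 2 y) (eval-** {E} {4} degree-quartic m y)))
                         (trans (eval-⊝ D 1ₛ y) (cong -_ (eval-degree {1ₛ} {0} {D} degree-1 (s≤s z≤n) y))) ⟩
          y ^ 2 * eval 5 E y ^ m - (1# + y * 0#)
            ≡⟨ combine₁ 1# (square u) (solve 3 (λ a b y → (a :* b :- (# 1 :+ y :* # 0)) :- # 0 := # 1 :* (b :* a :- # 1)) refl (y ^ 2) (eval 5 E y ^ m) y) ⟩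
          0#                           ∎
          where
          open ≡-Reasoning
          D = suc (2 ℕ.+ m ℕ.* 4)

        R-degree : Degree≤ (m ℕ.* 2) R
        R-degree {k} m*2<k = P′-degree (s≤s (ℕ.+-monoʳ-≤ q (subst (ℕ._≤ k) (sym q≡) m*2<k)))

        equation : X^ 2 ⊛ G ≗ 1ₛ ⊕ W ⊛ R
        equation k = combine₁ 1# (divisible P′ P′-degree P′-root k)
          (solve 3 (λ z o w → z :- (o :+ w) := # 1 :* (z :- o :- w)) refl ((X^ 2 ⊛ G) k) (1ₛ k) ((W ⊛ R) k))

        θ-equation : double (X^ 2) ⊛ G ⊕ X^ 2 ⊛ θ G ≗ A ⊛ R ⊕ W ⊛ θ R
        θ-equation k = begin
          (double (X^ 2) ⊛ G) k + (X^ 2 ⊛ θ G) k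
            ≡⟨ cong (_+ (X^ 2 ⊛ θ G) k) (⊛-cong {g = G} (λ k → trans (θ-X^ 2 k) (solve 1 (λ x → # 2 :* x := x :+ x) refl (X^ 2 k))) (λ _ → refl) k) ⟨
          (θ (X^ 2) ⊛ G) k + (X^ 2 ⊛ θ G) k   ≡⟨ θ-⊛ (X^ 2) G k ⟨
          θ (X^ 2 ⊛ G) k                      ≡⟨ θ-cong equation k ⟩
          θ (1ₛ ⊕ W ⊛ R) k                    ≡⟨ θ-⊕ 1ₛ (W ⊛ R) k ⟩
          θ 1ₛ k + θ (W ⊛ R) k                ≡⟨ cong₂ _+_ (θ-1 k) (θ-W⊛ R k) ⟩
          0# + (A ⊛ R ⊕ W ⊛ θ R) k            ≡⟨ +-identityˡ _ ⟩
          (A ⊛ R ⊕ W ⊛ θ R) k                 ∎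
          where open ≡-Reasoning

        T = (double E ⊖ θ E) ⊛ R ⊖ double E ⊛ θ R
        Y = double E ⊛ R ⊖ double (double E) ⊕ θ E

        W⊛T : W ⊛ T ≗ Y
        W⊛T = eliminate-power equation (θ-half-power E) θ-equation

        4+m*2≡ : 4 ℕ.+ m ℕ.* 2 ≡ q ℕ.+ 3
        4+m*2≡ = trans (identity m) (cong (ℕ._+ 3) (sym q≡))
          where
          identity : ∀ m → 4 ℕ.+ m ℕ.* 2 ≡ suc (m ℕ.* 2) ℕ.+ 3
          identity = ℕSolver.solve-∀

        2E-degree : Degree≤ 4 (double E)
        2E-degree = degree-double {E} degree-quartic

        θE-degree : Degree≤ 4 (θ E)
        θE-degree = degree-θ {E} degree-quartic

        T-degree : Degree≤ (4 ℕ.+ m ℕ.* 2) T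
        T-degree = degree-⊖ {(double E ⊖ θ E) ⊛ R} {double E ⊛ θ R}
          (degree-⊛ {double E ⊖ θ E} {R} {4} (degree-⊖ {double E} {θ E} 2E-degree θE-degree) R-degree)
          (degree-⊛ {double E} {θ R} {4} 2E-degree (degree-θ {R} R-degree))

        Y-degree : Degree≤ (4 ℕ.+ m ℕ.* 2) Y
        Y-degree = degree-⊕ {double E ⊛ R ⊖ double (double E)} {θ E}
          (degree-⊖ {double E ⊛ R} {double (double E)} (degree-⊛ {double E} {R} {4} 2E-degree R-degree)
            (degree-weaken {double (double E)} (ℕ.m≤m+n 4 _) (degree-double {double E} 2E-degree)))
          (degree-weaken {θ E} (ℕ.m≤m+n 4 _) θE-degree)

        -- deg Y ≤ 2m + 4 = (q + 1) + 2, so division by W leaves a quadratic, although the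
        -- definition of `T` only bounds its degree by 2m + 4.
        T-quadratic : Degree≤ 2 T
        T-quadratic = quotient-degree {T} {Y} W⊛T Y-degree T-degree (ℕ.≤-reflexive (trans 4+m*2≡ (ℕ.+-suc q 2)))

        -- `T` with its three coefficients made explicit, so that the solver can expand single
        -- coefficients of `stepanov` and `wronskian`.
        T₂ = quadratic (T 0) (T 1) (T 2)

        T≗T₂ : T ≗ T₂
        T≗T₂ 0 = refl
        T≗T₂ 1 = refl
        T≗T₂ 2 = refl
        T≗T₂ (suc (suc (suc k))) = T-quadratic (s≤s (s≤s (s≤s z≤n)))

        double-E⊛R : double E ⊛ R ≗ W ⊛ T₂ ⊕ double (double E) ⊖ θ E
        double-E⊛R k = combine₂ (- 1#) (W⊛T k) 1# (⊛-cong {W} (λ _ → refl) T≗T₂ k)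
          (solve 5 (λ r w e e′ w₂ → r :- (w₂ :+ e :- e′) := (:- # 1) :* (w :- (r :- e :+ e′)) :+ # 1 :* (w :- w₂)) refl
            ((double E ⊛ R) k) ((W ⊛ T) k) (double (double E) k) (θ E k) ((W ⊛ T₂) k))

        θ-double-E⊛R : double (θ E ⊛ R ⊕ E ⊛ θ R) ≗ A ⊛ T₂ ⊕ W ⊛ θ T₂ ⊕ double (double (θ E)) ⊖ θ (θ E)
        θ-double-E⊛R k = begin
          double (θ E ⊛ R ⊕ E ⊛ θ R) k   ≡⟨ cong (λ z → z + z) (θ-⊛ E R k) ⟨
          double (θ (E ⊛ R)) k           ≡⟨ θ-double (E ⊛ R) k ⟨
          θ (double (E ⊛ R)) k           ≡⟨ θ-cong (⊛-distribʳ R E E) k ⟨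
          θ (double E ⊛ R) k             ≡⟨ θ-cong double-E⊛R k ⟩
          θ (W ⊛ T₂ ⊕ double (double E) ⊖ θ E) k
            ≡⟨ trans (θ-⊕ (W ⊛ T₂ ⊕ double (double E)) (⊝ θ E) k) (cong₂ _+_ (θ-⊕ (W ⊛ T₂) (double (double E)) k) (θ-⊝ (θ E) k)) ⟩
          θ (W ⊛ T₂) k + θ (double (double E)) k - θ (θ E) k
            ≡⟨ cong₂ (λ u v → u + v - θ (θ E) k) (θ-W⊛ T₂ k) (trans (θ-double (double E) k) (cong (λ z → z + z) (θ-double E k))) ⟩
          (A ⊛ T₂ ⊕ W ⊛ θ T₂ ⊕ double (double (θ E)) ⊖ θ (θ E)) k ∎
          where open ≡-Reasoning

        L = stepanov E T₂
        V = wronskian E T₂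

        W⊛V : W ⊛ V ≗ L
        W⊛V = eliminate-quotient T≗T₂ double-E⊛R θ-double-E⊛R

        T₂-degree : Degree≤ 2 T₂
        T₂-degree = degree-quadratic

        V-degree : Degree≤ 6 V
        V-degree = degree-⊖ {θ E ⊛ T₂} {double (E ⊛ θ T₂)} (degree-⊛ {θ E} {T₂} {4} θE-degree T₂-degree)
          (degree-double {E ⊛ θ T₂} (degree-⊛ {E} {θ T₂} {4} degree-quartic (degree-θ {T₂} T₂-degree)))

        L-degree-8 : Degree≤ 8 L
        L-degree-8 = degree-⊕ {double (double (E ⊛ T₂)) ⊖ (double E ⊕ θ E) ⊛ (double (double E) ⊖ θ E)} {double E ⊛ (double (double (θ E)) ⊖ θ (θ E))}
          (degree-⊖ {double (double (E ⊛ T₂))} {(double E ⊕ θ E) ⊛ (double (double E) ⊖ θ E)}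
            (degree-weaken {double (double (E ⊛ T₂))} (ℕ.m≤m+n 6 2) (degree-double {double (E ⊛ T₂)} (degree-double {E ⊛ T₂} (degree-⊛ {E} {T₂} {4} degree-quartic T₂-degree))))
            (degree-⊛ {double E ⊕ θ E} {double (double E) ⊖ θ E} {4} (degree-⊕ {double E} {θ E} 2E-degree θE-degree)
              (degree-⊖ {double (double E)} {θ E} (degree-double {double E} 2E-degree) θE-degree)))
          (degree-⊛ {double E} {double (double (θ E)) ⊖ θ (θ E)} {4} 2E-degree
            (degree-⊖ {double (double (θ E))} {θ (θ E)} (degree-double {double (θ E)} (degree-double {θ E} θE-degree)) (degree-θ {θ E} θE-degree)))

        t₀ = T 0
        t₁ = T 1
        t₂ = T 2

        -- The terms of degree 8 and 7 cancel. For q = 5 this matters: W has degree 6, and the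
        -- formal bound 8 would not make V constant.
        L-degree : Degree≤ 6 L
        L-degree {k} 6<k with k ℕ.≤? 8
        ... | no k≰8 = L-degree-8 (ℕ.≰⇒> k≰8)
        ... | yes k≤8 with ℕ.m≤n⇒m<n∨m≡n k≤8
        ...   | inj₂ refl = solve 8 (λ e₀ e₁ e₂ e₃ e₄ t₀ t₁ t₂ → P.stepanov (P.quartic e₀ e₁ e₂ e₃ e₄) (P.quadratic t₀ t₁ t₂) 8 := # 0)
                              refl e₀ e₁ e₂ e₃ e₄ t₀ t₁ t₂
        ...   | inj₁ k<8 with refl ← ℕ.≤-antisym (ℕ.≤-pred k<8) 6<k =
          solve 8 (λ e₀ e₁ e₂ e₃ e₄ t₀ t₁ t₂ → P.stepanov (P.quartic e₀ e₁ e₂ e₃ e₄) (P.quadratic t₀ t₁ t₂) 7 := # 0)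
                refl e₀ e₁ e₂ e₃ e₄ t₀ t₁ t₂

        V-constant : Degree≤ 0 V
        V-constant = quotient-degree {V} {L} W⊛V L-degree V-degree (ℕ.≤-trans (s≤s 5≤q) (ℕ.≤-reflexive (sym (ℕ.+-identityʳ N))))

        V≗0 : V ≗ 0ₛ
        V≗0 zero = solve 8 (λ e₀ e₁ e₂ e₃ e₄ t₀ t₁ t₂ → P.wronskian (P.quartic e₀ e₁ e₂ e₃ e₄) (P.quadratic t₀ t₁ t₂) 0 := # 0)
                         refl e₀ e₁ e₂ e₃ e₄ t₀ t₁ t₂
        V≗0 (suc k) = V-constant (s≤s z≤n)

        L≗0 : L ≗ 0ₛ
        L≗0 k = trans (sym (W⊛V k)) (trans (⊛-cong {W} (λ _ → refl) V≗0 k) (trans (⊛-comm W 0ₛ k) (⊛-zeroˡ W k)))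

        -- If t₀ ≠ 0, the coefficients `V₁` to `V₄` of V = 0 determine e₁ to e₄; if t₀ = 0, those of
        -- L = 0 enter and give e₀ = e₁ = 0.
        L₀ : nat 4 * (e₀ * t₀) ≡ nat 8 * (e₀ * e₀)
        L₀ = combine₁ 1# (L≗0 0) (solve 8 (λ e₀ e₁ e₂ e₃ e₄ t₀ t₁ t₂ → # 4 :* (e₀ :* t₀) :- # 8 :* (e₀ :* e₀) :=
          # 1 :* (P.stepanov (P.quartic e₀ e₁ e₂ e₃ e₄) (P.quadratic t₀ t₁ t₂) 0 :- # 0)) refl e₀ e₁ e₂ e₃ e₄ t₀ t₁ t₂)

        L₂ : nat 4 * (e₂ * t₀ + e₁ * t₁ + e₀ * t₂) ≡ nat 3 * (e₁ * e₁) + nat 12 * (e₀ * e₂)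
        L₂ = combine₁ 1# (L≗0 2) (solve 8 (λ e₀ e₁ e₂ e₃ e₄ t₀ t₁ t₂ → # 4 :* (e₂ :* t₀ :+ e₁ :* t₁ :+ e₀ :* t₂) :- (# 3 :* (e₁ :* e₁) :+ # 12 :* (e₀ :* e₂)) :=
          # 1 :* (P.stepanov (P.quartic e₀ e₁ e₂ e₃ e₄) (P.quadratic t₀ t₁ t₂) 2 :- # 0)) refl e₀ e₁ e₂ e₃ e₄ t₀ t₁ t₂)

        V₁ : e₁ * t₀ ≡ nat 2 * (e₀ * t₁)
        V₁ = combine₁ 1# (V≗0 1) (solve 8 (λ e₀ e₁ e₂ e₃ e₄ t₀ t₁ t₂ → e₁ :* t₀ :- # 2 :* (e₀ :* t₁) :=
          # 1 :* (P.wronskian (P.quartic e₀ e₁ e₂ e₃ e₄) (P.quadratic t₀ t₁ t₂) 1 :- # 0)) refl e₀ e₁ e₂ e₃ e₄ t₀ t₁ t₂)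

        V₂ : nat 2 * (e₂ * t₀) ≡ e₁ * t₁ + nat 4 * (e₀ * t₂)
        V₂ = combine₁ 1# (V≗0 2) (solve 8 (λ e₀ e₁ e₂ e₃ e₄ t₀ t₁ t₂ → # 2 :* (e₂ :* t₀) :- (e₁ :* t₁ :+ # 4 :* (e₀ :* t₂)) :=
          # 1 :* (P.wronskian (P.quartic e₀ e₁ e₂ e₃ e₄) (P.quadratic t₀ t₁ t₂) 2 :- # 0)) refl e₀ e₁ e₂ e₃ e₄ t₀ t₁ t₂)

        V₃ : nat 3 * (e₃ * t₀) ≡ nat 3 * (e₁ * t₂)
        V₃ = combine₁ 1# (V≗0 3) (solve 8 (λ e₀ e₁ e₂ e₃ e₄ t₀ t₁ t₂ → # 3 :* (e₃ :* t₀) :- # 3 :* (e₁ :* t₂) :=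
          # 1 :* (P.wronskian (P.quartic e₀ e₁ e₂ e₃ e₄) (P.quadratic t₀ t₁ t₂) 3 :- # 0)) refl e₀ e₁ e₂ e₃ e₄ t₀ t₁ t₂)

        V₄ : nat 4 * (e₄ * t₀) + e₃ * t₁ ≡ nat 2 * (e₂ * t₂)
        V₄ = combine₁ 1# (V≗0 4) (solve 8 (λ e₀ e₁ e₂ e₃ e₄ t₀ t₁ t₂ → # 4 :* (e₄ :* t₀) :+ e₃ :* t₁ :- # 2 :* (e₂ :* t₂) :=
          # 1 :* (P.wronskian (P.quartic e₀ e₁ e₂ e₃ e₄) (P.quadratic t₀ t₁ t₂) 4 :- # 0)) refl e₀ e₁ e₂ e₃ e₄ t₀ t₁ t₂)

        -- e₀ e₁ e₂ e₃ e₄ are the coefficients of (e₀ / t₀²) (t₀ + t₁ X + t₂ X²)².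
        generic : t₀ ≢ 0# → SquareQuartic e₀ e₁ e₂ e₃ e₄
        generic t₀≢0 = record
          { κ = κ ; s₀ = t₀ ; s₁ = t₁ ; s₂ = t₂ ; e₀≡ = e₀≡ ; e₁≡ = e₁≡ ; e₂≡ = e₂≡ ; e₃≡ = e₃≡ ; e₄≡ = e₄≡ }
          where
          i = t₀ ⁻¹
          κ = e₀ * (i * i)
          e₀≡ : e₀ ≡ κ * (t₀ * t₀)
          e₀≡ = combine₁ (- e₀ * (t₀ * i + 1#)) (inverseʳ t₀ t₀≢0)
            (solve 3 (λ e t i → e :- e :* (i :* i) :* (t :* t) := (:- e :* (t :* i :+ # 1)) :* (t :* i :- # 1)) refl e₀ t₀ i)
          e₁≡ : e₁ ≡ κ * (nat 2 * t₀ * t₁)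
          e₁≡ = *-cancelˡ t₀≢0 (combine₂ 1# V₁ (nat 2 * t₁) e₀≡
            (solve 5 (λ e₀ e₁ t₀ t₁ κ → t₀ :* e₁ :- t₀ :* (κ :* (# 2 :* t₀ :* t₁)) :=
              # 1 :* (e₁ :* t₀ :- # 2 :* (e₀ :* t₁)) :+ (# 2 :* t₁) :* (e₀ :- κ :* (t₀ :* t₀))) refl e₀ e₁ t₀ t₁ κ))
          e₂≡ : e₂ ≡ κ * (t₁ * t₁ + nat 2 * t₀ * t₂)
          e₂≡ = *-cancelˡ (*-nonzero 2≢0 t₀≢0) (combine₃ 1# V₂ t₁ e₁≡ (nat 4 * t₂) e₀≡
            (solve 7 (λ e₀ e₁ e₂ t₀ t₁ t₂ κ → # 2 :* t₀ :* e₂ :- # 2 :* t₀ :* (κ :* (t₁ :* t₁ :+ # 2 :* t₀ :* t₂)) :=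
              # 1 :* (# 2 :* (e₂ :* t₀) :- (e₁ :* t₁ :+ # 4 :* (e₀ :* t₂))) :+ t₁ :* (e₁ :- κ :* (# 2 :* t₀ :* t₁)) :+ (# 4 :* t₂) :* (e₀ :- κ :* (t₀ :* t₀)))
              refl e₀ e₁ e₂ t₀ t₁ t₂ κ))
          e₃≡ : e₃ ≡ κ * (nat 2 * t₁ * t₂)
          e₃≡ = *-cancelˡ (*-nonzero nat3≢0 t₀≢0) (combine₂ 1# V₃ (nat 3 * t₂) e₁≡
            (solve 6 (λ e₁ e₃ t₀ t₁ t₂ κ → # 3 :* t₀ :* e₃ :- # 3 :* t₀ :* (κ :* (# 2 :* t₁ :* t₂)) :=
              # 1 :* (# 3 :* (e₃ :* t₀) :- # 3 :* (e₁ :* t₂)) :+ (# 3 :* t₂) :* (e₁ :- κ :* (# 2 :* t₀ :* t₁)))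
              refl e₁ e₃ t₀ t₁ t₂ κ))
          e₄≡ : e₄ ≡ κ * (t₂ * t₂)
          e₄≡ = *-cancelˡ (*-nonzero (*-nonzero 2≢0 2≢0) t₀≢0) (combine₃ 1# V₄ (nat 2 * t₂) e₂≡ (- t₁) e₃≡
            (solve 7 (λ e₂ e₃ e₄ t₀ t₁ t₂ κ → # 2 :* # 2 :* t₀ :* e₄ :- # 2 :* # 2 :* t₀ :* (κ :* (t₂ :* t₂)) :=
              # 1 :* (# 4 :* (e₄ :* t₀) :+ e₃ :* t₁ :- # 2 :* (e₂ :* t₂)) :+ (# 2 :* t₂) :* (e₂ :- κ :* (t₁ :* t₁ :+ # 2 :* t₀ :* t₂))
                :+ (:- t₁) :* (e₃ :- κ :* (# 2 :* t₁ :* t₂)))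
              refl e₂ e₃ e₄ t₀ t₁ t₂ κ))

        -- The lower coefficients e₀, e₁ vanish, hence by symmetry e₄, e₃ do as well, and E = e₂ X².
        degenerate : t₀ ≡ 0# → SquareQuartic e₀ e₁ e₂ e₃ e₄
        degenerate t₀≡0 = record
          { κ = e₂ ; s₀ = 0# ; s₁ = 1# ; s₂ = 0#
          ; e₀≡ = trans e₀≡0 (solve 1 (λ e → # 0 := e :* (# 0 :* # 0)) refl e₂)
          ; e₁≡ = trans e₁≡0 (solve 1 (λ e → # 0 := e :* (# 2 :* # 0 :* # 1)) refl e₂)
          ; e₂≡ = solve 1 (λ e → e := e :* (# 1 :* # 1 :+ # 2 :* # 0 :* # 0)) refl e₂
          ; e₃≡ = trans (e₁⇒e₃ e₁≡0) (solve 1 (λ e → # 0 := e :* (# 2 :* # 1 :* # 0)) refl e₂)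
          ; e₄≡ = trans (e₀⇒e₄ e₀≡0) (solve 1 (λ e → # 0 := e :* (# 0 :* # 0)) refl e₂) }
          where
          e₀≡0 : e₀ ≡ 0#
          e₀≡0 = ^≡0⇒≡0 2 (*-cancelˡ-0 (*-nonzero (*-nonzero 2≢0 2≢0) 2≢0) (combine₂ (- 1#) L₀ (nat 4 * e₀) t₀≡0
            (solve 2 (λ e t → # 2 :* # 2 :* # 2 :* (e :* (e :* # 1)) :- # 0 := (:- # 1) :* (# 4 :* (e :* t) :- # 8 :* (e :* e)) :+ (# 4 :* e) :* (t :- # 0)) refl e₀ t₀)))
          e₁t₁≡0 : e₁ * t₁ ≡ 0#
          e₁t₁≡0 = combine₃ (- 1#) V₂ (nat 2 * e₂) t₀≡0 (- nat 4 * t₂) e₀≡0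
            (solve 6 (λ e₀ e₁ e₂ t₀ t₁ t₂ → e₁ :* t₁ :- # 0 := (:- # 1) :* (# 2 :* (e₂ :* t₀) :- (e₁ :* t₁ :+ # 4 :* (e₀ :* t₂)))
              :+ (# 2 :* e₂) :* (t₀ :- # 0) :+ (:- # 4 :* t₂) :* (e₀ :- # 0)) refl e₀ e₁ e₂ t₀ t₁ t₂)
          e₁≡0 : e₁ ≡ 0#
          e₁≡0 = ^≡0⇒≡0 2 (*-cancelˡ-0 nat3≢0 (combine₄ (- 1#) L₂ (nat 4) e₁t₁≡0 (nat 4 * e₂) t₀≡0 (nat 4 * t₂ - nat 12 * e₂) e₀≡0
            (solve 6 (λ e₀ e₁ e₂ t₀ t₁ t₂ → # 3 :* (e₁ :* (e₁ :* # 1)) :- # 0 :=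
              (:- # 1) :* (# 4 :* (e₂ :* t₀ :+ e₁ :* t₁ :+ e₀ :* t₂) :- (# 3 :* (e₁ :* e₁) :+ # 12 :* (e₀ :* e₂)))
              :+ # 4 :* (e₁ :* t₁ :- # 0) :+ (# 4 :* e₂) :* (t₀ :- # 0) :+ (# 4 :* t₂ :- # 12 :* e₂) :* (e₀ :- # 0)) refl e₀ e₁ e₂ t₀ t₁ t₂)))

      square-quartic : SquareQuartic e₀ e₁ e₂ e₃ e₄
      square-quartic with t₀ ≟ 0#
      ... | yes t₀≡0 = degenerate t₀≡0
      ... | no t₀≢0 = generic t₀≢0

  -- The quadratic cofactor when the quartic has a double root y₀ on the circle.

  module _ {e₀ e₁ e₂ y₀ : Carrier} (y₀-unit : Unit y₀) where
    private
      E = quadratic e₀ e₁ e₂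

    -- Dividing (X - y₀)² out of the quartic changes the condition: on the circle (y - y₀)^(2m) = -ȳ
    -- ȳ₀, which turns the factor y² into y and the value 1 into -y₀.
    module _ (square : ∀ {y} → Unit y → y ≢ y₀ → eval 3 E y ^ m * y ≡ - y₀) where
      private
        G = E ** m
        c = linear y₀ 0#
        Z = linear (- y₀) 1#
        -- The factor X - y₀ supplies a root at y₀, where `square` says nothing. The degree is then
        -- q + 1, so the quotient R by W is a constant.
        P′ = (X ⊛ G ⊕ c) ⊛ Z
        R = λ k → P′ (N ℕ.+ k)

        1+m*2≡ : 1 ℕ.+ m ℕ.* 2 ≡ q
        1+m*2≡ = sym q≡

        X-degree : Degree≤ 1 X
        X-degree (s≤s (s≤s _)) = refl

        c-degree : Degree≤ 0 c
        c-degree (s≤s {n = zero} _) = refl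
        c-degree (s≤s {n = suc _} _) = refl

        G-degree : Degree≤ (m ℕ.* 2) G
        G-degree = degree-** {E} {2} degree-quadratic m

        XG+c-degree : Degree≤ q (X ⊛ G ⊕ c)
        XG+c-degree = subst (λ d → Degree≤ d (X ⊛ G ⊕ c)) 1+m*2≡ (degree-⊕ {X ⊛ G} {c} (degree-⊛ {X} {G} {1} X-degree G-degree)
          (degree-weaken {c} {0} z≤n c-degree))

        P′-degree : Degree≤ N P′
        P′-degree = subst (λ d → Degree≤ d P′) (ℕ.+-comm q 1) (degree-⊛ {X ⊛ G ⊕ c} {Z} {q} XG+c-degree degree-linear)

        N≤q+q : N ℕ.≤ q ℕ.+ q
        N≤q+q = ℕ.+-monoˡ-≤ q (ℕ.≤-trans (s≤s z≤n) 5≤q)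

        P′-root : ∀ {y} → Unit y → eval (suc (q ℕ.+ q)) P′ y ≡ 0#
        P′-root {y} u = begin
          eval (suc (q ℕ.+ q)) P′ y     ≡⟨ eval-degree P′-degree (s≤s N≤q+q) y ⟩
          eval (suc N) P′ y             ≡⟨ cong (λ d → eval (suc d) P′ y) (ℕ.+-comm q 1) ⟨
          eval (suc (q ℕ.+ 1)) P′ y     ≡⟨ eval-⊛ {X ⊛ G ⊕ c} {Z} {q} XG+c-degree degree-linear y ⟩
          eval (suc q) (X ⊛ G ⊕ c) y * eval 2 Z y
            ≡⟨ cong (_* eval 2 Z y) (trans (eval-⊕ (suc q) (X ⊛ G) c y) (cong₂ _+_
                 (trans (cong (λ d → eval (suc d) (X ⊛ G) y) q≡) (trans (eval-⊛ {X} {G} {1} X-degree G-degree y) (cong (eval 2 X y *_) (eval-** {E} {2} degree-quadratic m y))))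
                 (eval-degree {c} {0} {suc q} c-degree (s≤s z≤n) y))) ⟩
          (eval 2 X y * g + eval 1 c y) * eval 2 Z y
            ≡⟨ solve 3 (λ y g y₀ → ((# 0 :+ y :* (# 1 :+ y :* # 0)) :* g :+ (y₀ :+ y :* # 0)) :* (:- y₀ :+ y :* (# 1 :+ y :* # 0)) := (y :- y₀) :* (g :* y :- (:- y₀)))
                 refl y g y₀ ⟩
          (y - y₀) * (g * y - (- y₀))     ≡⟨ zero-factor (y ≟ y₀) ⟩
          0#                            ∎
          where
          open ≡-Reasoning
          g = eval 3 E y ^ m
          zero-factor : Dec (y ≡ y₀) → (y - y₀) * (g * y - (- y₀)) ≡ 0#
          zero-factor (yes refl) = trans (cong (_* (g * y - (- y₀))) (-‿inverseʳ y)) (zeroˡ _)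
          zero-factor (no y≢y₀) = trans (*-congˡ (x≈y⇒x-y≈0 (square u y≢y₀))) (zeroʳ _)

        equation : (X ⊛ G ⊕ c) ⊛ Z ≗ W ⊛ R
        equation = divisible P′ (degree-weaken {P′} N≤q+q P′-degree) P′-root

        R-degree : Degree≤ 0 R
        R-degree (s≤s {n = k} _) = P′-degree (ℕ.≤-trans (s≤s (ℕ.m≤m+n N k)) (ℕ.≤-reflexive (sym (ℕ.+-suc N k))))

        θR≗0 : θ R ≗ 0ₛ
        θR≗0 zero = zeroˡ _
        θR≗0 (suc k) = trans (*-congˡ (R-degree (s≤s z≤n))) (zeroʳ _)

        -- Comparison of constant coefficients gives R 0 = y₀².
        R≢0 : R 0 ≢ 0#
        R≢0 R≡0 = ^-nonzero 2 (unit-nonzero y₀-unit) (combine₂ (- 1#) (equation 0) (- 1#) (trans (W-low R (s≤s z≤n)) (cong -_ R≡0))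
          (solve 3 (λ y g w → y :* (y :* # 1) :- # 0 := (:- # 1) :* ((# 0 :* g :+ y) :* (:- y) :- w) :+ (:- # 1) :* (w :- (:- # 0))) refl y₀ (G 0) ((W ⊛ R) 0)))

        Z≗ : Z ≗ X ⊖ c
        Z≗ 0 = solve 1 (λ y → :- y := # 0 :- y) refl y₀
        Z≗ 1 = solve 0 (# 1 := # 1 :- # 0) refl
        Z≗ (suc (suc _)) = solve 0 (# 0 := # 0 :- # 0) refl

        θ-X : θ X ≗ X
        θ-X 0 = zeroˡ _
        θ-X 1 = *-identityˡ 1#
        θ-X (suc (suc _)) = zeroʳ _

        θ-c : θ c ≗ 0ₛ
        θ-c zero = zeroˡ _
        θ-c (suc k) = trans (*-congˡ (c-degree (s≤s z≤n))) (zeroʳ _)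

        equation′ : (X ⊛ G ⊕ c) ⊛ (X ⊖ c) ≗ W ⊛ R
        equation′ k = trans (⊛-cong {X ⊛ G ⊕ c} (λ _ → refl) (λ k → sym (Z≗ k)) k) (equation k)

        θ-equation : (X ⊛ G ⊕ X ⊛ θ G) ⊛ (X ⊖ c) ⊕ (X ⊛ G ⊕ c) ⊛ X ≗ A ⊛ R
        θ-equation k = begin
          ((X ⊛ G ⊕ X ⊛ θ G) ⊛ (X ⊖ c)) k + ((X ⊛ G ⊕ c) ⊛ X) k
            ≡⟨ cong₂ _+_ (⊛-cong {g = X ⊖ c} θ-left (λ _ → refl) k) (⊛-cong {X ⊛ G ⊕ c} (λ _ → refl) θ-right k) ⟨
          (θ (X ⊛ G ⊕ c) ⊛ (X ⊖ c)) k + ((X ⊛ G ⊕ c) ⊛ θ (X ⊖ c)) k  ≡⟨ θ-⊛ (X ⊛ G ⊕ c) (X ⊖ c) k ⟨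
          θ ((X ⊛ G ⊕ c) ⊛ (X ⊖ c)) k     ≡⟨ θ-cong equation′ k ⟩
          θ (W ⊛ R) k                     ≡⟨ θ-W⊛ R k ⟩
          (A ⊛ R) k + (W ⊛ θ R) k         ≡⟨ cong ((A ⊛ R) k +_) (trans (⊛-cong {W} (λ _ → refl) θR≗0 k) (trans (⊛-comm W 0ₛ k) (⊛-zeroˡ W k))) ⟩
          (A ⊛ R) k + 0#                  ≡⟨ +-identityʳ _ ⟩
          (A ⊛ R) k                       ∎
          where
          open ≡-Reasoning
          θ-left : θ (X ⊛ G ⊕ c) ≗ X ⊛ G ⊕ X ⊛ θ G
          θ-left k = trans (θ-⊕ (X ⊛ G) c k) (trans (cong₂ _+_ (trans (θ-⊛ X G k) (cong (_+ (X ⊛ θ G) k) (⊛-cong {g = G} θ-X (λ _ → refl) k))) (θ-c k)) (+-identityʳ _))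
          θ-right : θ (X ⊖ c) ≗ X
          θ-right k = trans (θ-⊕ X (⊝ c) k) (trans (cong₂ _+_ (θ-X k) (trans (θ-⊝ c k) (cong -_ (θ-c k)))) (solve 1 (λ x → x :+ (:- # 0) := x) refl (X k)))

        l = X ⊛ (X ⊖ c)
        l′ = l ⊕ X ⊛ X
        B = pointed-stepanov E y₀
        L = (double E ⊛ l′ ⊖ θ E ⊛ l) ⊛ (c ⊛ (X ⊖ c)) ⊕ double E ⊛ l ⊛ (R ⊖ c ⊛ X)

        W⊛R⊛B : W ⊛ (R ⊛ B) ≗ L
        W⊛R⊛B = eliminate-pointed equation′ (θ-half-power E) θ-equation

        E-degree : Degree≤ 2 (double E)
        E-degree = degree-double {E} degree-quadratic

        X-c-degree : Degree≤ 1 (X ⊖ c)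
        X-c-degree = degree-⊖ {X} {c} X-degree (degree-weaken {c} {0} z≤n c-degree)

        l-degree : Degree≤ 2 l
        l-degree = degree-⊛ {X} {X ⊖ c} {1} X-degree X-c-degree

        2El-degree : Degree≤ 4 (double E ⊛ l)
        2El-degree = degree-⊛ {double E} {l} {2} E-degree l-degree

        2El′-θEl-degree : Degree≤ 4 (double E ⊛ l′ ⊖ θ E ⊛ l)
        2El′-θEl-degree = degree-⊖ {double E ⊛ l′} {θ E ⊛ l}
          (degree-⊛ {double E} {l′} {2} E-degree (degree-⊕ {l} {X ⊛ X} l-degree (degree-⊛ {X} {X} {1} X-degree X-degree)))
          (degree-⊛ {θ E} {l} {2} (degree-θ {E} degree-quadratic) l-degree)

        B-degree : Degree≤ 5 (R ⊛ B)
        B-degree = degree-weaken {R ⊛ B} {4} (ℕ.n≤1+n 4) (degree-⊛ {R} {B} {0} R-degree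
          (degree-⊖ {double E ⊛ l′ ⊖ θ E ⊛ l} {double E ⊛ l} 2El′-θEl-degree 2El-degree))

        L-degree : Degree≤ 5 L
        L-degree = degree-⊕ {(double E ⊛ l′ ⊖ θ E ⊛ l) ⊛ (c ⊛ (X ⊖ c))} {double E ⊛ l ⊛ (R ⊖ c ⊛ X)}
          (degree-⊛ {double E ⊛ l′ ⊖ θ E ⊛ l} {c ⊛ (X ⊖ c)} {4} 2El′-θEl-degree (degree-⊛ {c} {X ⊖ c} {0} c-degree X-c-degree))
          (degree-⊛ {double E ⊛ l} {R ⊖ c ⊛ X} {4} 2El-degree
            (degree-⊖ {R} {c ⊛ X} (degree-weaken {R} {0} z≤n R-degree) (degree-⊛ {c} {X} {0} c-degree X-degree)))

        -- deg L ≤ 5 < q + 1, so R B is constant; R is a nonzero constant.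
        B≡0 : ∀ k → B (suc k) ≡ 0#
        B≡0 k = *-cancelˡ-0 R≢0 (trans (sym (⊛-constant {R} R-degree B (suc k)))
          (quotient-degree {R ⊛ B} {L} {0} W⊛R⊛B L-degree B-degree (ℕ.≤-trans 5≤q (ℕ.≤-trans (ℕ.n≤1+n q) (ℕ.m≤m+n N 0))) (s≤s z≤n)))

      pointed-square₁ : e₁ ≡ - (nat 2 * y₀ * e₂)
      pointed-square₁ = combine₁ 1# (B≡0 2) (solve 4 (λ e₀ e₁ e₂ y → e₁ :- (:- (# 2 :* y :* e₂)) :=
        # 1 :* (P.pointed-stepanov (P.quadratic e₀ e₁ e₂) y 3 :- # 0)) refl e₀ e₁ e₂ y₀)

      pointed-square₀ : e₀ ≡ y₀ * y₀ * e₂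
      pointed-square₀ = *-cancelˡ 2≢0 (combine₂ 1# (B≡0 1) (- y₀) pointed-square₁
        (solve 4 (λ e₀ e₁ e₂ y → # 2 :* e₀ :- # 2 :* (y :* y :* e₂) :=
          # 1 :* (P.pointed-stepanov (P.quadratic e₀ e₁ e₂) y 2 :- # 0) :+ (:- y) :* (e₁ :- (:- (# 2 :* y :* e₂)))) refl e₀ e₁ e₂ y₀))

-- Over the unit circle, ā, b̄ are the conjugates of a, b and f(x) = x H(y) with y = x^(q-1), H(y) = den y / y;
-- f is injective on the lines over y if num / den is injective on the circle.
module RawForms {A : Set} (_+_ _*_ : A → A → A) (-_ : A → A) (nat : ℕ → A) (a ā b b̄ : A) where
  infixl 6 _⊞_
  infixl 7 _⊠_
  _⊞_ _⊠_ : A → A → A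
  _⊞_ = _+_
  _⊠_ = _*_

  n : A
  n = a ⊠ ā ⊞ (- (b ⊠ b̄))

  -- `α`, `β`, `γ` are the coefficients of K(-, y) as a polynomial in x, and `E` is its
  -- discriminant.
  num den α β γ E : A → A
  num y = ā ⊠ y ⊠ y ⊠ y ⊞ y ⊠ y ⊞ b̄
  den y = b ⊠ y ⊠ y ⊠ y ⊞ y ⊞ a
  α y = (- (b ⊠ y ⊠ y)) ⊞ ā ⊠ y ⊞ n
  β y = ā ⊠ y ⊠ y ⊞ (n ⊞ nat 1) ⊠ y ⊞ a
  γ y = n ⊠ y ⊠ y ⊞ a ⊠ y ⊞ (- b̄)
  E y = β y ⊠ β y ⊞ (- (nat 4 ⊠ α y ⊠ γ y))

  -- (num x den y - num y den x) / (x - y)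
  K : A → A → A
  K x y = α y ⊠ x ⊠ x ⊞ β y ⊠ x ⊞ γ y

  e₀ e₁ e₂ e₃ e₄ : A
  e₀ = a ⊠ a ⊞ nat 4 ⊠ b̄ ⊠ n
  e₁ = nat 2 ⊠ a ⊠ (nat 1 ⊞ (- n)) ⊞ nat 4 ⊠ ā ⊠ b̄
  e₂ = (n ⊞ nat 1) ⊠ (n ⊞ nat 1) ⊞ (- (nat 2 ⊠ a ⊠ ā ⊞ nat 4 ⊠ b ⊠ b̄ ⊞ nat 4 ⊠ n ⊠ n))
  e₃ = nat 2 ⊠ ā ⊠ (nat 1 ⊞ (- n)) ⊞ nat 4 ⊠ a ⊠ b
  e₄ = ā ⊠ ā ⊞ nat 4 ⊠ b ⊠ n

  -- Half of the determinant of K as a conic in x + y and x y.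
  D : A
  D = nat 3 ⊠ n ⊠ (b ⊠ b̄) ⊞ b ⊠ b̄ ⊞ n ⊠ n ⊞ (- (n ⊠ n ⊠ n)) ⊞ a ⊠ a ⊠ b ⊞ ā ⊠ ā ⊠ b̄

-- The trinomial, its collision form K and the discriminant E.

module Trinomial (F : FiniteField) (q m : ℕ) (q≡ : q ≡ suc (m ℕ.* 2)) (2≤m : 2 ℕ.≤ m)
         (size≡ : FiniteField.size F ≡ q ℕ.^ 2) (3≢0 : fromℕ F 3 ≢ FiniteField.0# F)
         (conj-+ : ∀ x y → pow F (FiniteField._+_ F x y) q ≡ FiniteField._+_ F (pow F x q) (pow F y q))
         (a b : FiniteField.Carrier F) (a≢0 : a ≢ FiniteField.0# F) (b≢0 : b ≢ FiniteField.0# F) where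
  open FiniteField F using (Carrier; _+_; _*_; -_; 0#; 1#; inverseʳ)
  open Stepanov F q m q≡ 2≤m size≡ 3≢0 conj-+ public

  ā b̄ : Carrier
  ā = conj a
  b̄ = conj b

  open RawForms _+_ _*_ -_ nat a ā b b̄ hiding (_⊞_; _⊠_)
  private
    module P {n : ℕ} = RawForms {Polynomial n} _:+_ _:*_ :-_ #_

  NoCollision : Set
  NoCollision = ∀ {x y} → Unit x → Unit y → x ≢ y → K x y ≢ 0#

  H : Carrier → Carrier
  H y = 1# + a * conj y + b * (y * y)

  ā≢0 : ā ≢ 0#
  ā≢0 = conj-nonzero a≢0

  aā≢0 : a * ā ≢ 0#
  aā≢0 = *-nonzero a≢0 ā≢0

  conj-ā : conj ā ≡ a
  conj-ā = conj-involutive a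

  conj-b̄ : conj b̄ ≡ b
  conj-b̄ = conj-involutive b

  unit-neg : ∀ {y} → Unit y → Unit (- y)
  unit-neg {y} u = trans (cong (- y *_) (conj-neg y)) (trans (solve 2 (λ x y → (:- x) :* (:- y) := x :* y) refl y (conj y)) u)

  neg-≢ : ∀ {y} → Unit y → - y ≢ y
  neg-≢ {y} u -y≡y = *-nonzero 2≢0 (unit-nonzero u) (combine₁ (- 1#) -y≡y
    (solve 1 (λ y → # 2 :* y :- # 0 := (:- # 1) :* (:- y :- y)) refl y))

  conj-n : conj n ≡ n
  conj-n = trans (conj-sub (a * ā) (b * b̄)) (trans (cong₂ _-_
    (trans (conj-* a ā) (cong (ā *_) conj-ā)) (trans (conj-* b b̄) (cong (b̄ *_) conj-b̄)))
    (solve 4 (λ a ā b b̄ → ā :* a :- b̄ :* b := a :* ā :- b :* b̄) refl a ā b b̄))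

  conj-*₃ : ∀ x y z → conj (x * y * z) ≡ conj x * conj y * conj z
  conj-*₃ x y z = trans (conj-* (x * y) z) (cong (_* conj z) (conj-* x y))

  conj-+₃ : ∀ x y z → conj (x + y + z) ≡ conj x + conj y + conj z
  conj-+₃ x y z = trans (conj-+ (x + y) z) (cong (_+ conj z) (conj-+ x y))

  -- Conjugation is inversion on the circle, and K is self-reciprocal: up to the factor y², α and γ
  -- are exchanged and β is fixed.
  conj-α : ∀ {y} → Unit y → conj (α y) * (y * y) ≡ γ y
  conj-α {y} u = trans (cong (_* (y * y)) expand) (combine₁ (- b̄ * (y * ȳ + 1#) + a * y) u
    (solve 5 (λ a b̄ n y ȳ → (:- (b̄ :* ȳ :* ȳ) :+ a :* ȳ :+ n) :* (y :* y) :- (n :* y :* y :+ a :* y :+ (:- b̄)) :=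
      (:- b̄ :* (y :* ȳ :+ # 1) :+ a :* y) :* (y :* ȳ :- # 1)) refl a b̄ n y ȳ))
    where
    ȳ = conj y
    expand : conj (α y) ≡ - (b̄ * ȳ * ȳ) + a * ȳ + n
    expand = trans (conj-+₃ (- (b * y * y)) (ā * y) n) (cong₂ _+_ (cong₂ _+_
      (trans (conj-neg (b * y * y)) (cong -_ (conj-*₃ b y y)))
      (trans (conj-* ā y) (cong (_* ȳ) conj-ā))) conj-n)

  conj-β : ∀ {y} → Unit y → conj (β y) * (y * y) ≡ β y
  conj-β {y} u = trans (cong (_* (y * y)) expand) (combine₁ (a * (y * ȳ + 1#) + (n + 1#) * y) u
    (solve 5 (λ a ā n y ȳ → (a :* ȳ :* ȳ :+ (n :+ # 1) :* ȳ :+ ā) :* (y :* y) :- (ā :* y :* y :+ (n :+ # 1) :* y :+ a) :=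
      (a :* (y :* ȳ :+ # 1) :+ (n :+ # 1) :* y) :* (y :* ȳ :- # 1)) refl a ā n y ȳ))
    where
    ȳ = conj y
    expand : conj (β y) ≡ a * ȳ * ȳ + (n + 1#) * ȳ + ā
    expand = trans (conj-+₃ (ā * y * y) ((n + 1#) * y) a) (cong₂ _+_ (cong₂ _+_
      (trans (conj-*₃ ā y y) (cong (λ z → z * ȳ * ȳ) conj-ā))
      (trans (conj-* (n + 1#) y) (cong (_* ȳ) (trans (conj-+ n 1#) (cong₂ _+_ conj-n conj-1))))) refl)

  -- x ↦ x ȳ identifies { x : x̄ y² = x } with the subfield.
  conj-quotient : ∀ {x y} → Unit y → conj x * (y * y) ≡ x → conj (x * conj y) ≡ x * conj y
  conj-quotient {x} {y} u eq = trans (trans (conj-* x (conj y)) (cong (conj x *_) (conj-involutive y)))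
    (combine₂ (conj y) eq (- (conj x * y)) u (solve 4 (λ x x̄ y ȳ → x̄ :* y :- x :* ȳ :=
      ȳ :* (x̄ :* (y :* y) :- x) :+ (:- (x̄ :* y)) :* (y :* ȳ :- # 1)) refl x (conj x) y (conj y)))

  conj-γ : ∀ {y} → Unit y → conj (γ y) * (y * y) ≡ α y
  conj-γ {y} u = begin
    conj (γ y) * (y * y)                    ≡⟨ cong (λ z → conj z * (y * y)) (conj-α u) ⟨
    conj (conj (α y) * (y * y)) * (y * y)   ≡⟨ cong (_* (y * y)) (trans (conj-* (conj (α y)) (y * y)) (cong₂ _*_ (conj-involutive (α y)) (conj-* y y))) ⟩
    α y * (ȳ * ȳ) * (y * y)                 ≡⟨ combine₁ (α y * (y * ȳ + 1#)) u (solve 3 (λ x y ȳ → x :* (ȳ :* ȳ) :* (y :* y) :- x :=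
                                                 (x :* (y :* ȳ :+ # 1)) :* (y :* ȳ :- # 1)) refl (α y) y ȳ) ⟩
    α y                                     ∎
    where
    open ≡-Reasoning
    ȳ = conj y

  -- E(y) / y² on the circle, where ȳ = 1/y; this quotient lies in the subfield.
  reduced-E : Carrier → Carrier
  reduced-E y = E y * (conj y * conj y)

  reduced-E-real : ∀ {y} → Unit y → conj (reduced-E y) ≡ reduced-E y
  reduced-E-real {y} u = begin
    conj (E y * (ȳ * ȳ))                     ≡⟨ trans (conj-* (E y) (ȳ * ȳ)) (cong₂ _*_ expand (trans (conj-* ȳ ȳ) (cong₂ _*_ (conj-involutive y) (conj-involutive y)))) ⟩
    (β̄ * β̄ - nat 4 * ᾱ * γ̄) * (y * y)
      ≡⟨ combine₁ (- (β̄ * β̄ - nat 4 * ᾱ * γ̄) * (y * y) * (y * ȳ + 1#)) u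
           (solve 5 (λ α β γ y ȳ → (β :* β :- # 4 :* α :* γ) :* (y :* y) :-
              ((β :* (y :* y)) :* (β :* (y :* y)) :- # 4 :* (α :* (y :* y)) :* (γ :* (y :* y))) :* (ȳ :* ȳ)
              := (:- (β :* β :- # 4 :* α :* γ) :* (y :* y) :* (y :* ȳ :+ # 1)) :* (y :* ȳ :- # 1)) refl ᾱ β̄ γ̄ y ȳ) ⟩
    ((β̄ * (y * y)) * (β̄ * (y * y)) - nat 4 * (ᾱ * (y * y)) * (γ̄ * (y * y))) * (ȳ * ȳ)
      ≡⟨ cong (_* (ȳ * ȳ)) (cong₂ _-_ (cong₂ _*_ (conj-β u) (conj-β u)) (cong₂ (λ s t → nat 4 * s * t) (conj-α u) (conj-γ u))) ⟩
    (β y * β y - nat 4 * γ y * α y) * (ȳ * ȳ)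
      ≡⟨ solve 4 (λ α β γ z → (β :* β :- # 4 :* γ :* α) :* z := (β :* β :- # 4 :* α :* γ) :* z) refl (α y) (β y) (γ y) (ȳ * ȳ) ⟩
    E y * (ȳ * ȳ)                            ∎
    where
    open ≡-Reasoning
    ȳ = conj y
    ᾱ = conj (α y)
    β̄ = conj (β y)
    γ̄ = conj (γ y)
    expand : conj (E y) ≡ β̄ * β̄ - nat 4 * ᾱ * γ̄
    expand = trans (conj-sub (β y * β y) (nat 4 * α y * γ y)) (cong₂ _-_ (conj-* (β y) (β y))
      (trans (conj-*₃ (nat 4) (α y) (γ y)) (cong (λ z → z * ᾱ * γ̄) (conj-nat 4))))

  E≡ : ∀ {y} → Unit y → E y ≡ reduced-E y * (y * y)
  E≡ {y} u = combine₁ (- E y * (y * conj y + 1#)) u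
    (solve 3 (λ x y ȳ → x :- x :* (ȳ :* ȳ) :* (y :* y) := (:- x :* (y :* ȳ :+ # 1)) :* (y :* ȳ :- # 1)) refl (E y) y (conj y))

  K-square : ∀ x y → (nat 2 * α y * x + β y) * (nat 2 * α y * x + β y) ≡ nat 4 * α y * K x y + E y
  K-square x y = solve 4 (λ α β γ x → (# 2 :* α :* x :+ β) :* (# 2 :* α :* x :+ β) :=
    # 4 :* α :* (α :* x :* x :+ β :* x :+ γ) :+ (β :* β :+ (:- (# 4 :* α :* γ)))) refl (α y) (β y) (γ y) x

  -- α = 0 entails γ = 0 by conjugation. If also β = 0, then K(-, y) is identically zero and x = -y
  -- is a collision.
  K-degenerate : NoCollision → ∀ {y} → Unit y → α y ≡ 0# → β y ≢ 0#
  K-degenerate nc {y} u α≡0 β≡0 = nc (unit-neg u) u (neg-≢ u) (combine₃ (y * y) α≡0 (- y) β≡0 1# γ≡0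
    (solve 4 (λ α β γ y → (α :* (:- y) :* (:- y) :+ β :* (:- y) :+ γ) :- # 0 :=
      (y :* y) :* (α :- # 0) :+ (:- y) :* (β :- # 0) :+ # 1 :* (γ :- # 0)) refl (α y) (β y) (γ y) y))
    where
    γ≡0 : γ y ≡ 0#
    γ≡0 = trans (sym (conj-α u)) (trans (cong (λ z → conj z * (y * y)) α≡0) (trans (cong (_* (y * y)) conj-0) (zeroˡ _)))

  -- If E(y) = δ² with δ / y imaginary then the roots of K(-, y) lie on the circle, so (δ - β) / 2 α can only be y.
  root-on-circle : NoCollision → ∀ {y δ} → Unit y → α y ≢ 0# → δ * δ ≡ E y → conj δ * (y * y) ≡ - δ →
                   δ - β y ≡ nat 2 * α y * y
  root-on-circle nc {y} {δ} u α≢0 δδ≡E δ-imaginary with δ - β y ≟ nat 2 * α y * y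
  ... | yes eq = eq
  ... | no neq = contradiction K≡0 (nc x-unit u x≢y)
    where
    2α≢0 = *-nonzero 2≢0 α≢0
    i = (nat 2 * α y) ⁻¹
    x = (δ - β y) * i
    ᾱ = conj (α y)
    2αx : nat 2 * α y * x ≡ δ - β y
    2αx = combine₁ (δ - β y) (inverseʳ _ 2α≢0) (solve 3 (λ t s i → t :* (s :* i) :- s := s :* (t :* i :- # 1)) refl (nat 2 * α y) (δ - β y) i)
    x≢y : x ≢ y
    x≢y x≡y = neq (trans (sym 2αx) (cong (nat 2 * α y *_) x≡y))
    K≡0 : K x y ≡ 0#
    K≡0 = *-cancelˡ-0 (*-nonzero (*-nonzero 2≢0 2≢0) α≢0) (combine₃ (- 1#) (K-square x y) (nat 2 * α y * x + β y + δ) 2αx 1# δδ≡E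
      (solve 6 (λ α β x k e δ → # 2 :* # 2 :* α :* k :- # 0 :=
        (:- # 1) :* ((# 2 :* α :* x :+ β) :* (# 2 :* α :* x :+ β) :- (# 4 :* α :* k :+ e))
        :+ (# 2 :* α :* x :+ β :+ δ) :* (# 2 :* α :* x :- (δ :- β)) :+ # 1 :* (δ :* δ :- e)) refl (α y) (β y) x (K x y) (E y) δ))
    2ᾱx̄ : nat 2 * ᾱ * conj x ≡ conj δ - conj (β y)
    2ᾱx̄ = trans (sym (trans (conj-*₃ (nat 2) (α y) x) (cong (λ z → z * ᾱ * conj x) (conj-nat 2)))) (trans (cong conj 2αx) (conj-sub δ (β y)))
    -- y² times the conjugate of δ - β is -(δ + β), so 4αγ x x̄ = β² - δ² = 4αγ.
    x-unit : Unit x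
    x-unit = *-cancelˡ {nat 4 * α y * γ y} 4αγ≢0 (begin
      nat 4 * α y * γ y * (x * conj x)   ≡⟨ cong (λ z → nat 4 * α y * z * (x * conj x)) (conj-α u) ⟨
      nat 4 * α y * (ᾱ * (y * y)) * (x * conj x)
        ≡⟨ solve 5 (λ α ᾱ s x x̄ → # 4 :* α :* (ᾱ :* s) :* (x :* x̄) := (# 2 :* α :* x) :* ((# 2 :* ᾱ :* x̄) :* s)) refl (α y) ᾱ (y * y) x (conj x) ⟩
      (nat 2 * α y * x) * ((nat 2 * ᾱ * conj x) * (y * y))
        ≡⟨ cong₂ (λ s t → s * (t * (y * y))) 2αx 2ᾱx̄ ⟩
      (δ - β y) * ((conj δ - conj (β y)) * (y * y))
        ≡⟨ combine₃ (δ - β y) δ-imaginary (- (δ - β y)) (conj-β u) (- 1#) δδ≡E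
             (solve 7 (λ δ δ̄ β β̄ s α γ → (δ :- β) :* ((δ̄ :- β̄) :* s) :- # 4 :* α :* γ :* # 1 :=
               (δ :- β) :* (δ̄ :* s :- (:- δ)) :+ (:- (δ :- β)) :* (β̄ :* s :- β) :+ (:- # 1) :* (δ :* δ :- (β :* β :+ (:- (# 4 :* α :* γ)))))
               refl δ (conj δ) (β y) (conj (β y)) (y * y) (α y) (γ y)) ⟩
      nat 4 * α y * γ y * 1#             ∎)
      where
      open ≡-Reasoning
      y≢0 = unit-nonzero u
      4αγ≢0 : nat 4 * α y * γ y ≢ 0#
      4αγ≢0 eq = *-nonzero (*-nonzero (*-nonzero 2≢0 2≢0) α≢0) (*-nonzero (conj-nonzero α≢0) (*-nonzero y≢0 y≢0))
        (trans (cong (nat 2 * nat 2 * α y *_) (conj-α u))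
          (trans (solve 2 (λ α γ → # 2 :* # 2 :* α :* γ := # 4 :* α :* γ) refl (α y) (γ y)) eq))

  -- Permutations and collisions

  q∸1 : q ℕ.∸ 1 ≡ m ℕ.* 2
  q∸1 = cong (ℕ._∸ 1) q≡

  f : Carrier → Carrier
  f x = x * (1# + a * x ^ (q ℕ.* (q ℕ.∸ 1)) + b * x ^ (2 ℕ.* (q ℕ.∸ 1)))

  f-line : ∀ {x y} → x ≢ 0# → conj x ≡ y * x → f x ≡ x * H y
  f-line {x} {y} x≢0 eq = cong (x *_) (cong₂ (λ s t → 1# + a * s + b * t)
    (trans (^-* x q (q ℕ.∸ 1)) (cong conj power))
    (trans (^-* x 2 (q ℕ.∸ 1)) (trans (cong (_^ 2) power) (cong (y *_) (*-identityʳ y)))))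
    where
    power : x ^ (q ℕ.∸ 1) ≡ y
    power = *-cancelˡ x≢0 (trans (cong (λ k → x * x ^ k) q∸1) (trans (sym (conj≡* x)) (trans eq (*-comm y x))))

  abstract
    direction : ∀ {x} → x ≢ 0# → ∃ λ y → Unit y × conj x ≡ y * x
    direction {x} x≢0 = y , unit , eq
      where
      y : Carrier
      y = x ^ (m ℕ.* 2)
      eq : conj x ≡ y * x
      eq = trans (conj≡* x) (*-comm x y)
      unit : Unit y
      unit = *-cancelˡ x≢0 (combine₂ (- 1#) (trans (sym (conj-involutive x)) (trans (cong conj eq) (conj-* y x))) (- conj y) eq
        (solve 4 (λ x x̄ y ȳ → x :* (y :* ȳ) :- x :* # 1 := (:- # 1) :* (x :- ȳ :* x̄) :+ (:- ȳ) :* (x̄ :- y :* x)) refl x (conj x) y (conj y)))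

  conj-H : ∀ y → conj (H y) ≡ 1# + ā * y + b̄ * (conj y * conj y)
  conj-H y = trans (conj-+₃ 1# (a * conj y) (b * (y * y))) (cong₂ _+_ (cong₂ _+_ conj-1
    (trans (conj-* a (conj y)) (cong (ā *_) (conj-involutive y)))) (trans (conj-* b (y * y)) (cong (b̄ *_) (conj-* y y))))

  den≡ : ∀ {y} → Unit y → den y ≡ y * H y
  den≡ {y} u = combine₁ (- a) u (solve 4 (λ a b y ȳ → (b :* y :* y :* y :+ y :+ a) :- y :* (# 1 :+ a :* ȳ :+ b :* (y :* y)) :=
    (:- a) :* (y :* ȳ :- # 1)) refl a b y (conj y))

  num≡ : ∀ {y} → Unit y → num y ≡ y * y * conj (H y)
  num≡ {y} u = trans (combine₁ (- b̄ * (y * conj y + 1#)) u (solve 4 (λ ā b̄ y ȳ →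
      (ā :* y :* y :* y :+ y :* y :+ b̄) :- y :* y :* (# 1 :+ ā :* y :+ b̄ :* (ȳ :* ȳ)) :=
      (:- b̄ :* (y :* ȳ :+ # 1)) :* (y :* ȳ :- # 1)) refl ā b̄ y (conj y)))
    (cong (y * y *_) (sym (conj-H y)))

  K-identity : ∀ x y → (x - y) * K x y ≡ num x * den y - num y * den x
  K-identity = solve 6 (λ a ā b b̄ x y → (x :- y) :* P.K a ā b b̄ x y :=
    P.num a ā b b̄ x :* P.den a ā b b̄ y :- P.num a ā b b̄ y :* P.den a ā b b̄ x) refl a ā b b̄

  K-identity-H : ∀ {x y} → Unit x → Unit y → (x - y) * K x y ≡ x * y * (x * (conj (H x) * H y) - y * (conj (H y) * H x))
  K-identity-H {x} {y} ux uy = trans (K-identity x y) (trans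
    (cong₂ _-_ (cong₂ _*_ (num≡ ux) (den≡ uy)) (cong₂ _*_ (num≡ uy) (den≡ ux)))
    (solve 6 (λ x y g ḡ h h̄ → x :* x :* ḡ :* (y :* h) :- y :* y :* h̄ :* (x :* g) := x :* y :* (x :* (ḡ :* h) :- y :* (h̄ :* g)))
      refl x y (H x) (conj (H x)) (H y) (conj (H y))))

  -- A zero y of H on the circle is a common zero of `num` and `den`, so K(x, y) = 0 for all x ≠ y;
  -- the point -y serves.
  no-collision⇒H≢0 : NoCollision → ∀ {y} → Unit y → H y ≢ 0#
  no-collision⇒H≢0 nc {y} u H≡0 = nc (unit-neg u) u (neg-≢ u) (*-cancelˡ-0 (neg-≢ u ∘ x-y≈0⇒x≈y)
    (trans (K-identity-H (unit-neg u) u) (trans (cong₂ (λ s t → - y * y * (- y * (conj (H (- y)) * s) - y * (t * H (- y)))) H≡0 (trans (cong conj H≡0) conj-0))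
      (solve 3 (λ y g ḡ → (:- y) :* y :* ((:- y) :* (ḡ :* # 0) :- y :* (# 0 :* g)) := # 0) refl y (H (- y)) (conj (H (- y)))))))

  f-0 : f 0# ≡ 0#
  f-0 = zeroˡ _

  f-nonzero : NoCollision → ∀ {x} → x ≢ 0# → f x ≢ 0#
  f-nonzero nc x≢0 eq with direction x≢0
  ... | y , u , x̄ = *-nonzero x≢0 (no-collision⇒H≢0 nc u) (trans (sym (f-line x≢0 x̄)) eq)

  -- Dividing the conjugate of f(x₁) = f(x₂) by the equation itself shows that num / den agrees at
  -- the two directions. So they coincide, and H cancels.
  no-collision⇒injective : NoCollision → Injective _≡_ _≡_ f
  no-collision⇒injective nc {x₁} {x₂} eq with x₁ ≟ 0# | x₂ ≟ 0#
  ... | yes refl | yes refl = refl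
  ... | yes refl | no x₂≢0 = contradiction (trans (sym eq) f-0) (f-nonzero nc x₂≢0)
  ... | no x₁≢0 | yes refl = contradiction (trans eq f-0) (f-nonzero nc x₁≢0)
  ... | no x₁≢0 | no x₂≢0 with direction x₁≢0 | direction x₂≢0
  ...   | y₁ , u₁ , x̄₁ | y₂ , u₂ , x̄₂ = same-direction (y₁ ≟ y₂)
    where
    xH : x₁ * H y₁ ≡ x₂ * H y₂
    xH = trans (sym (f-line x₁≢0 x̄₁)) (trans eq (f-line x₂≢0 x̄₂))
    conj-xH : y₁ * x₁ * conj (H y₁) ≡ y₂ * x₂ * conj (H y₂)
    conj-xH = trans (cong (_* conj (H y₁)) (sym x̄₁)) (trans (sym (conj-* x₁ (H y₁))) (trans (cong conj xH)
      (trans (conj-* x₂ (H y₂)) (cong (_* conj (H y₂)) x̄₂))))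
    collision : (y₁ - y₂) * K y₁ y₂ ≡ 0#
    collision = *-cancelˡ-0 (*-nonzero x₁≢0 x₂≢0) (trans (cong (x₁ * x₂ *_) (K-identity-H u₁ u₂))
      (combine₂ (y₁ * y₂ * (x₂ * H y₂)) conj-xH (- (y₁ * y₂ * (y₂ * x₂ * conj (H y₂)))) xH
        (solve 8 (λ x₁ x₂ y₁ y₂ g ḡ h h̄ → x₁ :* x₂ :* (y₁ :* y₂ :* (y₁ :* (ḡ :* h) :- y₂ :* (h̄ :* g))) :- # 0 :=
          (y₁ :* y₂ :* (x₂ :* h)) :* (y₁ :* x₁ :* ḡ :- y₂ :* x₂ :* h̄) :+ (:- (y₁ :* y₂ :* (y₂ :* x₂ :* h̄))) :* (x₁ :* g :- x₂ :* h))
          refl x₁ x₂ y₁ y₂ (H y₁) (conj (H y₁)) (H y₂) (conj (H y₂)))))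
    same-direction : Dec (y₁ ≡ y₂) → x₁ ≡ x₂
    same-direction (yes refl) = *-cancelˡ (no-collision⇒H≢0 nc u₁) (trans (*-comm _ _) (trans xH (*-comm _ _)))
    same-direction (no y₁≢y₂) = contradiction (*-cancelˡ-0 (y₁≢y₂ ∘ x-y≈0⇒x≈y) collision) (nc u₁ u₂ y₁≢y₂)

  module _ (f-injective : Injective _≡_ _≡_ f) where
    injective⇒H≢0 : ∀ {y} → Unit y → H y ≢ 0#
    injective⇒H≢0 {y} u H≡0 = let x , x≢0 , x̄ = unit-ratio u in
      x≢0 (f-injective (trans (f-line x≢0 x̄) (trans (cong (x *_) H≡0) (trans (zeroʳ x) (sym f-0)))))

    -- x₁ H(y₁) / (x₂ H(y₂)) lies in the subfield, and f is linear over it.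
    injective⇒no-collision : NoCollision
    injective⇒no-collision {y₁} {y₂} u₁ u₂ y₁≢y₂ K≡0 with unit-ratio u₁ | unit-ratio u₂
    ... | x₁ , x₁≢0 , x̄₁ | x₂ , x₂≢0 , x̄₂ = y₁≢y₂ (*-cancelˡ x₁≢0 (trans (*-comm x₁ y₁) (trans (sym x̄₁) (trans x₁-direction (*-comm y₂ x₁)))))
      where
      s = x₁ * H y₁
      t = x₂ * H y₂
      t≢0 : t ≢ 0#
      t≢0 = *-nonzero x₂≢0 (injective⇒H≢0 u₂)
      c = s * t ⁻¹
      ct : c * t ≡ s
      ct = combine₁ s (inverseʳ t t≢0) (solve 3 (λ s t i → s :* i :* t :- s := s :* (t :* i :- # 1)) refl s t (t ⁻¹))
      conj-line : ∀ {x y} → conj x ≡ y * x → conj (x * H y) ≡ y * x * conj (H y)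
      conj-line {x} {y} x̄ = trans (conj-* x (H y)) (cong (_* conj (H y)) x̄)
      HH̄ : y₁ * (conj (H y₁) * H y₂) ≡ y₂ * (conj (H y₂) * H y₁)
      HH̄ = x-y≈0⇒x≈y (*-cancelˡ-0 (*-nonzero (unit-nonzero u₁) (unit-nonzero u₂))
        (trans (sym (K-identity-H u₁ u₂)) (trans (*-congˡ K≡0) (zeroʳ _))))
      st : conj s * t ≡ s * conj t
      st = trans (cong (_* t) (conj-line x̄₁)) (trans (combine₁ (x₁ * x₂) HH̄
          (solve 8 (λ x₁ x₂ y₁ y₂ g ḡ h h̄ → y₁ :* x₁ :* ḡ :* (x₂ :* h) :- x₁ :* g :* (y₂ :* x₂ :* h̄) :=
            (x₁ :* x₂) :* (y₁ :* (ḡ :* h) :- y₂ :* (h̄ :* g))) refl x₁ x₂ y₁ y₂ (H y₁) (conj (H y₁)) (H y₂) (conj (H y₂))))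
        (cong (s *_) (sym (conj-line x̄₂))))
      c-real : conj c ≡ c
      c-real = *-cancelˡ (*-nonzero t≢0 (conj-nonzero t≢0)) (combine₃ t (trans (sym (conj-* c t)) (cong conj ct)) 1# st (- conj t) ct
        (solve 6 (λ c c̄ s s̄ t t̄ → t :* t̄ :* c̄ :- t :* t̄ :* c := t :* (c̄ :* t̄ :- s̄) :+ # 1 :* (s̄ :* t :- s :* t̄) :+ (:- t̄) :* (c :* t :- s))
          refl c (conj c) s (conj s) t (conj t)))
      cx₂-direction : conj (c * x₂) ≡ y₂ * (c * x₂)
      cx₂-direction = trans (conj-* c x₂) (trans (cong₂ _*_ c-real x̄₂)
        (solve 3 (λ c x y → c :* (y :* x) := y :* (c :* x)) refl c x₂ y₂))
      c≢0 : c ≢ 0#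
      c≢0 = *-nonzero (*-nonzero x₁≢0 (injective⇒H≢0 u₁)) (⁻¹-nonzero t≢0)
      cx₂≡x₁ : c * x₂ ≡ x₁
      cx₂≡x₁ = f-injective (trans (f-line (*-nonzero c≢0 x₂≢0) cx₂-direction) (trans (*-assoc _ _ _) (trans ct (sym (f-line x₁≢0 x̄₁)))))
      x₁-direction : conj x₁ ≡ y₂ * x₁
      x₁-direction = subst (λ x → conj x ≡ y₂ * x) cx₂≡x₁ cx₂-direction

  -- The two families

  -- b b̄ / (a ā)
  ratio : Carrier
  ratio = (b * a ⁻¹) * conj (b * a ⁻¹)

  ratio≡ : ratio * (a * ā) ≡ b * b̄
  ratio≡ = trans (solve 4 (λ s s̄ a ā → s :* s̄ :* (a :* ā) := (s :* a) :* (s̄ :* ā)) refl (b * a ⁻¹) (conj (b * a ⁻¹)) a ā)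
    (cong₂ _*_ s (trans (sym (conj-* (b * a ⁻¹) a)) (cong conj s)))
    where
    s : b * a ⁻¹ * a ≡ b
    s = combine₁ b (inverseʳ a a≢0) (solve 3 (λ a b i → b :* i :* a :- b := b :* (a :* i :- # 1)) refl a b (a ⁻¹))

  discriminant : Carrier
  discriminant = 1# - nat 4 * ratio

  discriminant≡ : a * ā * discriminant ≡ a * ā - nat 4 * (b * b̄)
  discriminant≡ = combine₁ (- nat 4) ratio≡ (solve 3 (λ t r s → t :* (# 1 :- # 4 :* r) :- (t :- # 4 :* s) := (:- # 4) :* (r :* t :- s))
    refl (a * ā) ratio (b * b̄))

  module Family₁ (condition : a * b + n * ā ≡ 0#) where
    condition-conj : ā * b̄ + n * a ≡ 0#
    condition-conj = trans (cong₂ _+_ (sym (conj-* a b)) (trans (cong₂ _*_ (sym conj-n) (sym conj-ā)) (sym (conj-* n ā))))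
      (trans (sym (conj-+ (a * b) (n * ā))) (trans (cong conj condition) conj-0))

    bb̄≡n² : b * b̄ ≡ n * n
    bb̄≡n² = *-cancelˡ aā≢0 (combine₂ (ā * b̄) condition (- (n * ā)) condition-conj
      (solve 5 (λ a ā b b̄ n → a :* ā :* (b :* b̄) :- a :* ā :* (n :* n) :=
        (ā :* b̄) :* (a :* b :+ n :* ā :- # 0) :+ (:- (n :* ā)) :* (ā :* b̄ :+ n :* a :- # 0)) refl a ā b b̄ n))

    -- In this family K(x, y) = β(x) β(y) / (n + 1). Hence α and γ are multiples of β(y), and E is a
    -- constant times β(y)².
    aα≡nβ : ∀ y → a * α y ≡ n * β y
    aα≡nβ y = combine₂ (- (y * y)) condition y bb̄≡n²
      (solve 5 (λ a ā b b̄ y → let n = P.n a ā b b̄ in a :* P.α a ā b b̄ y :- n :* P.β a ā b b̄ y :=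
        (:- (y :* y)) :* (a :* b :+ n :* ā :- # 0) :+ y :* (b :* b̄ :- n :* n)) refl a ā b b̄ y)

    āγ≡nβ : ∀ y → ā * γ y ≡ n * β y
    āγ≡nβ y = combine₂ (- 1#) condition-conj y bb̄≡n²
      (solve 5 (λ a ā b b̄ y → let n = P.n a ā b b̄ in ā :* P.γ a ā b b̄ y :- n :* P.β a ā b b̄ y :=
        (:- # 1) :* (ā :* b̄ :+ n :* a :- # 0) :+ y :* (b :* b̄ :- n :* n)) refl a ā b b̄ y)

    E≡discriminant*β² : ∀ y → E y ≡ discriminant * (β y * β y)
    E≡discriminant*β² y = *-cancelˡ aā≢0 (combine₄ (- nat 4 * (ā * γ y)) (aα≡nβ y) (- nat 4 * (n * β y)) (āγ≡nβ y)
      (nat 4 * (β y * β y)) bb̄≡n² (- (β y * β y)) discriminant≡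
      (solve 9 (λ a ā b b̄ n d α β γ → a :* ā :* (β :* β :+ (:- (# 4 :* α :* γ))) :- a :* ā :* (d :* (β :* β)) :=
        (:- # 4 :* (ā :* γ)) :* (a :* α :- n :* β) :+ (:- # 4 :* (n :* β)) :* (ā :* γ :- n :* β) :+ (# 4 :* (β :* β)) :* (b :* b̄ :- n :* n)
        :+ (:- (β :* β)) :* (a :* ā :* d :- (a :* ā :- # 4 :* (b :* b̄)))) refl a ā b b̄ n discriminant (α y) (β y) (γ y)))

    aā≡ : a * ā ≡ n * (n + 1#)
    aā≡ = combine₁ 1# bb̄≡n² (solve 4 (λ a ā b b̄ → let n = P.n a ā b b̄ in a :* ā :- n :* (n :+ # 1) := # 1 :* (b :* b̄ :- n :* n)) refl a ā b b̄)

    -- (ā y - a ȳ)² = discriminant (n + 1)² if β(y) = 0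
    β≢0 : ∀ {r} → r * r ≡ discriminant → conj r ≡ r → r ≢ 0# → ∀ {y} → Unit y → β y ≢ 0#
    β≢0 {r} rr≡ r-real r≢0 {y} u β≡0 = *-nonzero r≢0 n+1≢0 (square-imaginary-real w-imaginary r[n+1]-real ww≡)
      where
      ȳ = conj y
      w = ā * y - a * ȳ
      n+1≢0 : n + 1# ≢ 0#
      n+1≢0 eq = aā≢0 (trans aā≡ (trans (cong (n *_) eq) (zeroʳ n)))
      n≢0 : n ≢ 0#
      n≢0 eq = aā≢0 (trans aā≡ (trans (cong (_* (n + 1#)) eq) (zeroˡ _)))
      w-imaginary : conj w ≡ - w
      w-imaginary = trans (conj-sub (ā * y) (a * ȳ)) (trans (cong₂ _-_ (trans (conj-* ā y) (cong (_* ȳ) conj-ā))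
        (trans (conj-* a ȳ) (cong (ā *_) (conj-involutive y)))) (solve 2 (λ s t → s :- t := :- (t :- s)) refl (a * ȳ) (ā * y)))
      r[n+1]-real : conj (r * (n + 1#)) ≡ r * (n + 1#)
      r[n+1]-real = trans (conj-* r (n + 1#)) (cong₂ _*_ r-real (trans (conj-+ n 1#) (cong₂ _+_ conj-n conj-1)))
      sum≡ : ā * y + a * ȳ ≡ - (n + 1#)
      sum≡ = combine₂ ȳ β≡0 (- (ā * y + n + 1#)) u (solve 5 (λ a ā n y ȳ → ā :* y :+ a :* ȳ :- (:- (n :+ # 1)) :=
        ȳ :* (ā :* y :* y :+ (n :+ # 1) :* y :+ a :- # 0) :+ (:- (ā :* y :+ n :+ # 1)) :* (y :* ȳ :- # 1)) refl a ā n y ȳ)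
      discriminant[n+1] : discriminant * (n + 1#) ≡ 1# - nat 3 * n
      discriminant[n+1] = *-cancelˡ n≢0 (combine₃ (- discriminant) aā≡ 1# (trans discriminant≡ (cong₂ (λ s t → s - nat 4 * t) aā≡ bb̄≡n²)) 0# bb̄≡n²
        (solve 4 (λ n d t s → n :* (d :* (n :+ # 1)) :- n :* (# 1 :- # 3 :* n) :=
          (:- d) :* (t :- n :* (n :+ # 1)) :+ # 1 :* (t :* d :- (n :* (n :+ # 1) :- # 4 :* (n :* n))) :+ # 0 :* (s :- n :* n)) refl n discriminant (a * ā) (b * b̄)))
      -- w² = (ā y + a ȳ)² - 4 a ā = (n + 1)² - 4 n (n + 1) = (n + 1)(1 - 3n).
      ww≡ : w * w ≡ r * (n + 1#) * (r * (n + 1#))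
      ww≡ = combine₄ (ā * y + a * ȳ - (n + 1#)) sum≡ (- nat 4 * (a * ā)) u (- ((n + 1#) * (n + 1#))) rr≡
        1# (trans (cong (λ t → (n + 1#) * (n + 1#) - nat 4 * t) aā≡) (sym (trans (cong ((n + 1#) *_) discriminant[n+1])
          (solve 1 (λ n → (n :+ # 1) :* (# 1 :- # 3 :* n) := (n :+ # 1) :* (n :+ # 1) :- # 4 :* (n :* (n :+ # 1))) refl n))))
        (solve 7 (λ a ā n y ȳ r d → let w = ā :* y :- a :* ȳ in w :* w :- r :* (n :+ # 1) :* (r :* (n :+ # 1)) :=
          (ā :* y :+ a :* ȳ :- (n :+ # 1)) :* (ā :* y :+ a :* ȳ :- (:- (n :+ # 1))) :+ (:- # 4 :* (a :* ā)) :* (y :* ȳ :- # 1)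
          :+ (:- ((n :+ # 1) :* (n :+ # 1))) :* (r :* r :- d)
          :+ # 1 :* ((n :+ # 1) :* (n :+ # 1) :- # 4 :* (a :* ā) :- (n :+ # 1) :* (d :* (n :+ # 1)))) refl a ā n y ȳ r discriminant)

  module Family₂ (condition : ā + nat 3 * (a * b) ≡ 0#) where
    condition-conj : a + nat 3 * (ā * b̄) ≡ 0#
    condition-conj = trans (cong₂ _+_ (sym conj-ā) (trans (cong₂ _*_ (sym (conj-nat 3)) (sym (conj-* a b))) (sym (conj-* (nat 3) (a * b)))))
      (trans (sym (conj-+ ā (nat 3 * (a * b)))) (trans (cong conj condition) conj-0))

    9bb̄≡1 : nat 9 * (b * b̄) ≡ 1#
    9bb̄≡1 = *-cancelˡ aā≢0 (combine₂ (nat 3 * (ā * b̄)) condition (- ā) condition-conj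
      (solve 4 (λ a ā b b̄ → a :* ā :* (# 9 :* (b :* b̄)) :- a :* ā :* # 1 :=
        (# 3 :* (ā :* b̄)) :* (ā :+ # 3 :* (a :* b) :- # 0) :+ (:- ā) :* (a :+ # 3 :* (ā :* b̄) :- # 0)) refl a ā b b̄))

    -- Here 9 a ā K(x, y) = 3 s(x) s(y) + a ā ω (x - y)². This conic lies in the pencil of (x - y)²
    -- = 0 and two of its tangents, hence is doubly tangent to it. The formulas for 9aα, 9āγ and 9β
    -- below are the coefficients of this identity.
    s : Carrier → Carrier
    s y = ā * y * y + nat 3 * (a * ā) * y + a

    discriminant₂ : Carrier
    discriminant₂ = - nat 3 * discriminant

    ω : Carrier
    ω = nat 9 * (a * ā) - nat 4

    ω≡ : nat 9 * (a * ā) * discriminant₂ ≡ - (nat 3 * ω)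
    ω≡ = combine₂ (- nat 27) discriminant≡ (nat 12) 9bb̄≡1
      (solve 3 (λ t d s → # 9 :* t :* ((:- # 3) :* d) :- (:- (# 3 :* (# 9 :* t :- # 4))) :=
        (:- # 27) :* (t :* d :- (t :- # 4 :* s)) :+ # 12 :* (# 9 :* s :- # 1)) refl (a * ā) discriminant (b * b̄))

    9aα≡ : ∀ y → nat 9 * a * α y ≡ nat 3 * s y + a * ω
    9aα≡ y = combine₂ (- nat 3 * (y * y)) condition (- a) 9bb̄≡1
      (solve 5 (λ a ā b b̄ y → # 9 :* a :* P.α a ā b b̄ y :- (# 3 :* (ā :* y :* y :+ # 3 :* (a :* ā) :* y :+ a) :+ a :* (# 9 :* (a :* ā) :- # 4)) :=
        (:- # 3 :* (y :* y)) :* (ā :+ # 3 :* (a :* b) :- # 0) :+ (:- a) :* (# 9 :* (b :* b̄) :- # 1)) refl a ā b b̄ y)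

    9āγ≡ : ∀ y → nat 9 * ā * γ y ≡ nat 3 * s y + ā * ω * (y * y)
    9āγ≡ y = combine₂ (- nat 3) condition-conj (- ā * (y * y)) 9bb̄≡1
      (solve 5 (λ a ā b b̄ y → # 9 :* ā :* P.γ a ā b b̄ y :- (# 3 :* (ā :* y :* y :+ # 3 :* (a :* ā) :* y :+ a) :+ ā :* (# 9 :* (a :* ā) :- # 4) :* (y :* y)) :=
        (:- # 3) :* (a :+ # 3 :* (ā :* b̄) :- # 0) :+ (:- ā :* (y :* y)) :* (# 9 :* (b :* b̄) :- # 1)) refl a ā b b̄ y)

    9β≡ : ∀ y → nat 9 * β y ≡ nat 9 * s y - nat 2 * ω * y
    9β≡ y = combine₁ (- y) 9bb̄≡1
      (solve 5 (λ a ā b b̄ y → # 9 :* P.β a ā b b̄ y :- (# 9 :* (ā :* y :* y :+ # 3 :* (a :* ā) :* y :+ a) :- # 2 :* (# 9 :* (a :* ā) :- # 4) :* y) :=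
        (:- y) :* (# 9 :* (b :* b̄) :- # 1)) refl a ā b b̄ y)

    9≢0 : nat 9 ≢ 0#
    9≢0 eq = *-nonzero nat3≢0 nat3≢0 (trans (solve 0 (# 3 :* # 3 := # 9) refl) eq)

    9E≡discriminant₂*s² : ∀ y → nat 9 * E y ≡ discriminant₂ * (s y * s y)
    9E≡discriminant₂*s² y = *-cancelˡ (*-nonzero 9≢0 aā≢0)
      (combine₄ (- nat 4 * (nat 9 * ā * γ y)) (9aα≡ y) (- nat 4 * (nat 3 * s y + a * ω)) (9āγ≡ y)
        (a * ā * (nat 9 * β y + (nat 9 * s y - nat 2 * ω * y))) (9β≡ y) (- (s y * s y)) ω≡
        (solve 7 (λ a ā y α β γ c → let s = ā :* y :* y :+ # 3 :* (a :* ā) :* y :+ a ; ω = # 9 :* (a :* ā) :- # 4 in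
          # 9 :* (a :* ā) :* (# 9 :* (β :* β :+ (:- (# 4 :* α :* γ)))) :- # 9 :* (a :* ā) :* (c :* (s :* s)) :=
          (:- # 4 :* (# 9 :* ā :* γ)) :* (# 9 :* a :* α :- (# 3 :* s :+ a :* ω))
          :+ (:- # 4 :* (# 3 :* s :+ a :* ω)) :* (# 9 :* ā :* γ :- (# 3 :* s :+ ā :* ω :* (y :* y)))
          :+ (a :* ā :* (# 9 :* β :+ (# 9 :* s :- # 2 :* ω :* y))) :* (# 9 :* β :- (# 9 :* s :- # 2 :* ω :* y))
          :+ (:- (s :* s)) :* (# 9 :* (a :* ā) :* c :- (:- (# 3 :* ω)))) refl a ā y (α y) (β y) (γ y) discriminant₂))

    conj-s : ∀ {y} → Unit y → conj (s y) * (y * y) ≡ s y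
    conj-s {y} u = trans (cong (_* (y * y)) expand) (combine₁ (a * (y * ȳ + 1#) + nat 3 * (a * ā) * y) u
      (solve 4 (λ a ā y ȳ → (a :* ȳ :* ȳ :+ # 3 :* (a :* ā) :* ȳ :+ ā) :* (y :* y) :- (ā :* y :* y :+ # 3 :* (a :* ā) :* y :+ a) :=
        (a :* (y :* ȳ :+ # 1) :+ # 3 :* (a :* ā) :* y) :* (y :* ȳ :- # 1)) refl a ā y ȳ))
      where
      ȳ = conj y
      expand : conj (s y) ≡ a * ȳ * ȳ + nat 3 * (a * ā) * ȳ + ā
      expand = trans (conj-+₃ (ā * y * y) (nat 3 * (a * ā) * y) a) (cong₂ _+_ (cong₂ _+_
        (trans (conj-*₃ ā y y) (cong (λ z → z * ȳ * ȳ) conj-ā))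
        (trans (conj-*₃ (nat 3) (a * ā) y) (cong₂ (λ u v → u * v * ȳ) (conj-nat 3) (trans (conj-* a ā) (trans (cong (ā *_) conj-ā) (*-comm ā a)))))) refl)

  -- Sufficiency

  -- If E(y) / y² = z², the roots of K(-, y) are not on the circle: (2 α x + β) ȳ would be imaginary.
  root-off-circle : ∀ {x y k z} → Unit x → Unit y → K x y ≡ 0# → conj k ≡ k → conj z ≡ z →
                    k * k * reduced-E y ≡ z * z → z ≡ 0#
  root-off-circle {x} {y} {k} {z} ux uy K≡0 k-real z-real eq = square-imaginary-real kw-imaginary z-real
    (trans (combine₂ (nat 4 * α y * (ȳ * ȳ) * (k * k)) K≡0 (k * k * (ȳ * ȳ)) (K-square x y)
      (solve 7 (λ α β x ȳ k κ e → k :* ((# 2 :* α :* x :+ β) :* ȳ) :* (k :* ((# 2 :* α :* x :+ β) :* ȳ)) :- k :* k :* (e :* (ȳ :* ȳ)) :=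
        (# 4 :* α :* (ȳ :* ȳ) :* (k :* k)) :* (κ :- # 0) :+ (k :* k :* (ȳ :* ȳ)) :* ((# 2 :* α :* x :+ β) :* (# 2 :* α :* x :+ β) :- (# 4 :* α :* κ :+ e)))
        refl (α y) (β y) x ȳ k (K x y) (E y))) eq)
    where
    ȳ = conj y
    w = (nat 2 * α y * x + β y) * ȳ
    w-imaginary : conj w ≡ - w
    w-imaginary = *-cancelˡ (*-nonzero (unit-nonzero uy) (unit-nonzero uy)) (begin
      y * y * conj w
        ≡⟨ cong (y * y *_) (trans (conj-* (nat 2 * α y * x + β y) ȳ) (cong₂ _*_ (trans (conj-+ (nat 2 * α y * x) (β y))
             (cong (_+ conj (β y)) (trans (conj-*₃ (nat 2) (α y) x) (cong (λ t → t * conj (α y) * conj x) (conj-nat 2))))) (conj-involutive y))) ⟩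
      y * y * ((nat 2 * conj (α y) * conj x + conj (β y)) * y)
        ≡⟨ solve 4 (λ y ᾱ x̄ β̄ → y :* y :* ((# 2 :* ᾱ :* x̄ :+ β̄) :* y) := (# 2 :* (ᾱ :* (y :* y)) :* x̄ :+ β̄ :* (y :* y)) :* y) refl y (conj (α y)) (conj x) (conj (β y)) ⟩
      (nat 2 * (conj (α y) * (y * y)) * conj x + conj (β y) * (y * y)) * y
        ≡⟨ cong₂ (λ s t → (nat 2 * s * conj x + t) * y) (conj-α uy) (conj-β uy) ⟩
      (nat 2 * γ y * conj x + β y) * y
        ≡⟨ combine₃ (nat 2 * conj x * y) K≡0 (- (nat 2 * y * (α y * x + β y))) ux ((nat 2 * α y * x + β y) * y) uy
             (solve 7 (λ α β γ x x̄ y ȳ → (# 2 :* γ :* x̄ :+ β) :* y :- y :* y :* (:- ((# 2 :* α :* x :+ β) :* ȳ)) :=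
               (# 2 :* x̄ :* y) :* (α :* x :* x :+ β :* x :+ γ :- # 0) :+ (:- (# 2 :* y :* (α :* x :+ β))) :* (x :* x̄ :- # 1)
               :+ ((# 2 :* α :* x :+ β) :* y) :* (y :* ȳ :- # 1)) refl (α y) (β y) (γ y) x (conj x) y ȳ) ⟩
      y * y * (- w) ∎)
      where open ≡-Reasoning
    kw-imaginary : conj (k * w) ≡ - (k * w)
    kw-imaginary = trans (conj-* k w) (trans (cong₂ _*_ k-real w-imaginary) (solve 2 (λ k w → k :* (:- w) := :- (k :* w)) refl k w))

  family₁⇒no-collision : a * b + n * ā ≡ 0# → IsNonzeroSquareIn𝔽 F q discriminant → NoCollision
  family₁⇒no-collision condition (r , r-real , r≢0 , rr≡) {x} {y} ux uy x≢y K≡0 =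
    *-nonzero r≢0 (*-nonzero (β≢0 rr≡ r-real r≢0 uy) (conj-nonzero (unit-nonzero uy)))
      (root-off-circle ux uy K≡0 conj-1 z-real (trans (cong (λ e → 1# * 1# * (e * (ȳ * ȳ))) (E≡discriminant*β² y))
        (combine₁ (- (β y * β y * (ȳ * ȳ))) rr≡ (solve 4 (λ d β ȳ r → # 1 :* # 1 :* (d :* (β :* β) :* (ȳ :* ȳ)) :- r :* (β :* ȳ) :* (r :* (β :* ȳ)) :=
          (:- (β :* β :* (ȳ :* ȳ))) :* (r :* r :- d)) refl discriminant (β y) ȳ r))))
    where
    open Family₁ condition
    ȳ = conj y
    z-real : conj (r * (β y * ȳ)) ≡ r * (β y * ȳ)
    z-real = trans (conj-* r (β y * ȳ)) (cong₂ _*_ r-real (conj-quotient uy (conj-β uy)))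

  family₂⇒no-collision : ā + nat 3 * (a * b) ≡ 0# → IsNonzeroSquareIn𝔽 F q (- nat 3 * discriminant) → NoCollision
  family₂⇒no-collision condition (r , r-real , r≢0 , rr≡) {x} {y} ux uy x≢y K≡0 = split (s y ≟ 0#)
    where
    open Family₂ condition
    ȳ = conj y
    ω≢0 : ω ≢ 0#
    ω≢0 ω≡0 = *-nonzero (*-nonzero 9≢0 aā≢0) (*-nonzero r≢0 r≢0)
      (trans (cong (nat 9 * (a * ā) *_) rr≡) (trans ω≡ (trans (cong (λ t → - (nat 3 * t)) ω≡0) (solve 0 (:- (# 3 :* # 0) := # 0) refl))))
    z-real : conj (r * (s y * ȳ)) ≡ r * (s y * ȳ)
    z-real = trans (conj-* r (s y * ȳ)) (cong₂ _*_ r-real (conj-quotient uy (conj-s uy)))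
    split : Dec (s y ≡ 0#) → _
    split (no s≢0) = *-nonzero r≢0 (*-nonzero s≢0 (conj-nonzero (unit-nonzero uy)))
      (root-off-circle {k = nat 3} ux uy K≡0 (conj-nat 3) z-real (combine₂ (ȳ * ȳ) (9E≡discriminant₂*s² y) (- (s y * s y * (ȳ * ȳ))) rr≡
        (solve 5 (λ e d s ȳ r → # 3 :* # 3 :* (e :* (ȳ :* ȳ)) :- r :* (s :* ȳ) :* (r :* (s :* ȳ)) :=
          (ȳ :* ȳ) :* (# 9 :* e :- d :* (s :* s)) :+ (:- (s :* s :* (ȳ :* ȳ))) :* (r :* r :- d)) refl (E y) discriminant₂ (s y) ȳ r)))
    -- At a zero of s, K(-, y) is a nonzero multiple of (X - y)², whose only root is y.
    split (yes s≡0) = x≢y (x-y≈0⇒x≈y (^≡0⇒≡0 2 (*-cancelˡ-0 (*-nonzero aā≢0 ω≢0) (combine₄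
      (nat 9 * (a * ā)) K≡0 (- ā * (x * x)) 9aα (- a) 9āγ (- (a * ā) * x) 9β
      (solve 8 (λ a ā x y α β γ ω → a :* ā :* ω :* ((x :- y) :* ((x :- y) :* # 1)) :- # 0 :=
        (# 9 :* (a :* ā)) :* (α :* x :* x :+ β :* x :+ γ :- # 0) :+ (:- ā :* (x :* x)) :* (# 9 :* a :* α :- a :* ω)
        :+ (:- a) :* (# 9 :* ā :* γ :- ā :* ω :* (y :* y)) :+ (:- (a :* ā) :* x) :* (# 9 :* β :- (:- (# 2 :* ω :* y)))) refl a ā x y (α y) (β y) (γ y) ω)))))
      where
      9aα : nat 9 * a * α y ≡ a * ω
      9aα = trans (9aα≡ y) (trans (cong (λ t → nat 3 * t + a * ω) s≡0) (solve 1 (λ x → # 3 :* # 0 :+ x := x) refl (a * ω)))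
      9āγ : nat 9 * ā * γ y ≡ ā * ω * (y * y)
      9āγ = trans (9āγ≡ y) (trans (cong (λ t → nat 3 * t + ā * ω * (y * y)) s≡0) (solve 1 (λ x → # 3 :* # 0 :+ x := x) refl (ā * ω * (y * y))))
      9β : nat 9 * β y ≡ - (nat 2 * ω * y)
      9β = trans (9β≡ y) (trans (cong (λ t → nat 9 * t - nat 2 * ω * y) s≡0) (solve 1 (λ x → # 9 :* # 0 :- x := :- x) refl (nat 2 * ω * y)))

  -- Necessity

  -- A double root is a y with E(y) = 0 and K(-, y) = α(y) (X - y)².
  SquareAt DoubleRootAt : Carrier → Set
  SquareAt y = ∃ λ z → z ≢ 0# × conj z ≡ z × reduced-E y ≡ z * z
  DoubleRootAt y = E y ≡ 0# × β y ≡ - (nat 2 * α y * y) × γ y ≡ α y * (y * y)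

  abstract
    -- E(y) / y² lies in the subfield, so its square root z is real or imaginary. If z ≠ 0 is
    -- imaginary, `root-on-circle` applies to both zy and -zy and gives the same value, so zy = 0.
    -- If E(y) = 0, it applies to δ = 0 and gives the double root.
    square-or-double-root : NoCollision → ∀ {y} → Unit y → SquareAt y ⊎ DoubleRootAt y
    square-or-double-root nc {y} u = zero-or-not (E y ≟ 0#)
      where
      ȳ : Carrier
      ȳ = conj y
      nonzero : reduced-E y ≢ 0# → SquareAt y ⊎ DoubleRootAt y
      nonzero e≢0 = signs (real-square-root e≢0 (reduced-E-real u))
        where
        signs : (∃ λ z → z * z ≡ reduced-E y × (conj z ≡ z ⊎ conj z ≡ - z)) → SquareAt y ⊎ DoubleRootAt y
        signs (z , zz≡ , inj₁ z-real) = inj₁ (z , (λ z≡0 → e≢0 (trans (sym zz≡) (trans (cong (_* z) z≡0) (zeroˡ z)))) , z-real , sym zz≡)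
        signs (z , zz≡ , inj₂ z-imaginary) = contradiction zy≡0 (*-nonzero z≢0 (unit-nonzero u))
          where
          z≢0 : z ≢ 0#
          z≢0 z≡0 = e≢0 (trans (sym zz≡) (trans (cong (_* z) z≡0) (zeroˡ z)))
          βȳ : Carrier
          βȳ = β y * ȳ
          α≢0 : α y ≢ 0#
          α≢0 α≡0 = e≢0 (trans (sym zz≡) (trans zz≡ββ (trans (cong (_* βȳ) (square-imaginary-real z-imaginary (conj-quotient u (conj-β u)) zz≡ββ)) (zeroˡ _))))
            where
            zz≡ββ : z * z ≡ βȳ * βȳ
            zz≡ββ = trans zz≡ (combine₁ (- nat 4 * γ y * (ȳ * ȳ)) α≡0 (solve 4 (λ α β γ ȳ →
              (β :* β :+ (:- (# 4 :* α :* γ))) :* (ȳ :* ȳ) :- (β :* ȳ) :* (β :* ȳ) := (:- # 4 :* γ :* (ȳ :* ȳ)) :* (α :- # 0)) refl (α y) (β y) (γ y) ȳ))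
          E≡zzyy : E y ≡ z * z * (y * y)
          E≡zzyy = trans (E≡ u) (cong (_* (y * y)) (sym zz≡))
          conj-zy : conj (z * y) * (y * y) ≡ - (z * y)
          conj-zy = trans (cong (_* (y * y)) (trans (conj-* z y) (cong (_* ȳ) z-imaginary)))
            (combine₁ (- (z * y)) u (solve 3 (λ z y ȳ → (:- z) :* ȳ :* (y :* y) :- (:- (z :* y)) := (:- (z :* y)) :* (y :* ȳ :- # 1)) refl z y ȳ))
          root₊ : z * y - β y ≡ nat 2 * α y * y
          root₊ = root-on-circle nc u α≢0 (trans (solve 2 (λ z y → z :* y :* (z :* y) := z :* z :* (y :* y)) refl z y) (sym E≡zzyy)) conj-zy
          root₋ : - (z * y) - β y ≡ nat 2 * α y * y
          root₋ = root-on-circle nc u α≢0 (trans (solve 2 (λ z y → (:- (z :* y)) :* (:- (z :* y)) := z :* z :* (y :* y)) refl z y) (sym E≡zzyy))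
            (trans (cong (_* (y * y)) (conj-neg (z * y))) (trans (solve 2 (λ c s → (:- c) :* s := :- (c :* s)) refl (conj (z * y)) (y * y)) (cong -_ conj-zy)))
          zy≡0 : z * y ≡ 0#
          zy≡0 = *-cancelˡ-0 2≢0 (combine₂ 1# root₊ (- 1#) root₋ (solve 3 (λ t β r → # 2 :* t :- # 0 := # 1 :* (t :- β :- r) :+ (:- # 1) :* (:- t :- β :- r)) refl (z * y) (β y) (nat 2 * α y * y)))
      zero-or-not : Dec (E y ≡ 0#) → SquareAt y ⊎ DoubleRootAt y
      zero-or-not (no E≢0) = nonzero (*-nonzero E≢0 (*-nonzero ȳ≢0 ȳ≢0))
        where
        ȳ≢0 : ȳ ≢ 0#
        ȳ≢0 = conj-nonzero (unit-nonzero u)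
      zero-or-not (yes E≡0) = inj₂ (E≡0 , β≡ , γ≡)
        where
        α≢0 : α y ≢ 0#
        α≢0 α≡0 = K-degenerate nc u α≡0 (^≡0⇒≡0 2 (combine₂ 1# E≡0 (nat 4 * γ y) α≡0 (solve 3 (λ α β γ → β :* (β :* # 1) :- # 0 :=
          # 1 :* (β :* β :+ (:- (# 4 :* α :* γ)) :- # 0) :+ (# 4 :* γ) :* (α :- # 0)) refl (α y) (β y) (γ y))))
        β≡ : β y ≡ - (nat 2 * α y * y)
        β≡ = combine₁ (- 1#) (root-on-circle nc {δ = 0#} u α≢0 (trans (zeroˡ 0#) (sym E≡0)) (trans (cong (_* (y * y)) conj-0) (solve 1 (λ s → # 0 :* s := :- # 0) refl (y * y))))
          (solve 2 (λ β r → β :- (:- r) := (:- # 1) :* (# 0 :- β :- r)) refl (β y) (nat 2 * α y * y))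
        γ≡ : γ y ≡ α y * (y * y)
        γ≡ = *-cancelˡ (*-nonzero (*-nonzero 2≢0 2≢0) α≢0) (combine₂ (β y - nat 2 * α y * y) β≡ (- 1#) E≡0
          (solve 4 (λ α β γ y → # 2 :* # 2 :* α :* γ :- # 2 :* # 2 :* α :* (α :* (y :* y)) :=
            (β :- # 2 :* α :* y) :* (β :- (:- (# 2 :* α :* y))) :+ (:- # 1) :* (β :* β :+ (:- (# 4 :* α :* γ)) :- # 0)) refl (α y) (β y) (γ y) y))

    -- A double root y satisfies K(y, y) = 0. This is a quartic in y with leading coefficient -b ≠
    -- 0, so it cannot vanish on all of the circle.
    square-at : NoCollision → ∃ λ y → Unit y × SquareAt y
    square-at nc = search (any? (λ y → (y * conj y ≟ 1#) ×-dec ¬? (K y y ≟ 0#)))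
      where
      kᵢ : Series
      kᵢ = quartic (- b̄) (nat 2 * a) (nat 3 * n + 1#) (nat 2 * ā) (- b)
      search : Dec (∃ λ y → Unit y × K y y ≢ 0#) → ∃ λ y → Unit y × SquareAt y
      search (yes (y , u , K≢0)) = y , u , fromInj₁ square (square-or-double-root nc u)
        where
        square : DoubleRootAt y → SquareAt y
        square (_ , β≡ , γ≡) = contradiction (combine₂ y β≡ 1# γ≡ (solve 4 (λ α β γ y → (α :* y :* y :+ β :* y :+ γ) :- # 0 :=
          y :* (β :- (:- (# 2 :* α :* y))) :+ # 1 :* (γ :- α :* (y :* y))) refl (α y) (β y) (γ y) y)) K≢0
      search (no ∄) = contradiction (trans (solve 1 (λ b → b := :- (:- b)) refl b) (trans (cong -_ (roots-unit kᵢ root (ℕ.≤-trans 5≤q (ℕ.n≤1+n q))))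
          (solve 0 (:- # 0 := # 0) refl))) b≢0
        where
        root : ∀ {y} → Unit y → eval (suc q) kᵢ y ≡ 0#
        root {y} u = trans (eval-degree {kᵢ} degree-quartic (ℕ.≤-trans 5≤q (ℕ.n≤1+n q)) y)
          (trans (solve 5 (λ a ā b b̄ y → (:- b̄) :+ y :* (# 2 :* a :+ y :* (# 3 :* P.n a ā b b̄ :+ # 1 :+ y :* (# 2 :* ā :+ y :* (:- b :+ y :* # 0)))) := P.K a ā b b̄ y y) refl a ā b b̄ y)
            (decidable-stable (K y y ≟ 0#) (λ K≢0 → ∄ (y , u , K≢0))))

  E-eval : ∀ y → eval 5 (quartic e₀ e₁ e₂ e₃ e₄) y ≡ E y
  E-eval = solve 5 (λ a ā b b̄ y → P.e₀ a ā b b̄ :+ y :* (P.e₁ a ā b b̄ :+ y :* (P.e₂ a ā b b̄ :+ y :* (P.e₃ a ā b b̄ :+ y :* (P.e₄ a ā b b̄ :+ y :* # 0)))) := P.E a ā b b̄ y)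
    refl a ā b b̄

  conj-e₀ : conj e₀ ≡ e₄
  conj-e₀ = trans (conj-+ (a * a) (nat 4 * b̄ * n)) (cong₂ _+_ (conj-* a a) (trans (conj-*₃ (nat 4) b̄ n)
    (cong₂ _*_ (cong₂ _*_ (conj-nat 4) conj-b̄) conj-n)))

  conj-e₁ : conj e₁ ≡ e₃
  conj-e₁ = trans (conj-+ (nat 2 * a * (1# - n)) (nat 4 * ā * b̄)) (cong₂ _+_
    (trans (conj-*₃ (nat 2) a (1# - n)) (cong₂ _*_ (cong (_* ā) (conj-nat 2)) (trans (conj-sub 1# n) (cong₂ _-_ conj-1 conj-n))))
    (trans (conj-*₃ (nat 4) ā b̄) (cong₂ _*_ (cong₂ _*_ (conj-nat 4) conj-ā) conj-b̄)))

  square-power : ∀ {y} → Unit y → SquareAt y → E y ^ m * (y * y) ≡ 1#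
  square-power {y} u (z , z≢0 , z-real , e≡zz) = begin
    E y ^ m * (y * y)                          ≡⟨ cong (λ t → t ^ m * (y * y)) (trans (E≡ u) (cong (_* (y * y)) e≡zz)) ⟩
    (z * z * (y * y)) ^ m * (y * y)            ≡⟨ cong (_* (y * y)) (trans (*-^ (z * z) (y * y) m) (cong₂ _*_ (square-^ z) (square-^ y))) ⟩
    z ^ (m ℕ.* 2) * y ^ (m ℕ.* 2) * (y * y)    ≡⟨ cong (λ t → t * y ^ (m ℕ.* 2) * (y * y)) (^-m*2 z≢0 z-real) ⟩
    1# * y ^ (m ℕ.* 2) * (y * y)               ≡⟨ combine₂ (- y) (conj≡* y) 1# u (solve 3 (λ y ȳ p → # 1 :* p :* (y :* y) :- # 1 :=
                                                    (:- y) :* (ȳ :- y :* p) :+ # 1 :* (y :* ȳ :- # 1)) refl y (conj y) (y ^ (m ℕ.* 2))) ⟩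
    1#                                         ∎
    where
    open ≡-Reasoning
    square-^ : ∀ x → (x * x) ^ m ≡ x ^ (m ℕ.* 2)
    square-^ x = trans (cong (λ t → (x * t) ^ m) (sym (*-identityʳ x))) (sym (^-* x m 2))

  IsSquare : Set
  IsSquare = SquareQuartic e₀ e₁ e₂ e₃ e₄

  no-double-root : (∀ {y} → Unit y → SquareAt y) → IsSquare
  no-double-root square = square-quartic {e₀} {e₁} {e₂} {e₃} {e₄}
    (λ e₀≡0 → trans (sym conj-e₀) (trans (cong conj e₀≡0) conj-0))
    (λ e₁≡0 → trans (sym conj-e₁) (trans (cong conj e₁≡0) conj-0))
    (λ {y} u → trans (cong₂ (λ s t → s ^ m * (y * t)) (E-eval y) (*-identityʳ y)) (square-power u (square u)))

  -- Double roots of E on the circle.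

  module DoubleRoot {y₀} (u₀ : Unit y₀) (double-root : DoubleRootAt y₀) where
    E′ : Carrier → Carrier
    E′ y = e₁ + nat 2 * e₂ * y + nat 3 * e₃ * (y * y) + nat 4 * e₄ * (y * y * y)

    -- Substituting β and γ in E′ = 2ββ′ - 4α′γ - 4αγ′ gives -4α ∂K/∂y at x = y. By symmetry of K
    -- this partial derivative equals ∂K/∂x, which vanishes at a double root.
    E′≡0 : ∀ {y} → DoubleRootAt y → E′ y ≡ 0#
    E′≡0 {y} (_ , β≡ , γ≡) = combine₂ (nat 2 * (nat 2 * ā * y + n + 1#) - nat 4 * α y) β≡ (- nat 4 * (ā - nat 2 * b * y)) γ≡
      (solve 5 (λ a ā b b̄ y → let n = P.n a ā b b̄ ; α = P.α a ā b b̄ y in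
        P.e₁ a ā b b̄ :+ # 2 :* P.e₂ a ā b b̄ :* y :+ # 3 :* P.e₃ a ā b b̄ :* (y :* y) :+ # 4 :* P.e₄ a ā b b̄ :* (y :* y :* y) :- # 0 :=
        (# 2 :* (# 2 :* ā :* y :+ n :+ # 1) :- # 4 :* α) :* (P.β a ā b b̄ y :- (:- (# 2 :* α :* y)))
        :+ (:- # 4 :* (ā :- # 2 :* b :* y)) :* (P.γ a ā b b̄ y :- α :* (y :* y))) refl a ā b b̄ y)

    private
      ȳ₀ = conj y₀
      y₀≢0 = unit-nonzero u₀

    -- E = (X - y₀)² (ε₀ + ε₁ X + ε₂ X²)
    ε₀ ε₁ ε₂ : Carrier
    ε₀ = e₀ * (ȳ₀ * ȳ₀)
    ε₁ = e₃ + nat 2 * y₀ * e₄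
    ε₂ = e₄

    private
      E≡0 : e₀ + y₀ * (e₁ + y₀ * (e₂ + y₀ * (e₃ + y₀ * e₄))) ≡ 0#
      E≡0 = trans (solve 6 (λ e₀ e₁ e₂ e₃ e₄ y → e₀ :+ y :* (e₁ :+ y :* (e₂ :+ y :* (e₃ :+ y :* e₄))) := e₀ :+ y :* (e₁ :+ y :* (e₂ :+ y :* (e₃ :+ y :* (e₄ :+ y :* # 0)))))
        refl e₀ e₁ e₂ e₃ e₄ y₀) (trans (E-eval y₀) (proj₁ double-root))

    e₀≡ : e₀ ≡ y₀ * y₀ * ε₀
    e₀≡ = combine₁ (- e₀ * (y₀ * ȳ₀ + 1#)) u₀ (solve 3 (λ e y ȳ → e :- y :* y :* (e :* (ȳ :* ȳ)) := (:- e :* (y :* ȳ :+ # 1)) :* (y :* ȳ :- # 1)) refl e₀ y₀ ȳ₀)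

    e₁≡ : e₁ ≡ y₀ * y₀ * ε₁ - nat 2 * y₀ * ε₀
    e₁≡ = *-cancelˡ y₀≢0 (combine₃ (nat 2) E≡0 (- y₀) (E′≡0 double-root) (- nat 2) e₀≡
      (solve 7 (λ e₀ e₁ e₂ e₃ e₄ y ε → y :* e₁ :- y :* (y :* y :* (e₃ :+ # 2 :* y :* e₄) :- # 2 :* y :* ε) :=
        # 2 :* (e₀ :+ y :* (e₁ :+ y :* (e₂ :+ y :* (e₃ :+ y :* e₄))) :- # 0)
        :+ (:- y) :* (e₁ :+ # 2 :* e₂ :* y :+ # 3 :* e₃ :* (y :* y) :+ # 4 :* e₄ :* (y :* y :* y) :- # 0)
        :+ (:- # 2) :* (e₀ :- y :* y :* ε)) refl e₀ e₁ e₂ e₃ e₄ y₀ ε₀))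

    e₂≡ : e₂ ≡ ε₀ - nat 2 * y₀ * ε₁ + y₀ * y₀ * ε₂
    e₂≡ = *-cancelˡ (*-nonzero y₀≢0 y₀≢0) (combine₃ (- 1#) E≡0 y₀ (E′≡0 double-root) 1# e₀≡
      (solve 7 (λ e₀ e₁ e₂ e₃ e₄ y ε → y :* y :* e₂ :- y :* y :* (ε :- # 2 :* y :* (e₃ :+ # 2 :* y :* e₄) :+ y :* y :* e₄) :=
        (:- # 1) :* (e₀ :+ y :* (e₁ :+ y :* (e₂ :+ y :* (e₃ :+ y :* e₄))) :- # 0)
        :+ y :* (e₁ :+ # 2 :* e₂ :* y :+ # 3 :* e₃ :* (y :* y) :+ # 4 :* e₄ :* (y :* y :* y) :- # 0)
        :+ # 1 :* (e₀ :- y :* y :* ε)) refl e₀ e₁ e₂ e₃ e₄ y₀ ε₀))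

    e₃≡ : e₃ ≡ ε₁ - nat 2 * y₀ * ε₂
    e₃≡ = solve 3 (λ e₃ e₄ y → e₃ := e₃ :+ # 2 :* y :* e₄ :- # 2 :* y :* e₄) refl e₃ e₄ y₀

    E-factor : ∀ y → E y ≡ (y - y₀) * (y - y₀) * eval 3 (quadratic ε₀ ε₁ ε₂) y
    E-factor y = trans (sym (E-eval y)) (trans (cong₂ (λ s t → s + y * (t + y * (e₂ + y * (e₃ + y * (e₄ + y * 0#))))) e₀≡ e₁≡)
      (trans (cong₂ (λ s t → y₀ * y₀ * ε₀ + y * (y₀ * y₀ * ε₁ - nat 2 * y₀ * ε₀ + y * (s + y * (t + y * (e₄ + y * 0#))))) e₂≡ e₃≡)
        (solve 5 (λ ε₀ ε₁ ε₂ r y → r :* r :* ε₀ :+ y :* (r :* r :* ε₁ :- # 2 :* r :* ε₀ :+ y :* (ε₀ :- # 2 :* r :* ε₁ :+ r :* r :* ε₂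
            :+ y :* (ε₁ :- # 2 :* r :* ε₂ :+ y :* (ε₂ :+ y :* # 0)))) :=
          (y :- r) :* (y :- r) :* (ε₀ :+ y :* (ε₁ :+ y :* (ε₂ :+ y :* # 0)))) refl ε₀ ε₁ ε₂ y₀ y)))

    E′-factor : ∀ y → E′ y ≡ nat 2 * (y - y₀) * (ε₀ + ε₁ * y + ε₂ * (y * y)) + (y - y₀) * (y - y₀) * (ε₁ + nat 2 * ε₂ * y)
    E′-factor y = combine₃ 1# e₁≡ (nat 2 * y) e₂≡ (nat 3 * (y * y)) e₃≡
      (solve 8 (λ e₁ e₂ e₃ ε₀ ε₁ ε₂ r y → e₁ :+ # 2 :* e₂ :* y :+ # 3 :* e₃ :* (y :* y) :+ # 4 :* ε₂ :* (y :* y :* y)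
          :- (# 2 :* (y :- r) :* (ε₀ :+ ε₁ :* y :+ ε₂ :* (y :* y)) :+ (y :- r) :* (y :- r) :* (ε₁ :+ # 2 :* ε₂ :* y)) :=
        # 1 :* (e₁ :- (r :* r :* ε₁ :- # 2 :* r :* ε₀)) :+ (# 2 :* y) :* (e₂ :- (ε₀ :- # 2 :* r :* ε₁ :+ r :* r :* ε₂))
        :+ (# 3 :* (y :* y)) :* (e₃ :- (ε₁ :- # 2 :* r :* ε₂))) refl e₁ e₂ e₃ ε₀ ε₁ ε₂ y₀ y)

    -- Then E = ε₂ ((X - y₀)(X - y₁))². Equality y₁ = y₀ is allowed, and is what the pointed
    -- argument yields.
    second-double-root : ∀ {y₁} → ε₁ ≡ - (nat 2 * y₁ * ε₂) → ε₀ ≡ y₁ * y₁ * ε₂ → IsSquare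
    second-double-root {y₁} ε₁≡ ε₀≡ = record
      { κ = ε₂ ; s₀ = y₀ * y₁ ; s₁ = - (y₀ + y₁) ; s₂ = 1#
      ; e₀≡ = trans e₀≡ (trans (cong (y₀ * y₀ *_) ε₀≡) (solve 3 (λ ε r t → r :* r :* (t :* t :* ε) := ε :* (r :* t :* (r :* t))) refl ε₂ y₀ y₁))
      ; e₁≡ = trans e₁≡ (trans (cong₂ (λ s t → y₀ * y₀ * s - nat 2 * y₀ * t) ε₁≡ ε₀≡)
          (solve 3 (λ ε r t → r :* r :* (:- (# 2 :* t :* ε)) :- # 2 :* r :* (t :* t :* ε) := ε :* (# 2 :* (r :* t) :* (:- (r :+ t)))) refl ε₂ y₀ y₁))
      ; e₂≡ = trans e₂≡ (trans (cong₂ (λ s t → t - nat 2 * y₀ * s + y₀ * y₀ * ε₂) ε₁≡ ε₀≡)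
          (solve 3 (λ ε r t → t :* t :* ε :- # 2 :* r :* (:- (# 2 :* t :* ε)) :+ r :* r :* ε := ε :* ((:- (r :+ t)) :* (:- (r :+ t)) :+ # 2 :* (r :* t) :* # 1)) refl ε₂ y₀ y₁))
      ; e₃≡ = trans e₃≡ (trans (cong (λ s → s - nat 2 * y₀ * ε₂) ε₁≡)
          (solve 3 (λ ε r t → :- (# 2 :* t :* ε) :- # 2 :* r :* ε := ε :* (# 2 :* (:- (r :+ t)) :* # 1)) refl ε₂ y₀ y₁))
      ; e₄≡ = solve 1 (λ ε → ε := ε :* (# 1 :* # 1)) refl ε₂ }

    two-double-roots : ∀ {y₁} → y₁ ≢ y₀ → DoubleRootAt y₁ → IsSquare
    two-double-roots {y₁} y₁≢y₀ dr = second-double-root ε₁≡ (combine₂ 1# Ẽ≡0 (- y₁) ε₁≡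
        (solve 4 (λ ε₀ ε₁ ε₂ y → ε₀ :- y :* y :* ε₂ := # 1 :* ((ε₀ :+ y :* (ε₁ :+ y :* (ε₂ :+ y :* # 0))) :- # 0) :+ (:- y) :* (ε₁ :- (:- (# 2 :* y :* ε₂)))) refl ε₀ ε₁ ε₂ y₁))
      where
      d≢0 : y₁ - y₀ ≢ 0#
      d≢0 = y₁≢y₀ ∘ x-y≈0⇒x≈y
      Ẽ≡0 : eval 3 (quadratic ε₀ ε₁ ε₂) y₁ ≡ 0#
      Ẽ≡0 = *-cancelˡ-0 (*-nonzero d≢0 d≢0) (trans (sym (E-factor y₁)) (proj₁ dr))
      ε₁≡ : ε₁ ≡ - (nat 2 * y₁ * ε₂)
      ε₁≡ = *-cancelˡ (*-nonzero d≢0 d≢0) (combine₂ 1# (trans (sym (E′-factor y₁)) (E′≡0 dr)) (- nat 2 * (y₁ - y₀)) Ẽ≡0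
        (solve 5 (λ ε₀ ε₁ ε₂ r y → (y :- r) :* (y :- r) :* ε₁ :- (y :- r) :* (y :- r) :* (:- (# 2 :* y :* ε₂)) :=
          # 1 :* (# 2 :* (y :- r) :* (ε₀ :+ ε₁ :* y :+ ε₂ :* (y :* y)) :+ (y :- r) :* (y :- r) :* (ε₁ :+ # 2 :* ε₂ :* y) :- # 0)
          :+ (:- # 2 :* (y :- r)) :* (ε₀ :+ y :* (ε₁ :+ y :* (ε₂ :+ y :* # 0)) :- # 0)) refl ε₀ ε₁ ε₂ y₀ y₁))

    one-double-root : (∀ {y} → Unit y → y ≢ y₀ → SquareAt y) → IsSquare
    one-double-root square = second-double-root (pointed-square₁ u₀ power) (pointed-square₀ u₀ power)
      where
      power : ∀ {y} → Unit y → y ≢ y₀ → eval 3 (quadratic ε₀ ε₁ ε₂) y ^ m * y ≡ - y₀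
      power {y} u y≢y₀ = combine₄ (- y₀) total (y₀ * g * (y * y)) half (- (y₀ * ȳ₀ * g * y)) u (- (g * y)) u₀
        (solve 6 (λ g p y ȳ r r̄ → g :* y :- (:- r) :=
          (:- r) :* (p :* g :* (y :* y) :- # 1) :+ (r :* g :* (y :* y)) :* (p :- (:- (ȳ :* r̄))) :+ (:- (r :* r̄ :* g :* y)) :* (y :* ȳ :- # 1) :+ (:- (g :* y)) :* (r :* r̄ :- # 1))
          refl g (dd ^ m) y ȳ y₀ ȳ₀)
        where
        ȳ = conj y
        g = eval 3 (quadratic ε₀ ε₁ ε₂) y ^ m
        d = y - y₀
        dd = d * d
        d≢0 : d ≢ 0#
        d≢0 = y≢y₀ ∘ x-y≈0⇒x≈y
        total : dd ^ m * g * (y * y) ≡ 1#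
        total = trans (cong (_* (y * y)) (trans (sym (*-^ dd (eval 3 (quadratic ε₀ ε₁ ε₂) y) m)) (cong (_^ m) (sym (E-factor y))))) (square-power u (square u y≢y₀))
        -- d^(2m) = d̄ / d, and ȳ - ȳ₀ = -(y - y₀) ȳ ȳ₀ on the circle.
        half : dd ^ m ≡ - (ȳ * ȳ₀)
        half = *-cancelˡ d≢0 (trans (cong (λ t → d * (d * t) ^ m) (sym (*-identityʳ d))) (trans (cong (d *_) (sym (^-* d m 2))) (trans (sym (conj≡* d)) (trans (conj-sub y y₀)
          (combine₂ (- ȳ) u₀ ȳ₀ u (solve 4 (λ y ȳ r r̄ → ȳ :- r̄ :- (y :- r) :* (:- (ȳ :* r̄)) := (:- ȳ) :* (r :* r̄ :- # 1) :+ r̄ :* (y :* ȳ :- # 1)) refl y ȳ y₀ ȳ₀))))))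

  abstract
    -- Each zero of E on the circle is double. Two distinct ones determine the quartic up to a
    -- constant; with one or none, the differential argument applies.
    is-square : NoCollision → IsSquare
    is-square nc = search₀ (any? (λ y → (y * conj y ≟ 1#) ×-dec (E y ≟ 0#)))
      where
      no-root⇒square : ∀ {y} → Unit y → E y ≢ 0# → SquareAt y
      no-root⇒square u E≢0 = fromInj₁ (λ (E≡0 , _) → contradiction E≡0 E≢0) (square-or-double-root nc u)
      root⇒double-root : ∀ {y} → Unit y → E y ≡ 0# → DoubleRootAt y
      root⇒double-root {y} u E≡0 = fromInj₂ (λ (z , z≢0 , _ , e≡zz) → contradiction (trans (sym e≡zz) (trans (cong (_* (conj y * conj y)) E≡0) (zeroˡ _))) (*-nonzero z≢0 z≢0))
        (square-or-double-root nc u)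
      search₀ : Dec (∃ λ y → Unit y × E y ≡ 0#) → IsSquare
      search₀ (no ∄) = no-double-root (λ {y} u → no-root⇒square u (λ E≡0 → ∄ (y , u , E≡0)))
      search₀ (yes (y₀ , u₀ , E≡0)) = search₁ (any? (λ y → (y * conj y ≟ 1#) ×-dec ((E y ≟ 0#) ×-dec ¬? (y ≟ y₀))))
        where
        open DoubleRoot u₀ (root⇒double-root u₀ E≡0)
        search₁ : Dec (∃ λ y → Unit y × E y ≡ 0# × y ≢ y₀) → IsSquare
        search₁ (yes (y₁ , u₁ , E≡0 , y₁≢y₀)) = two-double-roots y₁≢y₀ (root⇒double-root u₁ E≡0)
        search₁ (no ∄) = one-double-root (λ {y} u y≢y₀ → no-root⇒square u (λ E≡0 → ∄ (y , u , E≡0 , y≢y₀)))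

  -- If num and den have a common root on the circle then K vanishes on it identically; this happens if D = 0
  -- outside the first family.
  D≡0⇒family₁ : NoCollision → D ≡ 0# → a * b + n * ā ≡ 0#
  D≡0⇒family₁ nc D≡0 = decidable-stable (d ≟ 0#) λ d≢0 → let module R = CommonRoot d≢0 in K-degenerate nc R.r-unit R.α≡0 R.β≡0
    where
    d d̄ g : Carrier
    d = a * b + n * ā
    d̄ = ā * b̄ + n * a
    g = b * b̄ - n * n
    conj-d : conj d ≡ d̄
    conj-d = trans (conj-+ (a * b) (n * ā)) (cong₂ _+_ (conj-* a b) (trans (conj-* n ā) (cong₂ _*_ conj-n conj-ā)))
    conj-g : conj g ≡ g
    conj-g = trans (conj-sub (b * b̄) (n * n)) (cong₂ _-_ (trans (conj-* b b̄) (trans (cong (b̄ *_) conj-b̄) (*-comm b̄ b))) (trans (conj-* n n) (cong₂ _*_ conj-n conj-n)))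
    gg : g * g ≡ d * d̄
    gg = combine₁ (- n) D≡0 (solve 4 (λ a ā b b̄ → let n = P.n a ā b b̄ ; g = b :* b̄ :- n :* n in
      g :* g :- (a :* b :+ n :* ā) :* (ā :* b̄ :+ n :* a) := (:- n) :* (P.D a ā b b̄ :- # 0)) refl a ā b b̄)
    module CommonRoot (d≢0 : d ≢ 0#) where
      -- g lies in the subfield and g² = d d̄, so g / d lies on the circle.
      r : Carrier
      r = g * d ⁻¹
      rd : r * d ≡ g
      rd = combine₁ g (inverseʳ d d≢0) (solve 3 (λ d g i → g :* i :* d :- g := g :* (d :* i :- # 1)) refl d g (d ⁻¹))
      rg : r * g ≡ d̄
      rg = *-cancelˡ d≢0 (combine₂ g rd 1# gg (solve 4 (λ r d g d̄ → d :* (r :* g) :- d :* d̄ := g :* (r :* d :- g) :+ # 1 :* (g :* g :- d :* d̄)) refl r d g d̄))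
      r-unit : Unit r
      r-unit = *-cancelˡ (*-nonzero d≢0 (conj-nonzero d≢0)) (combine₃ (conj r * conj d) rd g (trans (sym (conj-* r d)) (trans (cong conj rd) conj-g))
        1# (trans gg (cong (d *_) (sym conj-d)))
        (solve 5 (λ r r̄ d d̄ g → d :* d̄ :* (r :* r̄) :- d :* d̄ :* # 1 := (r̄ :* d̄) :* (r :* d :- g) :+ g :* (r̄ :* d̄ :- g) :+ # 1 :* (g :* g :- d :* d̄))
          refl r (conj r) d (conj d) g))
      α≡0 : α r ≡ 0#
      α≡0 = *-cancelˡ-0 d≢0 (combine₂ (- (b * r) + ā) rd (- b) rg
        (solve 5 (λ a ā b b̄ r → let n = P.n a ā b b̄ ; d = a :* b :+ n :* ā ; g = b :* b̄ :- n :* n in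
          d :* P.α a ā b b̄ r :- # 0 := (:- (b :* r) :+ ā) :* (r :* d :- g) :+ (:- b) :* (r :* g :- (ā :* b̄ :+ n :* a))) refl a ā b b̄ r))
      β≡0 : β r ≡ 0#
      β≡0 = *-cancelˡ-0 d≢0 (combine₃ (ā * r + n + 1#) rd ā rg 1# D≡0
        (solve 5 (λ a ā b b̄ r → let n = P.n a ā b b̄ ; d = a :* b :+ n :* ā ; g = b :* b̄ :- n :* n in
          d :* P.β a ā b b̄ r :- # 0 := (ā :* r :+ n :+ # 1) :* (r :* d :- g) :+ ā :* (r :* g :- (ā :* b̄ :+ n :* a)) :+ # 1 :* (P.D a ā b b̄ :- # 0)) refl a ā b b̄ r))

  -- As a form in (x + y, x y, 1), K has the matrix M / 2 with M = [2n ā a; ā -2b 1-n; a 1-n -2b̄], and E is, up to sign, the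
  -- restriction of the dual conic adj M to the tangents (-y, 1, y²) of the conic J : s² = 4 p.  E = κ (s₂ y² + s₁ y + s₀)² means
  -- adj M = τ J - κ v vᵀ for v = (-s₁, s₀, s₂).  The equations below are entries of M adj M = 2 D, with (w₁ w₂ w₃) = κ M v.
  module Conic (square : IsSquare) (D≢0 : D ≢ 0#) where
    open SquareQuartic square

    τ w₁ w₂ w₃ : Carrier
    τ = a * ā - nat 2 * n * (1# - n) + κ * s₂ * s₀
    w₁ = κ * (ā * s₀ + a * s₂ - nat 2 * n * s₁)
    w₂ = κ * ((1# - n) * s₂ - ā * s₁ - nat 2 * b * s₀)
    w₃ = κ * ((1# - n) * s₀ - a * s₁ - nat 2 * b̄ * s₂)

    entry-ā : τ * ā ≡ w₁ * s₂
    entry-ā = combine₂ (- n) e₃≡ a e₄≡ (solve 8 (λ a ā b b̄ κ s₀ s₁ s₂ → let n = P.n a ā b b̄ in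
      (a :* ā :- # 2 :* n :* (# 1 :- n) :+ κ :* s₂ :* s₀) :* ā :- κ :* (ā :* s₀ :+ a :* s₂ :- # 2 :* n :* s₁) :* s₂ :=
      (:- n) :* (P.e₃ a ā b b̄ :- κ :* (# 2 :* s₁ :* s₂)) :+ a :* (P.e₄ a ā b b̄ :- κ :* (s₂ :* s₂))) refl a ā b b̄ κ s₀ s₁ s₂)

    entry-a : τ * a ≡ w₁ * s₀
    entry-a = combine₂ (- n) e₁≡ ā e₀≡ (solve 8 (λ a ā b b̄ κ s₀ s₁ s₂ → let n = P.n a ā b b̄ in
      (a :* ā :- # 2 :* n :* (# 1 :- n) :+ κ :* s₂ :* s₀) :* a :- κ :* (ā :* s₀ :+ a :* s₂ :- # 2 :* n :* s₁) :* s₀ :=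
      (:- n) :* (P.e₁ a ā b b̄ :- κ :* (# 2 :* s₀ :* s₁)) :+ ā :* (P.e₀ a ā b b̄ :- κ :* (s₀ :* s₀))) refl a ā b b̄ κ s₀ s₁ s₂)

    entry-b : τ * (- nat 2 * b) ≡ w₂ * s₂
    entry-b = *-cancelˡ 2≢0 (combine₂ (- ā) e₃≡ (nat 2 * (1# - n)) e₄≡ (solve 8 (λ a ā b b̄ κ s₀ s₁ s₂ → let n = P.n a ā b b̄ in
      # 2 :* ((a :* ā :- # 2 :* n :* (# 1 :- n) :+ κ :* s₂ :* s₀) :* (:- # 2 :* b)) :- # 2 :* (κ :* ((# 1 :- n) :* s₂ :- ā :* s₁ :- # 2 :* b :* s₀) :* s₂) :=
      (:- ā) :* (P.e₃ a ā b b̄ :- κ :* (# 2 :* s₁ :* s₂)) :+ (# 2 :* (# 1 :- n)) :* (P.e₄ a ā b b̄ :- κ :* (s₂ :* s₂))) refl a ā b b̄ κ s₀ s₁ s₂))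

    entry-b̄ : τ * (- nat 2 * b̄) ≡ w₃ * s₀
    entry-b̄ = *-cancelˡ 2≢0 (combine₂ (- a) e₁≡ (nat 2 * (1# - n)) e₀≡ (solve 8 (λ a ā b b̄ κ s₀ s₁ s₂ → let n = P.n a ā b b̄ in
      # 2 :* ((a :* ā :- # 2 :* n :* (# 1 :- n) :+ κ :* s₂ :* s₀) :* (:- # 2 :* b̄)) :- # 2 :* (κ :* ((# 1 :- n) :* s₀ :- a :* s₁ :- # 2 :* b̄ :* s₂) :* s₀) :=
      (:- a) :* (P.e₁ a ā b b̄ :- κ :* (# 2 :* s₀ :* s₁)) :+ (# 2 :* (# 1 :- n)) :* (P.e₀ a ā b b̄ :- κ :* (s₀ :* s₀))) refl a ā b b̄ κ s₀ s₁ s₂))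

    ν : Carrier
    ν = τ * (1# - n) - nat 2 * D

    entry-ν₂ : ν ≡ w₂ * s₀
    entry-ν₂ = *-cancelˡ 2≢0 (combine₂ (- ā) e₁≡ (- nat 4 * b) e₀≡ (solve 8 (λ a ā b b̄ κ s₀ s₁ s₂ → let n = P.n a ā b b̄ in
      # 2 :* ((a :* ā :- # 2 :* n :* (# 1 :- n) :+ κ :* s₂ :* s₀) :* (# 1 :- n) :- # 2 :* P.D a ā b b̄) :- # 2 :* (κ :* ((# 1 :- n) :* s₂ :- ā :* s₁ :- # 2 :* b :* s₀) :* s₀) :=
      (:- ā) :* (P.e₁ a ā b b̄ :- κ :* (# 2 :* s₀ :* s₁)) :+ (:- # 4 :* b) :* (P.e₀ a ā b b̄ :- κ :* (s₀ :* s₀))) refl a ā b b̄ κ s₀ s₁ s₂))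

    entry-ν₃ : ν ≡ w₃ * s₂
    entry-ν₃ = *-cancelˡ 2≢0 (combine₂ (- a) e₃≡ (- nat 4 * b̄) e₄≡ (solve 8 (λ a ā b b̄ κ s₀ s₁ s₂ → let n = P.n a ā b b̄ in
      # 2 :* ((a :* ā :- # 2 :* n :* (# 1 :- n) :+ κ :* s₂ :* s₀) :* (# 1 :- n) :- # 2 :* P.D a ā b b̄) :- # 2 :* (κ :* ((# 1 :- n) :* s₀ :- a :* s₁ :- # 2 :* b̄ :* s₂) :* s₂) :=
      (:- a) :* (P.e₃ a ā b b̄ :- κ :* (# 2 :* s₁ :* s₂)) :+ (:- # 4 :* b̄) :* (P.e₄ a ā b b̄ :- κ :* (s₂ :* s₂))) refl a ā b b̄ κ s₀ s₁ s₂))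

    entry-n : nat 4 * τ * n + nat 2 * D ≡ w₁ * s₁
    entry-n = *-cancelˡ 2≢0 (combine₃ (- nat 4 * n) e₂≡ ā e₁≡ a e₃≡ (solve 8 (λ a ā b b̄ κ s₀ s₁ s₂ → let n = P.n a ā b b̄ in
      # 2 :* (# 4 :* (a :* ā :- # 2 :* n :* (# 1 :- n) :+ κ :* s₂ :* s₀) :* n :+ # 2 :* P.D a ā b b̄) :- # 2 :* (κ :* (ā :* s₀ :+ a :* s₂ :- # 2 :* n :* s₁) :* s₁) :=
      (:- # 4 :* n) :* (P.e₂ a ā b b̄ :- κ :* (s₁ :* s₁ :+ # 2 :* s₀ :* s₂)) :+ ā :* (P.e₁ a ā b b̄ :- κ :* (# 2 :* s₀ :* s₁))
      :+ a :* (P.e₃ a ā b b̄ :- κ :* (# 2 :* s₁ :* s₂))) refl a ā b b̄ κ s₀ s₁ s₂))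

    entry-2ā : nat 2 * τ * ā ≡ w₂ * s₁
    entry-2ā = *-cancelˡ 2≢0 (combine₃ (- nat 2 * ā) e₂≡ (- nat 2 * b) e₁≡ (1# - n) e₃≡ (solve 8 (λ a ā b b̄ κ s₀ s₁ s₂ → let n = P.n a ā b b̄ in
      # 2 :* (# 2 :* (a :* ā :- # 2 :* n :* (# 1 :- n) :+ κ :* s₂ :* s₀) :* ā) :- # 2 :* (κ :* ((# 1 :- n) :* s₂ :- ā :* s₁ :- # 2 :* b :* s₀) :* s₁) :=
      (:- # 2 :* ā) :* (P.e₂ a ā b b̄ :- κ :* (s₁ :* s₁ :+ # 2 :* s₀ :* s₂)) :+ (:- # 2 :* b) :* (P.e₁ a ā b b̄ :- κ :* (# 2 :* s₀ :* s₁))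
      :+ (# 1 :- n) :* (P.e₃ a ā b b̄ :- κ :* (# 2 :* s₁ :* s₂))) refl a ā b b̄ κ s₀ s₁ s₂))

    -- If τ = 0, then ν = -2D is nonzero, so `entry-ν₂` and `entry-ν₃` make w₂ and s₂ nonzero, while
    -- `entry-b` says w₂ s₂ = 0.
    τ≢0 : τ ≢ 0#
    τ≢0 τ≡0 = *-nonzero w₂≢0 s₂≢0 (trans (sym entry-b) (trans (cong (_* (- nat 2 * b)) τ≡0) (zeroˡ _)))
      where
      ν≢0 : ν ≢ 0#
      ν≢0 ν≡0 = *-nonzero 2≢0 D≢0 (combine₂ (1# - n) τ≡0 (- 1#) ν≡0 (solve 3 (λ τ n d → # 2 :* d :- # 0 :=
        (# 1 :- n) :* (τ :- # 0) :+ (:- # 1) :* (τ :* (# 1 :- n) :- # 2 :* d :- # 0)) refl τ n D))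
      w₂≢0 : w₂ ≢ 0#
      w₂≢0 w₂≡0 = ν≢0 (trans entry-ν₂ (trans (cong (_* s₀) w₂≡0) (zeroˡ _)))
      s₂≢0 : s₂ ≢ 0#
      s₂≢0 s₂≡0 = ν≢0 (trans entry-ν₃ (trans (cong (w₃ *_) s₂≡0) (zeroʳ _)))

    -- The right sides of the entries form a rank one matrix, the products of the w's and the s's.
    -- Its 2 × 2 minors vanish; this and the next two are such minors, with nonzero factors
    -- cancelled.
    minor-ā : ā * ν ≡ - nat 2 * (a * b) * τ
    minor-ā = *-cancelˡ τ≢0 (combine₄ ν entry-ā (w₁ * s₂) entry-ν₂ (τ * (nat 2 * b)) entry-a (- (w₁ * s₀)) entry-b
      (solve 9 (λ τ a ā b ν w₁ w₂ s₀ s₂ → τ :* (ā :* ν) :- τ :* ((:- # 2) :* (a :* b) :* τ) :=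
        ν :* (τ :* ā :- w₁ :* s₂) :+ (w₁ :* s₂) :* (ν :- w₂ :* s₀) :+ (τ :* (# 2 :* b)) :* (τ :* a :- w₁ :* s₀)
        :+ (:- (w₁ :* s₀)) :* (τ :* ((:- # 2) :* b) :- w₂ :* s₂)) refl τ a ā b ν w₁ w₂ s₀ s₂))

    minor-a : a * ν ≡ - nat 2 * (ā * b̄) * τ
    minor-a = *-cancelˡ τ≢0 (combine₄ ν entry-a (w₁ * s₀) entry-ν₃ (τ * (nat 2 * b̄)) entry-ā (- (w₁ * s₂)) entry-b̄
      (solve 9 (λ τ a ā b̄ ν w₁ w₃ s₀ s₂ → τ :* (a :* ν) :- τ :* ((:- # 2) :* (ā :* b̄) :* τ) :=
        ν :* (τ :* a :- w₁ :* s₀) :+ (w₁ :* s₀) :* (ν :- w₃ :* s₂) :+ (τ :* (# 2 :* b̄)) :* (τ :* ā :- w₁ :* s₂)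
        :+ (:- (w₁ :* s₂)) :* (τ :* ((:- # 2) :* b̄) :- w₃ :* s₀)) refl τ a ā b̄ ν w₁ w₃ s₀ s₂))

    minor-b : - b * (nat 4 * τ * n + nat 2 * D) ≡ ā * ā * τ
    minor-b = *-cancelˡ (*-nonzero 2≢0 τ≢0) (combine₄ (nat 4 * τ * n + nat 2 * D) entry-b (w₂ * s₂) entry-n (- (nat 2 * τ * ā)) entry-ā (- (w₁ * s₂)) entry-2ā
      (solve 9 (λ τ ā b n d w₁ w₂ s₁ s₂ → # 2 :* τ :* ((:- b) :* (# 4 :* τ :* n :+ # 2 :* d)) :- # 2 :* τ :* (ā :* ā :* τ) :=
        (# 4 :* τ :* n :+ # 2 :* d) :* (τ :* ((:- # 2) :* b) :- w₂ :* s₂) :+ (w₂ :* s₂) :* (# 4 :* τ :* n :+ # 2 :* d :- w₁ :* s₁)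
        :+ (:- (# 2 :* τ :* ā)) :* (τ :* ā :- w₁ :* s₂) :+ (:- (w₁ :* s₂)) :* (# 2 :* τ :* ā :- w₂ :* s₁)) refl τ ā b n D w₁ w₂ s₁ s₂))

    a²b-real : a * a * b ≡ ā * ā * b̄
    a²b-real = *-cancelˡ (*-nonzero 2≢0 τ≢0) (combine₂ a minor-ā (- ā) minor-a
      (solve 6 (λ τ a ā b b̄ ν → # 2 :* τ :* (a :* a :* b) :- # 2 :* τ :* (ā :* ā :* b̄) :=
        a :* (ā :* ν :- (:- # 2) :* (a :* b) :* τ) :+ (:- ā) :* (a :* ν :- (:- # 2) :* (ā :* b̄) :* τ)) refl τ a ā b b̄ ν))

    -- In a combination of `minor-b` and `minor-ā` the determinant D cancels and τ factors out.
    cubic : ā * ā * ā + b * ā * (1# + nat 3 * n) + nat 2 * a * b * b ≡ 0#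
    cubic = *-cancelˡ-0 τ≢0 (combine₂ (- ā) minor-b b minor-ā
      (solve 6 (λ τ a ā b n d → τ :* (ā :* ā :* ā :+ b :* ā :* (# 1 :+ # 3 :* n) :+ # 2 :* a :* b :* b) :- # 0 :=
        (:- ā) :* ((:- b) :* (# 4 :* τ :* n :+ # 2 :* d) :- ā :* ā :* τ)
        :+ b :* (ā :* (τ :* (# 1 :- n) :- # 2 :* d) :- (:- # 2) :* (a :* b) :* τ)) refl τ a ā b n D))

    -- As n = a ā - b b̄, the product differs from a times the left side of `cubic` only by b (a² b
    -- - ā² b̄).
    families : (ā + nat 3 * (a * b)) * (a * b + n * ā) ≡ 0#
    families = combine₂ a cubic b a²b-real (solve 4 (λ a ā b b̄ → let n = P.n a ā b b̄ in
      (ā :+ # 3 :* (a :* b)) :* (a :* b :+ n :* ā) :- # 0 :=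
      a :* (ā :* ā :* ā :+ b :* ā :* (# 1 :+ # 3 :* n) :+ # 2 :* a :* b :* b :- # 0) :+ b :* (a :* a :* b :- ā :* ā :* b̄)) refl a ā b b̄)

  quotient-square : ∀ {c w z} → conj w ≡ w → conj z ≡ z → z ≢ 0# → c * (w * w) ≡ z * z → IsNonzeroSquareIn𝔽 F q c
  quotient-square {c} {w} {z} w-real z-real z≢0 eq = z * w ⁻¹
    , trans (conj-* z (w ⁻¹)) (cong₂ _*_ z-real (trans (conj-⁻¹ w≢0) (cong _⁻¹ w-real)))
    , *-nonzero z≢0 (⁻¹-nonzero w≢0)
    , combine₂ (- (w ⁻¹ * w ⁻¹)) eq (c * (w * w ⁻¹ + 1#)) (inverseʳ w w≢0)
        (solve 4 (λ c w z i → z :* i :* (z :* i) :- c := (:- (i :* i)) :* (c :* (w :* w) :- z :* z) :+ (c :* (w :* i :+ # 1)) :* (w :* i :- # 1)) refl c w z (w ⁻¹))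
    where
    w≢0 : w ≢ 0#
    w≢0 w≡0 = *-nonzero z≢0 z≢0 (trans (sym eq) (trans (cong (λ t → c * (t * t)) w≡0) (solve 1 (λ c → c :* (# 0 :* # 0) := # 0) refl c)))

  Family₁Condition Family₂Condition : Set
  Family₁Condition = a * b + n * ā ≡ 0# × IsNonzeroSquareIn𝔽 F q discriminant
  Family₂Condition = ā + nat 3 * (a * b) ≡ 0# × IsNonzeroSquareIn𝔽 F q (- nat 3 * discriminant)

  -- The equations come from the conic. For the square condition one point of the circle with E(y) /
  -- y² a nonzero square is enough, since this value is, up to a square, the discriminant in
  -- question times a square of the subfield.
  no-collision⇒families : NoCollision → Family₁Condition ⊎ Family₂Condition
  no-collision⇒families nc = equation (D ≟ 0#)
    where
    family₁ : a * b + n * ā ≡ 0# → Family₁Condition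
    family₁ condition = condition , square (square-at nc)
      where
      open Family₁ condition
      square : (∃ λ y → Unit y × SquareAt y) → IsNonzeroSquareIn𝔽 F q discriminant
      square (y , u , z , z≢0 , z-real , e≡zz) = quotient-square (conj-quotient u (conj-β u)) z-real z≢0
        (trans (solve 3 (λ c β ȳ → c :* (β :* ȳ :* (β :* ȳ)) := c :* (β :* β) :* (ȳ :* ȳ)) refl discriminant (β y) (conj y))
          (trans (cong (_* (conj y * conj y)) (sym (E≡discriminant*β² y))) e≡zz))
    family₂ : ā + nat 3 * (a * b) ≡ 0# → Family₂Condition
    family₂ condition = condition , square (square-at nc)
      where
      open Family₂ condition
      square : (∃ λ y → Unit y × SquareAt y) → IsNonzeroSquareIn𝔽 F q discriminant₂
      square (y , u , z , z≢0 , z-real , e≡zz) = quotient-square {z = nat 3 * z} (conj-quotient u (conj-s u))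
        (trans (conj-* (nat 3) z) (cong₂ _*_ (conj-nat 3) z-real)) (*-nonzero nat3≢0 z≢0)
        (combine₂ (- (conj y * conj y)) (9E≡discriminant₂*s² y) (nat 9) e≡zz
          (solve 5 (λ c s ȳ e z → c :* (s :* ȳ :* (s :* ȳ)) :- # 3 :* z :* (# 3 :* z) :=
            (:- (ȳ :* ȳ)) :* (# 9 :* e :- c :* (s :* s)) :+ # 9 :* (e :* (ȳ :* ȳ) :- z :* z)) refl discriminant₂ (s y) (conj y) (E y) z))
    equation : Dec (D ≡ 0#) → Family₁Condition ⊎ Family₂Condition
    equation (yes D≡0) = inj₁ (family₁ (D≡0⇒family₁ nc D≡0))
    equation (no D≢0) = split (x*y≡0 (Conic.families (is-square nc) D≢0))
      where
      split : ā + nat 3 * (a * b) ≡ 0# ⊎ a * b + n * ā ≡ 0# → Family₁Condition ⊎ Family₂Condition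
      split (inj₁ condition) = inj₂ (family₂ condition)
      split (inj₂ condition) = inj₁ (family₁ condition)

  families⇒no-collision : Family₁Condition ⊎ Family₂Condition → NoCollision
  families⇒no-collision (inj₁ (condition , square)) = family₁⇒no-collision condition square
  families⇒no-collision (inj₂ (condition , square)) = family₂⇒no-collision condition square

  -- Translation to the exponents of the theorem.

  ^-q+1 : ∀ x → x ^ (q ℕ.+ 1) ≡ x * conj x
  ^-q+1 x = trans (^-+ x q 1) (trans (cong (conj x *_) (*-identityʳ x)) (*-comm (conj x) x))

  ^-q∸1 : ∀ x → x * x ^ (q ℕ.∸ 1) ≡ conj x
  ^-q∸1 x = trans (cong (λ k → x * x ^ k) q∸1) (sym (conj≡* x))

  discriminant-^ : 1# - fromℕ F 4 * (b * a ⁻¹) ^ (q ℕ.+ 1) ≡ discriminant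
  discriminant-^ = cong₂ (λ s t → 1# - s * t) (sym (nat≡fromℕ 4)) (^-q+1 (b * a ⁻¹))

  -- Conjugation carries the equation of the theorem, which reads ā b̄ = -n a, to the one used
  -- above.
  family₁-^ : (conj a * conj b ≡ a * (b ^ (q ℕ.+ 1) - a ^ (q ℕ.+ 1))) ⇔ (a * b + n * ā ≡ 0#)
  family₁-^ = mk⇔
    (λ eq → trans (cong₂ _+_ (sym (trans (conj-* ā b̄) (cong₂ _*_ conj-ā conj-b̄))) (sym (trans (conj-* n a) (cong (_* ā) conj-n))))
      (trans (sym (conj-+ (ā * b̄) (n * a))) (trans (cong conj (combine₁ 1# (trans eq rhs≡)
        (solve 3 (λ s n a → s :+ n :* a :- # 0 := # 1 :* (s :- (:- (n :* a)))) refl (ā * b̄) n a))) conj-0)))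
    (λ condition → trans (combine₁ 1# (Family₁.condition-conj condition)
      (solve 3 (λ s n a → s :- (:- (n :* a)) := # 1 :* (s :+ n :* a :- # 0)) refl (ā * b̄) n a)) (sym rhs≡))
    where
    rhs≡ : a * (b ^ (q ℕ.+ 1) - a ^ (q ℕ.+ 1)) ≡ - (n * a)
    rhs≡ = trans (cong₂ (λ s t → a * (s - t)) (^-q+1 b) (^-q+1 a))
      (solve 4 (λ a ā b b̄ → a :* (b :* b̄ :- a :* ā) := :- (P.n a ā b b̄ :* a)) refl a ā b b̄)

  family₂-^ : (a ^ (q ℕ.∸ 1) + fromℕ F 3 * b ≡ 0#) ⇔ (ā + nat 3 * (a * b) ≡ 0#)
  family₂-^ = mk⇔ (λ eq → trans (sym a*≡) (trans (cong (a *_) eq) (zeroʳ a))) (λ condition → *-cancelˡ-0 a≢0 (trans a*≡ condition))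
    where
    a*≡ : a * (a ^ (q ℕ.∸ 1) + fromℕ F 3 * b) ≡ ā + nat 3 * (a * b)
    a*≡ = trans (distribˡ a _ _) (cong₂ _+_ (^-q∸1 a) (trans (cong (λ t → a * (t * b)) (sym (nat≡fromℕ 3)))
      (solve 3 (λ a t b → a :* (t :* b) := t :* (a :* b)) refl a (nat 3) b)))

  permutation⇔families : IsPermutation F f ⇔
    ((conj a * conj b ≡ a * (b ^ (q ℕ.+ 1) - a ^ (q ℕ.+ 1)) × IsNonzeroSquareIn𝔽 F q (1# - fromℕ F 4 * (b * a ⁻¹) ^ (q ℕ.+ 1)))
    ⊎ (a ^ (q ℕ.∸ 1) + fromℕ F 3 * b ≡ 0# × IsNonzeroSquareIn𝔽 F q (- fromℕ F 3 * (1# - fromℕ F 4 * (b * a ⁻¹) ^ (q ℕ.+ 1)))))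
  permutation⇔families = mk⇔
    (λ (f-injective , _) → Sum.map
      (λ (e , s) → Equivalence.from family₁-^ e , subst Square (sym discriminant-^) s)
      (λ (e , s) → Equivalence.from family₂-^ e , subst Square (sym discriminant₂-^) s)
      (no-collision⇒families (injective⇒no-collision f-injective)))
    (λ conditions → injective⇒bijective (no-collision⇒injective (families⇒no-collision (Sum.map
      (λ (e , s) → Equivalence.to family₁-^ e , subst Square discriminant-^ s)
      (λ (e , s) → Equivalence.to family₂-^ e , subst Square discriminant₂-^ s) conditions))))
    where
    Square = IsNonzeroSquareIn𝔽 F q
    discriminant₂-^ : - fromℕ F 3 * (1# - fromℕ F 4 * (b * a ⁻¹) ^ (q ℕ.+ 1)) ≡ - nat 3 * discriminant
    discriminant₂-^ = cong₂ (λ s t → - s * t) (sym (nat≡fromℕ 3)) discriminant-^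

open import Data.Nat using (ℕ; _<_; _≤_; _^_; _*_; _∸_; _+_)

mainTheorem1 : (p h : ℕ) → Prime p → 3 < p → 1 ≤ h →
    (F : FiniteField) → FiniteField.size F ≡ (p ^ h) ^ 2 →
    (a b : FiniteField.Carrier F) → a ≢ FiniteField.0# F → b ≢ FiniteField.0# F →
    IsPermutation F (λ x → FiniteField._*_ F x
    (FiniteField._+_ F (FiniteField._+_ F (FiniteField.1# F)
    (FiniteField._*_ F a (pow F x ((p ^ h) * ((p ^ h) ∸ 1)))))
    (FiniteField._*_ F b (pow F x (2 * ((p ^ h) ∸ 1))))))
    ⇔
    ((FiniteField._*_ F (pow F a (p ^ h)) (pow F b (p ^ h))
    ≡ FiniteField._*_ F a (sub F (pow F b ((p ^ h) + 1)) (pow F a ((p ^ h) + 1)))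
    × IsNonzeroSquareIn𝔽 F (p ^ h)
    (sub F (FiniteField.1# F)
    (FiniteField._*_ F (fromℕ F 4)
    (pow F (FiniteField._*_ F b (FiniteField._⁻¹ F a)) ((p ^ h) + 1)))))
    ⊎
    (FiniteField._+_ F (pow F a ((p ^ h) ∸ 1)) (FiniteField._*_ F (fromℕ F 3) b)
    ≡ FiniteField.0# F
    × IsNonzeroSquareIn𝔽 F (p ^ h)
    (FiniteField._*_ F (FiniteField.-_ F (fromℕ F 3))
    (sub F (FiniteField.1# F)
    (FiniteField._*_ F (fromℕ F 4)
    (pow F (FiniteField._*_ F b (FiniteField._⁻¹ F a)) ((p ^ h) + 1)))))))
mainTheorem1 p h p-prime 3<p 1≤h F size≡ a b a≢0 b≢0 = permutation⇔families
  where
  open PrimePower F p-prime 3<p 1≤h size≡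
  3≢0 : fromℕ F 3 ≢ FiniteField.0# F
  3≢0 eq = nat-nonzero {2} (s≤s (s≤s (s≤s z≤n))) (trans (SeriesProperties.nat≡fromℕ F 3) eq)
  open Trinomial F (p ^ h) (proj₁ odd-power) (proj₂ odd-power) 2≤half size≡ 3≢0 (^-p^-+ h) a b a≢0 b≢0
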